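{- Let $k\ge 22$ be an integer and let $n=2k+2$. Let $G$ be a connected $\{C_3,C_4\}$-free graph of order $n$ with no pendant vertices. Then $q(G)\le q'(n)$, where $q'(n)$ is the largest root of $$x^5-\tfrac12(n+18)x^4+\tfrac32(3n+16)x^3-\tfrac12(27n+20)x^2+4(4n-9)x-6n+24=0.$$ Moreover, equality $q(G)=q'(n)$ holds if and only if $G\cong T_{\frac{n-2}{2}}$.
   Context: All graphs are finite, simple, undirected and connected. The order of a graph is its number of vertices. A pendant vertex is a vertex of degree $1$. $C_r$ is the cycle on $r$ vertices. A graph is $\mathcal F$-free if it contains no member of the family $\mathcal F$ as a (not necessarily induced) subgraph. $q(G)$ denotes the signless Laplacian spectral radius of $G$, i.e. the largest eigenvalue of $Q(G)=D(G)+A(G)$, where $A(G)$ is the adjacency matrix and $D(G)$ the diagonal matrix of vertex degrees. For $r\ge 3$, the theta graph $\theta(2,3^{\,r-1})$ consists of two distinct vertices $x,y$ (the terminal vertices) joined by one path of length $2$ and $r-1$ paths of length $3$ (length = number of edges), all these paths being internally disjoint. Let $P_1,P_2$ be two distinct of these $x$–$y$ paths of length $3$. The graph $T_r$, of order $2r+2$, is obtained from $\theta(2,3^{\,r-1})$ by adding a new vertex $w$ and making $w$ adjacent to exactly two vertices: the neighbor of $x$ on $P_1$ and the neighbor of $y$ on $P_2$. -}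

module Defs where

open import Algebra.Bundles.Raw using (RawRing)
open import Data.Bool.Base using (Bool; true; false; _∨_; _∧_; if_then_else_)
open import Data.Bool.Properties using (∨-comm)
open import Data.Fin.Base using (Fin; zero; suc; toℕ)
import Data.Fin.Properties as Fin
import Data.Fin.Subset as Subset
open import Data.Integer.Base as ℤ using (+_)
open import Data.List.Base using (List)
open import Data.List.Relation.Unary.All using (All)
open import Data.Maybe.Base using (Maybe; just; nothing)
open import Data.Nat.Base as ℕ using (ℕ; zero; suc; s≤s; z≤n; _≡ᵇ_)
import Data.Nat.Properties as ℕ
open import Data.Product.Base using (Σ-syntax; ∃-syntax; _×_; _,_; proj₁; proj₂)
open import Data.Rational.Base as ℚ using (ℚ; 0ℚ; 1ℚ; ½; ∣_∣; _/_)
import Data.Rational.Properties as ℚ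
open import Data.Rational.Solver using (module +-*-Solver)
import Data.Vec.Base as Vec
open import Function.Bundles using (_↔_; Inverse)
open import Function.Definitions using (Injective)
open import Relation.Binary.Construct.Closure.ReflexiveTransitive using (Star)
open import Relation.Binary.PropositionalEquality
open import Relation.Nullary.Decidable using (⌊_⌋)
open import Relation.Nullary.Negation using (¬_)

------------------------------------------------------------------------
-- Real numbers: Cauchy sequences of rationals, up to the equivalence _≃_

IsCauchy : (ℕ → ℚ) → Set
IsCauchy x = ∀ ε → 0ℚ ℚ.< ε →
  ∃[ N ] ∀ m n → N ℕ.≤ m → N ℕ.≤ n → ∣ x m ℚ.- x n ∣ ℚ.≤ ε

record ℝ : Set where
  constructor mkℝ
  field
    seq    : ℕ → ℚ
    cauchy : IsCauchy seq

open ℝ public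

infix 4 _≃_ _≤ℝ_

_≃_ : ℝ → ℝ → Set
x ≃ y = ∀ ε → 0ℚ ℚ.< ε →
  ∃[ N ] ∀ n → N ℕ.≤ n → ∣ seq x n ℚ.- seq y n ∣ ℚ.≤ ε

_≤ℝ_ : ℝ → ℝ → Set
x ≤ℝ y = ∀ ε → 0ℚ ℚ.< ε →
  ∃[ N ] ∀ n → N ℕ.≤ n → seq x n ℚ.≤ seq y n ℚ.+ ε

fromℚ : ℚ → ℝ
fromℚ q = mkℝ (λ _ → q) λ ε 0<ε → 0 , λ _ _ _ _ →
  subst (ℚ._≤ ε) (sym (cong ∣_∣ (ℚ.+-inverseʳ q))) (ℚ.<⇒≤ 0<ε)

abstract
  0<½*_ : ∀ {ε} → 0ℚ ℚ.< ε → 0ℚ ℚ.< ½ ℚ.* ε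
  0<½*_ {ε} 0<ε = subst (ℚ._< ½ ℚ.* ε) (ℚ.*-zeroʳ ½) (ℚ.*-monoʳ-<-pos ½ 0<ε)

  ½+½ : ∀ ε → ½ ℚ.* ε ℚ.+ ½ ℚ.* ε ≡ ε
  ½+½ ε = trans (sym (ℚ.*-distribʳ-+ ε ½ ½)) (ℚ.*-identityˡ ε)

  +-cauchy : ∀ x y → IsCauchy x → IsCauchy y → IsCauchy λ n → x n ℚ.+ y n
  +-cauchy x y cx cy ε 0<ε with cx (½ ℚ.* ε) (0<½* 0<ε) | cy (½ ℚ.* ε) (0<½* 0<ε)
  ... | N₁ , h₁ | N₂ , h₂ = N₁ ℕ.⊔ N₂ , λ m n N≤m N≤n → begin
    ∣ (x m ℚ.+ y m) ℚ.- (x n ℚ.+ y n) ∣       ≡⟨ cong ∣_∣ (regroup (x m) (y m) (x n) (y n)) ⟩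
    ∣ (x m ℚ.- x n) ℚ.+ (y m ℚ.- y n) ∣       ≤⟨ ℚ.∣p+q∣≤∣p∣+∣q∣ (x m ℚ.- x n) (y m ℚ.- y n) ⟩
    ∣ x m ℚ.- x n ∣ ℚ.+ ∣ y m ℚ.- y n ∣       ≤⟨ ℚ.+-mono-≤
        (h₁ m n (ℕ.m⊔n≤o⇒m≤o N₁ N₂ N≤m) (ℕ.m⊔n≤o⇒m≤o N₁ N₂ N≤n))
        (h₂ m n (ℕ.m⊔n≤o⇒n≤o N₁ N₂ N≤m) (ℕ.m⊔n≤o⇒n≤o N₁ N₂ N≤n)) ⟩
    ½ ℚ.* ε ℚ.+ ½ ℚ.* ε                       ≡⟨ ½+½ ε ⟩
    ε                                         ∎
    where
    open ℚ.≤-Reasoning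
    regroup : ∀ a b c d → (a ℚ.+ b) ℚ.- (c ℚ.+ d) ≡ (a ℚ.- c) ℚ.+ (b ℚ.- d)
    regroup = solve 4 (λ a b c d → (a :+ b) :- (c :+ d) := (a :- c) :+ (b :- d)) refl
      where open +-*-Solver

  neg-cauchy : ∀ x → IsCauchy x → IsCauchy λ n → ℚ.- x n
  neg-cauchy x cx ε 0<ε with cx ε 0<ε
  ... | N , h = N , λ m n N≤m N≤n → begin
    ∣ ℚ.- x m ℚ.- ℚ.- x n ∣  ≡⟨ cong ∣_∣ (regroup (x m) (x n)) ⟩
    ∣ ℚ.- (x m ℚ.- x n) ∣    ≡⟨ ℚ.∣-p∣≡∣p∣ (x m ℚ.- x n) ⟩
    ∣ x m ℚ.- x n ∣          ≤⟨ h m n N≤m N≤n ⟩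
    ε                        ∎
    where
    open ℚ.≤-Reasoning
    regroup : ∀ a b → ℚ.- a ℚ.- ℚ.- b ≡ ℚ.- (a ℚ.- b)
    regroup = solve 2 (λ a b → :- a :- :- b := :- (a :- b)) refl
      where open +-*-Solver

  eventuallyBounded : ∀ {x} → IsCauchy x →
    ∃[ N ] Σ[ b ∈ ℚ ] (0ℚ ℚ.< b × (∀ n → N ℕ.≤ n → ∣ x n ∣ ℚ.≤ b))
  eventuallyBounded {x} cx with cx 1ℚ (ℚ.positive⁻¹ 1ℚ)
  ... | N , h = N , 1ℚ ℚ.+ ∣ x N ∣ ,
    ℚ.<-≤-trans (ℚ.positive⁻¹ 1ℚ)
      (subst (ℚ._≤ 1ℚ ℚ.+ ∣ x N ∣) (ℚ.+-identityʳ 1ℚ) (ℚ.+-monoʳ-≤ 1ℚ (ℚ.0≤∣p∣ (x N)))) ,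
    λ n N≤n → begin
      ∣ x n ∣                          ≡⟨ cong ∣_∣ (regroup (x n) (x N)) ⟩
      ∣ (x n ℚ.- x N) ℚ.+ x N ∣        ≤⟨ ℚ.∣p+q∣≤∣p∣+∣q∣ (x n ℚ.- x N) (x N) ⟩
      ∣ x n ℚ.- x N ∣ ℚ.+ ∣ x N ∣      ≤⟨ ℚ.+-monoˡ-≤ ∣ x N ∣ (h n N N≤n ℕ.≤-refl) ⟩
      1ℚ ℚ.+ ∣ x N ∣                   ∎
    where
    open ℚ.≤-Reasoning
    regroup : ∀ a b → a ≡ (a ℚ.- b) ℚ.+ b
    regroup = solve 2 (λ a b → a := (a :- b) :+ b) refl
      where open +-*-Solver

  scale : ∀ b ε → 0ℚ ℚ.< b → 0ℚ ℚ.< ε → Σ[ δ ∈ ℚ ] (0ℚ ℚ.< δ × b ℚ.* δ ≡ ε)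
  scale b ε 0<b 0<ε = b⁻¹ ℚ.* ε ,
    ℚ.positive⁻¹ (b⁻¹ ℚ.* ε) {{ℚ.pos*pos⇒pos b⁻¹ {{ℚ.1/pos⇒pos b}} ε}} ,
    trans (sym (ℚ.*-assoc b b⁻¹ ε))
      (trans (cong (ℚ._* ε) (ℚ.*-inverseʳ b)) (ℚ.*-identityˡ ε))
    where
    instance
      b>0 : ℚ.Positive b
      b>0 = ℚ.positive 0<b
      ε>0 : ℚ.Positive ε
      ε>0 = ℚ.positive 0<ε
      b≢0 : ℚ.NonZero b
      b≢0 = ℚ.pos⇒nonZero b
    b⁻¹ : ℚ
    b⁻¹ = ℚ.1/ b

  *-mono-∣∣ : ∀ p q {b c} → ∣ p ∣ ℚ.≤ b → 0ℚ ℚ.< b → ∣ q ∣ ℚ.≤ c → ∣ p ℚ.* q ∣ ℚ.≤ b ℚ.* c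
  *-mono-∣∣ p q {b} {c} p≤b 0<b q≤c = begin
    ∣ p ℚ.* q ∣      ≡⟨ ℚ.∣p*q∣≡∣p∣*∣q∣ p q ⟩
    ∣ p ∣ ℚ.* ∣ q ∣  ≤⟨ ℚ.*-monoʳ-≤-nonNeg ∣ q ∣ {{ℚ.nonNegative (ℚ.0≤∣p∣ q)}} p≤b ⟩
    b ℚ.* ∣ q ∣      ≤⟨ ℚ.*-monoˡ-≤-nonNeg b {{ℚ.nonNegative (ℚ.<⇒≤ 0<b)}} q≤c ⟩
    b ℚ.* c          ∎
    where open ℚ.≤-Reasoning

  *-cauchy-from : ∀ {x y} → IsCauchy x → IsCauchy y → ∀ {M₁ M₂} b c →
    (∀ n → M₁ ℕ.≤ n → ∣ x n ∣ ℚ.≤ b) → 0ℚ ℚ.< b →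
    (∀ n → M₂ ℕ.≤ n → ∣ y n ∣ ℚ.≤ c) → 0ℚ ℚ.< c →
    ∀ ε δ η → 0ℚ ℚ.< δ → 0ℚ ℚ.< η → b ℚ.* δ ≡ ½ ℚ.* ε → c ℚ.* η ≡ ½ ℚ.* ε →
    ∃[ N ] ∀ m n → N ℕ.≤ m → N ℕ.≤ n → ∣ x m ℚ.* y m ℚ.- x n ℚ.* y n ∣ ℚ.≤ ε
  *-cauchy-from {x} {y} cx cy {M₁} {M₂} b c x≤b 0<b y≤c 0<c ε δ η 0<δ 0<η bδ cη =
    (M₁ ℕ.⊔ M₂) ℕ.⊔ (N₁ ℕ.⊔ N₂) , λ m n N≤m N≤n →
      let M≤m = ℕ.m⊔n≤o⇒m≤o (M₁ ℕ.⊔ M₂) (N₁ ℕ.⊔ N₂) N≤m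
          M≤n = ℕ.m⊔n≤o⇒m≤o (M₁ ℕ.⊔ M₂) (N₁ ℕ.⊔ N₂) N≤n
          K≤m = ℕ.m⊔n≤o⇒n≤o (M₁ ℕ.⊔ M₂) (N₁ ℕ.⊔ N₂) N≤m
          K≤n = ℕ.m⊔n≤o⇒n≤o (M₁ ℕ.⊔ M₂) (N₁ ℕ.⊔ N₂) N≤n
      in estimate (x m) (y m) (x n) (y n)
           (x≤b m (ℕ.m⊔n≤o⇒m≤o M₁ M₂ M≤m))
           (y≤c n (ℕ.m⊔n≤o⇒n≤o M₁ M₂ M≤n))
           (proj₂ (cy δ 0<δ) m n (ℕ.m⊔n≤o⇒m≤o N₁ N₂ K≤m) (ℕ.m⊔n≤o⇒m≤o N₁ N₂ K≤n))
           (proj₂ (cx η 0<η) m n (ℕ.m⊔n≤o⇒n≤o N₁ N₂ K≤m) (ℕ.m⊔n≤o⇒n≤o N₁ N₂ K≤n))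
    where
    open ℚ.≤-Reasoning
    N₁ N₂ : ℕ
    N₁ = proj₁ (cy δ 0<δ)
    N₂ = proj₁ (cx η 0<η)

    regroup : ∀ a b c d →
      a ℚ.* b ℚ.- c ℚ.* d ≡ a ℚ.* (b ℚ.- d) ℚ.+ d ℚ.* (a ℚ.- c)
    regroup = solve 4 (λ a b c d → a :* b :- c :* d := a :* (b :- d) :+ d :* (a :- c)) refl
      where open +-*-Solver

    estimate : ∀ p q r s → ∣ p ∣ ℚ.≤ b → ∣ s ∣ ℚ.≤ c →
      ∣ q ℚ.- s ∣ ℚ.≤ δ → ∣ p ℚ.- r ∣ ℚ.≤ η → ∣ p ℚ.* q ℚ.- r ℚ.* s ∣ ℚ.≤ ε
    estimate p q r s p≤b s≤c q-s p-r = begin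
      ∣ p ℚ.* q ℚ.- r ℚ.* s ∣
        ≡⟨ cong ∣_∣ (regroup p q r s) ⟩
      ∣ p ℚ.* (q ℚ.- s) ℚ.+ s ℚ.* (p ℚ.- r) ∣
        ≤⟨ ℚ.∣p+q∣≤∣p∣+∣q∣ (p ℚ.* (q ℚ.- s)) (s ℚ.* (p ℚ.- r)) ⟩
      ∣ p ℚ.* (q ℚ.- s) ∣ ℚ.+ ∣ s ℚ.* (p ℚ.- r) ∣
        ≤⟨ ℚ.+-mono-≤ (*-mono-∣∣ p (q ℚ.- s) p≤b 0<b q-s) (*-mono-∣∣ s (p ℚ.- r) s≤c 0<c p-r) ⟩
      b ℚ.* δ ℚ.+ c ℚ.* η
        ≡⟨ cong₂ ℚ._+_ bδ cη ⟩
      ½ ℚ.* ε ℚ.+ ½ ℚ.* ε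
        ≡⟨ ½+½ ε ⟩
      ε ∎

  *-cauchy : ∀ x y → IsCauchy x → IsCauchy y → IsCauchy λ n → x n ℚ.* y n
  *-cauchy x y cx cy ε 0<ε =
    let M₁ , b , 0<b , x≤b = eventuallyBounded {x} cx
        M₂ , c , 0<c , y≤c = eventuallyBounded {y} cy
        δ , 0<δ , bδ = scale b (½ ℚ.* ε) 0<b (0<½* 0<ε)
        η , 0<η , cη = scale c (½ ℚ.* ε) 0<c (0<½* 0<ε)
    in *-cauchy-from {x} {y} cx cy {M₁} {M₂} b c x≤b 0<b y≤c 0<c ε δ η 0<δ 0<η bδ cη

infixl 6 _+ℝ_ _-ℝ_
infixl 7 _*ℝ_
infix  8 -ℝ_

_+ℝ_ : ℝ → ℝ → ℝ
x +ℝ y = mkℝ (λ n → seq x n ℚ.+ seq y n) (+-cauchy (seq x) (seq y) (cauchy x) (cauchy y))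

-ℝ_ : ℝ → ℝ
-ℝ x = mkℝ (λ n → ℚ.- seq x n) (neg-cauchy (seq x) (cauchy x))

_-ℝ_ : ℝ → ℝ → ℝ
x -ℝ y = x +ℝ -ℝ y

_*ℝ_ : ℝ → ℝ → ℝ
x *ℝ y = mkℝ (λ n → seq x n ℚ.* seq y n) (*-cauchy (seq x) (seq y) (cauchy x) (cauchy y))

0ℝ 1ℝ : ℝ
0ℝ = fromℚ 0ℚ
1ℝ = fromℚ 1ℚ

ℝ-rawRing : RawRing _ _
ℝ-rawRing = record
  { Carrier = ℝ
  ; _≈_     = _≃_
  ; _+_     = _+ℝ_
  ; _*_     = _*ℝ_
  ; -_      = -ℝ_
  ; 0#      = 0ℝ
  ; 1#      = 1ℝ
  }

open import Algebra.Definitions.RawSemiring (RawRing.rawSemiring ℝ-rawRing) public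
  using (sum) renaming (_^_ to _^ℝ_)

IsLargestRoot : (ℝ → ℝ) → ℝ → Set
IsLargestRoot f x = f x ≃ 0ℝ × (∀ y → f y ≃ 0ℝ → y ≤ℝ x)

------------------------------------------------------------------------
-- Matrices and eigenvalues

Matrix : ℕ → Set
Matrix n = Fin n → Fin n → ℝ

IsEigenvalue : ∀ {n} → Matrix n → ℝ → Set
IsEigenvalue {n} M μ = Σ[ v ∈ (Fin n → ℝ) ]
  (¬ (∀ i → v i ≃ 0ℝ) × (∀ i → sum (λ j → M i j *ℝ v j) ≃ μ *ℝ v i))

IsLargestEigenvalue : ∀ {n} → Matrix n → ℝ → Set
IsLargestEigenvalue M μ = IsEigenvalue M μ × (∀ ν → IsEigenvalue M ν → ν ≤ℝ μ)

------------------------------------------------------------------------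
-- Graphs

record Graph (V : Set) : Set where
  field
    adj    : V → V → Bool
    symm   : ∀ u v → adj u v ≡ adj v u
    irrefl : ∀ v → adj v v ≡ false

open Graph public

Adj : ∀ {V} → Graph V → V → V → Set
Adj G u v = adj G u v ≡ true

Connected : ∀ {V} → Graph V → Set
Connected G = ∀ u v → Star (Adj G) u v

degree : ∀ {n} → Graph (Fin n) → Fin n → ℕ
degree G v = Subset.∣ Vec.tabulate (adj G v) ∣

IsPendant : ∀ {n} → Graph (Fin n) → Fin n → Set
IsPendant G v = degree G v ≡ 1

infix 4 _≅_

_≅_ : ∀ {V W} → Graph V → Graph W → Set
_≅_ {V} {W} G H = Σ[ f ∈ V ↔ W ]
  (∀ u v → adj G u v ≡ adj H (Inverse.to f u) (Inverse.to f v))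

ContainsSubgraph : ∀ {V W} → Graph V → Graph W → Set
ContainsSubgraph {V} {W} G H = Σ[ f ∈ (W → V) ]
  (Injective _≡_ _≡_ f × (∀ {u v} → Adj H u v → Adj G (f u) (f v)))

FiniteGraph : Set
FiniteGraph = Σ[ m ∈ ℕ ] Graph (Fin m)

Free : ∀ {V} → List FiniteGraph → Graph V → Set
Free 𝓕 G = All (λ H → ¬ ContainsSubgraph G (proj₂ H)) 𝓕

------------------------------------------------------------------------
-- The signless Laplacian

adjacencyMatrix : ∀ {n} → Graph (Fin n) → Matrix n
adjacencyMatrix G i j = if adj G i j then 1ℝ else 0ℝ

degreeMatrix : ∀ {n} → Graph (Fin n) → Matrix n
degreeMatrix G i j = if ⌊ i Fin.≟ j ⌋ then fromℚ (+ degree G i / 1) else 0ℝ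

signlessLaplacian : ∀ {n} → Graph (Fin n) → Matrix n
signlessLaplacian G i j = degreeMatrix G i j +ℝ adjacencyMatrix G i j

IsSignlessLaplacianSpectralRadius : ∀ {n} → Graph (Fin n) → ℝ → Set
IsSignlessLaplacianSpectralRadius G q = IsLargestEigenvalue (signlessLaplacian G) q

------------------------------------------------------------------------
-- Particular graphs

undirected : ∀ {V} (E : V → V → Bool) → (∀ v → E v v ≡ false) → Graph V
undirected E E-irrefl = record
  { adj    = λ u v → E u v ∨ E v u
  ; symm   = λ u v → ∨-comm (E u v) (E v u)
  ; irrefl = λ v → cong₂ _∨_ (E-irrefl v) (E-irrefl v)
  }

-- i → i + 1 for i < r - 1, and r - 1 → 0
cycleEdge : ∀ r → Fin r → Fin r → Bool
cycleEdge r i j = (toℕ j ≡ᵇ suc (toℕ i)) ∨ ((suc (toℕ i) ≡ᵇ r) ∧ (toℕ j ≡ᵇ 0))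

cycle : ∀ r → 3 ℕ.≤ r → Graph (Fin r)
cycle r 3≤r = undirected (cycleEdge r) (edge-irrefl 3≤r)
  where
  n≢ᵇ1+n : ∀ n → (n ≡ᵇ suc n) ≡ false
  n≢ᵇ1+n zero    = refl
  n≢ᵇ1+n (suc n) = n≢ᵇ1+n n

  edge-irrefl : ∀ {r} → 3 ℕ.≤ r → ∀ i → cycleEdge r i i ≡ false
  edge-irrefl (s≤s (s≤s (s≤s _))) zero = refl
  edge-irrefl {r} 3≤r (suc i)
    rewrite n≢ᵇ1+n (toℕ i) with suc (suc (toℕ i)) ≡ᵇ r
  ... | true  = refl
  ... | false = refl

C₃ C₄ : FiniteGraph
C₃ = 3 , cycle 3 (s≤s (s≤s (s≤s z≤n)))
C₄ = 4 , cycle 4 (s≤s (s≤s (s≤s z≤n)))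

-- The paths joining the terminals are
-- terminalX - mid - terminalY and terminalX - nearX i - nearY i - terminalY.
data ThetaVertex (m : ℕ) : Set where
  terminalX terminalY mid : ThetaVertex m
  nearX nearY             : Fin m → ThetaVertex m

thetaEdge : ∀ {m} → ThetaVertex m → ThetaVertex m → Bool
thetaEdge terminalX mid       = true
thetaEdge mid       terminalY = true
thetaEdge terminalX (nearX _) = true
thetaEdge (nearX i) (nearY j) = ⌊ i Fin.≟ j ⌋
thetaEdge (nearY _) terminalY = true
thetaEdge _         _         = false

theta[2,3^_] : ∀ m → Graph (ThetaVertex m)
theta[2,3^ m ] = undirected thetaEdge λ where
  terminalX → refl
  terminalY → refl
  mid       → refl
  (nearX _) → refl
  (nearY _) → refl

addVertex : ∀ {V} → Graph V → (V → Bool) → Graph (Maybe V)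
addVertex {V} G N = record { adj = adj′ ; symm = symm′ ; irrefl = irrefl′ }
  where
  adj′ : Maybe V → Maybe V → Bool
  adj′ (just u) (just v) = adj G u v
  adj′ (just u) nothing  = N u
  adj′ nothing  (just v) = N v
  adj′ nothing  nothing  = false

  symm′ : ∀ u v → adj′ u v ≡ adj′ v u
  symm′ (just u) (just v) = symm G u v
  symm′ (just u) nothing  = refl
  symm′ nothing  (just v) = refl
  symm′ nothing  nothing  = refl

  irrefl′ : ∀ v → adj′ v v ≡ false
  irrefl′ (just v) = irrefl G v
  irrefl′ nothing  = refl

-- P₁ and P₂ are the length-3 paths with indices 0 and 1.
wNeighbour : ∀ {m} → ThetaVertex m → Bool
wNeighbour (nearX zero)       = true
wNeighbour (nearY (suc zero)) = true
wNeighbour _                  = false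

-- For r ≥ 3; for smaller r the path with index 1 does not exist.
T : ∀ r → Graph (Maybe (ThetaVertex (r ℕ.∸ 1)))
T r = addVertex theta[2,3^ r ℕ.∸ 1 ] wNeighbour

------------------------------------------------------------------------
-- The quintic

quintic : ℕ → ℝ → ℝ
quintic n z =
     z ^ℝ 5
  -ℝ fromℚ (½ ℚ.* (n′ ℚ.+ + 18 / 1)) *ℝ z ^ℝ 4
  +ℝ fromℚ (+ 3 / 2 ℚ.* (+ 3 / 1 ℚ.* n′ ℚ.+ + 16 / 1)) *ℝ z ^ℝ 3
  -ℝ fromℚ (½ ℚ.* (+ 27 / 1 ℚ.* n′ ℚ.+ + 20 / 1)) *ℝ z ^ℝ 2
  +ℝ fromℚ (+ 4 / 1 ℚ.* (+ 4 / 1 ℚ.* n′ ℚ.- + 9 / 1)) *ℝ z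
  -ℝ fromℚ (+ 6 / 1 ℚ.* n′)
  +ℝ fromℚ (+ 24 / 1)
  where
  n′ : ℚ
  n′ = + n / 1

module Submission where

-- For a {C₃, C₄}-free graph with minimum degree two on 2k + 2 vertices, the
-- degrees of the neighbours of a vertex sum to at most 2k + 1, so all degrees
-- are at most k. If the graph is not T, a positive vector x with
-- Q x ≤ (k + 1 + 3/k) x is exhibited, according to the number of vertices of
-- degree k: none (x is essentially the degree), one (x is adapted to the layers
-- around it) or two. In the last case the centres are joined by k paths of length
-- three, or by one path of length two, k - 2 of length three and one of length
-- four, or else the graph is T. By the Collatz–Wielandt argument such a vector
-- bounds q, and k + 1 + 3/k is smaller than the largest root of the quintic. For T
-- itself the same argument applies with the explicit vector whose only defect in
-- Q x = z x is the value of the quintic at z, occurring at the two terminals.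

-- The margin decides the form of the proof. The graph with the path of length four and `T` both
-- have radius k + 1 + 3/k up to terms of order 1/k²; there `T` gains about 2/k² and the other graph
-- nothing. Moreover the plain quotient d + S/d, with S the degree sum of the neighbours, is k + 1 +
-- 3/(k - 1) at a vertex with d = k - 1 and S = 2k + 1, already above the threshold. Hence the
-- vectors for two centres solve the eigenvalue equation for k + 1 + 3/k exactly off the centres,
-- and the degree vector carries a correction of order 1/k². Clearing denominators turns each bound
-- into a polynomial inequality over ℕ.
--
-- The quintic is handled through its signs. A sign change between k + 1 + 6/(2k - 1) and k + 4
-- yields a root, which `q′` dominates by maximality. For `T`, a nonnegative value at a rational z ≥
-- 5 bounds q by z, while every root that is at least 6 is an eigenvalue. The rational gap between
-- the threshold and the sign change excludes equality whenever a certificate exists. All case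
-- distinctions concern rational approximations or finite graphs, never reals.

open import Defs
open import Algebra.Bundles using (CommutativeRing)
import Algebra.Properties.Semiring.Sum as Sum
open import Data.Bool.Base as Bool using (Bool; true; false; if_then_else_; not; _∧_; _∨_)
import Data.Bool.Properties as Bool
open import Data.Empty using (⊥; ⊥-elim)
open import Data.Fin.Base using (Fin; zero; suc; _↑ˡ_; _↑ʳ_; splitAt; join)
open import Data.Fin.Patterns using (0F; 1F; 2F; 3F)
open import Data.Fin.Permutation using (Permutation)
import Data.Fin.Properties as Fin
import Data.Fin.Subset as Subset
open import Data.Integer.Base as ℤ using (+_; -[1+_])
import Data.Integer.Properties as ℤ
open import Data.List.Base using (List; []; _∷_)
import Data.List.Relation.Unary.All as All
open import Data.Maybe.Base using (Maybe; just; nothing)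
open import Data.Nat.Base as ℕ
open import Data.Nat.DivMod using (m*n/n≡m)
open import Data.Nat.Properties using (_≤?_)
import Data.Nat.Properties as ℕ
open import Data.Nat.Tactic.RingSolver using (solve-∀)
open import Data.Product.Base using (Σ-syntax; ∃-syntax; _×_; _,_; proj₁; proj₂)
open import Data.Rational.Base as ℚ using (ℚ; 0ℚ; 1ℚ; ½; ∣_∣; mkℚ)
import Data.Rational.Properties as ℚ
open import Data.Rational.Solver using (module +-*-Solver)
open import Data.Rational.Unnormalised.Base as ℚᵘ using (mkℚᵘ; *≡*)
import Data.Rational.Unnormalised.Properties as ℚᵘ
open import Data.Sum.Base using (_⊎_; inj₁; inj₂; [_,_]′)
import Data.Vec.Base as Vec
open import Data.Vec.Base using (Vec; []; _∷_; lookup; map)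
open import Data.Vec.Properties using (lookup-map)
open import Data.Vec.Relation.Binary.Pointwise.Inductive using (Pointwise; []; _∷_)
open import Function.Base using (_∘_)
open import Function.Bundles using (_⇔_; _↔_; mk⇔; mk↔ₛ′; Inverse)
open import Relation.Binary.Construct.Closure.ReflexiveTransitive as Star using (Star; _◅_)
open import Relation.Binary.PropositionalEquality
open import Relation.Nullary.Decidable using (Dec; yes; no; ⌊_⌋; _×-dec_; ¬?)
open import Relation.Nullary.Negation using (¬_; contradiction)

-- Polynomial inequalities with nonnegative coefficients

data Expr (m : ℕ) : Set where
  lit       : ℕ → Expr m
  arg       : Fin m → Expr m
  _⊞_ _⊠_ : Expr m → Expr m → Expr m

infixl 6 _⊞_
infixl 7 _⊠_

⟦_⟧ : ∀ {m} → Expr m → Vec ℕ m → ℕ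
⟦ lit c ⟧  ρ = c
⟦ arg i ⟧  ρ = lookup ρ i
⟦ e ⊞ f ⟧ ρ = ⟦ e ⟧ ρ + ⟦ f ⟧ ρ
⟦ e ⊠ f ⟧ ρ = ⟦ e ⟧ ρ * ⟦ f ⟧ ρ

-- Dense nested coefficient lists; the head of the valuation is the outermost variable. Lists need
-- not be reduced, as trailing zeros affect neither `eval` nor the coefficientwise comparison.
Poly : ℕ → Set
Poly zero    = ℕ
Poly (suc m) = List (Poly m)

eval : ∀ {m} → Poly m → Vec ℕ m → ℕ
eval {zero}  c        []      = c
eval {suc m} []       (x ∷ ρ) = 0
eval {suc m} (p ∷ ps) (x ∷ ρ) = eval p ρ + x * eval {suc m} ps (x ∷ ρ)

constant : ∀ {m} → ℕ → Poly m
constant {zero}  c = c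
constant {suc m} c = constant c ∷ []

eval-constant : ∀ {m} c (ρ : Vec ℕ m) → eval (constant c) ρ ≡ c
eval-constant c []      = refl
eval-constant c (x ∷ ρ) rewrite eval-constant c ρ | ℕ.*-zeroʳ x = ℕ.+-identityʳ c

indeterminate : ∀ {m} → Fin m → Poly m
indeterminate zero    = constant 0 ∷ constant 1 ∷ []
indeterminate (suc i) = indeterminate i ∷ []

eval-indeterminate : ∀ {m} i (ρ : Vec ℕ m) → eval (indeterminate i) ρ ≡ lookup ρ i
eval-indeterminate zero (x ∷ ρ)
  rewrite eval-constant 0 ρ | eval-constant 1 ρ | ℕ.*-zeroʳ x = ℕ.*-identityʳ x
eval-indeterminate (suc i) (x ∷ ρ)
  rewrite eval-indeterminate i ρ | ℕ.*-zeroʳ x = ℕ.+-identityʳ _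

infixl 6 _⊕_
infixl 7 _⊗_

_⊕_ : ∀ {m} → Poly m → Poly m → Poly m
_⊕_ {zero}  c        d        = c + d
_⊕_ {suc m} []       qs       = qs
_⊕_ {suc m} (p ∷ ps) []       = p ∷ ps
_⊕_ {suc m} (p ∷ ps) (q ∷ qs) = p ⊕ q ∷ _⊕_ {suc m} ps qs

eval-⊕ : ∀ {m} p q (ρ : Vec ℕ m) → eval (p ⊕ q) ρ ≡ eval p ρ + eval q ρ
eval-⊕ {zero}  c        d        []      = refl
eval-⊕ {suc m} []       qs       (x ∷ ρ) = refl
eval-⊕ {suc m} (p ∷ ps) []       (x ∷ ρ) = sym (ℕ.+-identityʳ _)
eval-⊕ {suc m} (p ∷ ps) (q ∷ qs) (x ∷ ρ)
  rewrite eval-⊕ p q ρ | eval-⊕ {suc m} ps qs (x ∷ ρ) =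
  regroup (eval p ρ) (eval q ρ) x (eval {suc m} ps (x ∷ ρ)) (eval {suc m} qs (x ∷ ρ))
  where
  regroup : ∀ a b x c d → a + b + x * (c + d) ≡ a + x * c + (b + x * d)
  regroup = solve-∀

_⊗_ : ∀ {m} → Poly m → Poly m → Poly m
scaleBy : ∀ {m} → Poly m → Poly (suc m) → Poly (suc m)

_⊗_ {zero}  c        d  = c * d
_⊗_ {suc m} []       qs = []
_⊗_ {suc m} (p ∷ ps) qs = scaleBy p qs ⊕ (constant 0 ∷ _⊗_ {suc m} ps qs)

scaleBy p []       = []
scaleBy p (q ∷ qs) = p ⊗ q ∷ scaleBy p qs

eval-⊗ : ∀ {m} p q (ρ : Vec ℕ m) → eval (p ⊗ q) ρ ≡ eval p ρ * eval q ρ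
eval-scale : ∀ {m} p qs x (ρ : Vec ℕ m) →
  eval {suc m} (scaleBy p qs) (x ∷ ρ) ≡ eval p ρ * eval {suc m} qs (x ∷ ρ)

eval-⊗ {zero}  c        d  []      = refl
eval-⊗ {suc m} []       qs (x ∷ ρ) = refl
eval-⊗ {suc m} (p ∷ ps) qs (x ∷ ρ)
  rewrite eval-⊕ {suc m} (scaleBy p qs) (constant 0 ∷ _⊗_ {suc m} ps qs) (x ∷ ρ)
        | eval-scale p qs x ρ | eval-constant 0 ρ | eval-⊗ {suc m} ps qs (x ∷ ρ) =
  regroup (eval p ρ) (eval {suc m} ps (x ∷ ρ)) x (eval {suc m} qs (x ∷ ρ))
  where
  regroup : ∀ a b x c → a * c + x * (b * c) ≡ (a + x * b) * c
  regroup = solve-∀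

eval-scale p []       x ρ = sym (ℕ.*-zeroʳ (eval p ρ))
eval-scale {m} p (q ∷ qs) x ρ rewrite eval-⊗ p q ρ | eval-scale p qs x ρ =
  regroup (eval p ρ) (eval q ρ) x (eval {suc m} qs (x ∷ ρ))
  where
  regroup : ∀ a b x c → a * b + x * (a * c) ≡ a * (b + x * c)
  regroup = solve-∀

-- A sufficient test only: it may reject a true inequality until the variables are shifted by lower
-- bounds. This is why some estimates below split their range into boxes.
dominates : ∀ {m} → Poly m → Poly m → Bool
dominates {zero}  c        d        = c ≤ᵇ d
dominates {suc m} []       qs       = true
dominates {suc m} (p ∷ ps) []       = dominates p (constant 0) ∧ dominates {suc m} ps []
dominates {suc m} (p ∷ ps) (q ∷ qs) = dominates p q ∧ dominates {suc m} ps qs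

∧-true : ∀ {a b} → a ∧ b ≡ true → a ≡ true
∧-true {true} _ = refl

∧-true′ : ∀ {a b} → a ∧ b ≡ true → b ≡ true
∧-true′ {true} eq = eq

dominates-sound : ∀ {m} p q (ρ : Vec ℕ m) → dominates p q ≡ true → eval p ρ ≤ eval q ρ
dominates-sound {zero}  c        d        []      h = ℕ.≤ᵇ⇒≤ c d (subst Bool.T (sym h) _)
dominates-sound {suc m} []       qs       (x ∷ ρ) h = z≤n
dominates-sound {suc m} (p ∷ ps) []       (x ∷ ρ) h = ℕ.+-mono-≤
  (ℕ.≤-trans (dominates-sound p (constant 0) ρ (∧-true h)) (ℕ.≤-reflexive (eval-constant 0 ρ)))
  (ℕ.≤-trans (ℕ.*-monoʳ-≤ x (dominates-sound {suc m} ps [] (x ∷ ρ) (∧-true′ h)))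
    (ℕ.≤-reflexive (ℕ.*-zeroʳ x)))
dominates-sound {suc m} (p ∷ ps) (q ∷ qs) (x ∷ ρ) h = ℕ.+-mono-≤
  (dominates-sound p q ρ (∧-true h))
  (ℕ.*-monoʳ-≤ x (dominates-sound {suc m} ps qs (x ∷ ρ) (∧-true′ {dominates p q} h)))

shifted : ∀ {m} → Vec ℕ m → Expr m → Poly m
shifted b (lit c)  = constant c
shifted b (arg i)  = constant (lookup b i) ⊕ indeterminate i
shifted b (e ⊞ f) = shifted b e ⊕ shifted b f
shifted b (e ⊠ f) = shifted b e ⊗ shifted b f

excess : ∀ {m} {b ρ : Vec ℕ m} → Pointwise _≤_ b ρ → Vec ℕ m
excess []                          = []
excess (_∷_ {x = x} {y = y} _ b≤ρ) = y ∸ x ∷ excess b≤ρ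

lookup-excess : ∀ {m} {b ρ : Vec ℕ m} (b≤ρ : Pointwise _≤_ b ρ) i →
  lookup b i + lookup (excess b≤ρ) i ≡ lookup ρ i
lookup-excess (x≤y ∷ b≤ρ) zero    = ℕ.m+[n∸m]≡n x≤y
lookup-excess (x≤y ∷ b≤ρ) (suc i) = lookup-excess b≤ρ i

eval-shifted : ∀ {m} {b ρ : Vec ℕ m} (b≤ρ : Pointwise _≤_ b ρ) e →
  eval (shifted b e) (excess b≤ρ) ≡ ⟦ e ⟧ ρ
eval-shifted b≤ρ (lit c) = eval-constant c (excess b≤ρ)
eval-shifted {b = b} b≤ρ (arg i)
  rewrite eval-⊕ (constant (lookup b i)) (indeterminate i) (excess b≤ρ)
        | eval-constant (lookup b i) (excess b≤ρ) | eval-indeterminate i (excess b≤ρ) = lookup-excess b≤ρ i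
eval-shifted {b = b} b≤ρ (e ⊞ f)
  rewrite eval-⊕ (shifted b e) (shifted b f) (excess b≤ρ) =
  cong₂ _+_ (eval-shifted b≤ρ e) (eval-shifted b≤ρ f)
eval-shifted {b = b} b≤ρ (e ⊠ f)
  rewrite eval-⊗ (shifted b e) (shifted b f) (excess b≤ρ) =
  cong₂ _*_ (eval-shifted b≤ρ e) (eval-shifted b≤ρ f)

infix 9 _⟪_⟫

_⟪_⟫ : ∀ {l m} → Expr l → Vec (Expr m) l → Expr m
lit c    ⟪ σ ⟫ = lit c
arg i    ⟪ σ ⟫ = lookup σ i
(e ⊞ f) ⟪ σ ⟫ = e ⟪ σ ⟫ ⊞ f ⟪ σ ⟫
(e ⊠ f) ⟪ σ ⟫ = e ⟪ σ ⟫ ⊠ f ⟪ σ ⟫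

Defines : ∀ {l m} → Vec ℕ m → Vec ℕ l → Vec (Expr m) l → Set
Defines ρ = Pointwise (λ x e → x ≡ ⟦ e ⟧ ρ)

⟦⟪⟫⟧ : ∀ {l m} {ρ : Vec ℕ m} {τ : Vec ℕ l} {σ} → Defines ρ τ σ → ∀ e → ⟦ e ⟧ τ ≡ ⟦ e ⟪ σ ⟫ ⟧ ρ
⟦⟪⟫⟧ τ≡σ         (lit c)       = refl
⟦⟪⟫⟧ (x≡e ∷ τ≡σ) (arg zero)    = x≡e
⟦⟪⟫⟧ (x≡e ∷ τ≡σ) (arg (suc i)) = ⟦⟪⟫⟧ τ≡σ (arg i)
⟦⟪⟫⟧ τ≡σ         (e ⊞ f)      = cong₂ _+_ (⟦⟪⟫⟧ τ≡σ e) (⟦⟪⟫⟧ τ≡σ f)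
⟦⟪⟫⟧ τ≡σ         (e ⊠ f)      = cong₂ _*_ (⟦⟪⟫⟧ τ≡σ e) (⟦⟪⟫⟧ τ≡σ f)

-- The variables τ are substituted by the expressions σ in the variables ρ,
-- which are then translated by their lower bounds b. If this makes all
-- coefficients of f - e nonnegative, then e ≤ f.
byCoefficients : ∀ {l m} {b ρ : Vec ℕ m} {τ : Vec ℕ l} {σ} →
  Defines ρ τ σ → Pointwise _≤_ b ρ → (e f : Expr l) →
  dominates (shifted b (e ⟪ σ ⟫)) (shifted b (f ⟪ σ ⟫)) ≡ true → ⟦ e ⟧ τ ≤ ⟦ f ⟧ τ
byCoefficients {b = b} {σ = σ} τ≡σ b≤ρ e f h = subst₂ _≤_
  (trans (eval-shifted b≤ρ (e ⟪ σ ⟫)) (sym (⟦⟪⟫⟧ τ≡σ e)))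
  (trans (eval-shifted b≤ρ (f ⟪ σ ⟫)) (sym (⟦⟪⟫⟧ τ≡σ f)))
  (dominates-sound (shifted b (e ⟪ σ ⟫)) (shifted b (f ⟪ σ ⟫)) (excess b≤ρ) h)

-- Finite sums and indicators

module ℕΣ = Sum ℕ.+-*-semiring

∑ : ∀ {n} → (Fin n → ℕ) → ℕ
∑ = ℕΣ.sum

∑-mono : ∀ {n} {f g : Fin n → ℕ} → (∀ i → f i ≤ g i) → ∑ f ≤ ∑ g
∑-mono {zero}  f≤g = z≤n
∑-mono {suc n} f≤g = ℕ.+-mono-≤ (f≤g zero) (∑-mono (f≤g ∘ suc))

∑-cong : ∀ {n} {f g : Fin n → ℕ} → (∀ i → f i ≡ g i) → ∑ f ≡ ∑ g
∑-cong = ℕΣ.sum-cong-≗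

∑-+ : ∀ {n} (f g : Fin n → ℕ) → ∑ (λ i → f i + g i) ≡ ∑ f + ∑ g
∑-+ = ℕΣ.∑-distrib-+

∑-* : ∀ {n} c (f : Fin n → ℕ) → ∑ (λ i → c * f i) ≡ c * ∑ f
∑-* c f = sym (ℕΣ.*-distribˡ-sum c f)

∑-*ʳ : ∀ {n} (f : Fin n → ℕ) c → ∑ (λ i → f i * c) ≡ ∑ f * c
∑-*ʳ f c = sym (ℕΣ.*-distribʳ-sum c f)

∑-const : ∀ n c → ∑ {n} (λ _ → c) ≡ n * c
∑-const zero    c = refl
∑-const (suc n) c = cong (c ℕ.+_) (∑-const n c)

∑-zero : ∀ n → ∑ {n} (λ _ → 0) ≡ 0
∑-zero n = trans (∑-const n 0) (ℕ.*-zeroʳ n)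

term≤∑ : ∀ {n} (f : Fin n → ℕ) i → f i ≤ ∑ f
term≤∑ f zero    = ℕ.m≤m+n (f zero) _
term≤∑ f (suc i) = ℕ.≤-trans (term≤∑ (f ∘ suc) i) (ℕ.m≤n+m _ (f zero))

∑-witness : ∀ {n} (f : Fin n → ℕ) → 1 ≤ ∑ f → ∃[ i ] 1 ≤ f i
∑-witness {suc n} f 1≤∑ with f zero in eq
... | suc _ = zero , subst (1 ≤_) (sym eq) (s≤s z≤n)
... | zero with ∑-witness (f ∘ suc) 1≤∑
...   | i , 1≤fi = suc i , 1≤fi

bit : Bool → ℕ
bit b = if b then 1 else 0

bit≤1 : ∀ b → bit b ≤ 1
bit≤1 true  = ℕ.≤-refl
bit≤1 false = z≤n

δ : ∀ {n} → Fin n → Fin n → ℕ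
δ i j = bit ⌊ i Fin.≟ j ⌋

δ-refl : ∀ {n} (i : Fin n) → δ i i ≡ 1
δ-refl i with i Fin.≟ i
... | yes _  = refl
... | no i≢i = contradiction refl i≢i

δ-≢ : ∀ {n} {i j : Fin n} → i ≢ j → δ i j ≡ 0
δ-≢ {i = i} {j} i≢j with i Fin.≟ j
... | yes i≡j = contradiction i≡j i≢j
... | no _    = refl

δ-suc : ∀ {n} (i j : Fin n) → δ (suc i) (suc j) ≡ δ i j
δ-suc i j with i Fin.≟ j
... | yes _ = refl
... | no _  = refl

∑-δ* : ∀ {n} (i : Fin n) (f : Fin n → ℕ) → ∑ (λ j → δ i j * f j) ≡ f i
∑-δ* {suc n} zero    f = trans (cong (f zero + 0 ℕ.+_) (∑-zero n))
  (trans (ℕ.+-identityʳ _) (ℕ.+-identityʳ _))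
∑-δ* {suc n} (suc i) f =
  trans (∑-cong λ j → cong (_* f (suc j)) (δ-suc i j)) (∑-δ* i (f ∘ suc))

∑-δ : ∀ {n} (i : Fin n) → ∑ (δ i) ≡ 1
∑-δ i = trans (∑-cong λ j → sym (ℕ.*-identityʳ (δ i j))) (∑-δ* i λ _ → 1)

count-tabulate : ∀ {n} (p : Fin n → Bool) → Subset.∣ Vec.tabulate p ∣ ≡ ∑ (bit ∘ p)
count-tabulate {zero}  p = refl
count-tabulate {suc n} p with p zero
... | true  = cong suc (count-tabulate (p ∘ suc))
... | false = count-tabulate (p ∘ suc)

Enumeration : ∀ {n} → (Fin n → Bool) → ℕ → Set
Enumeration {n} p c = Σ[ g ∈ (Fin c → Fin n) ]
  (∀ {i j} → g i ≡ g j → i ≡ j) × (∀ i → p (g i) ≡ true) × (∀ v → p v ≡ true → ∃[ i ] g i ≡ v)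

enumerate : ∀ {n} (p : Fin n → Bool) {c} → ∑ (bit ∘ p) ≡ c → Enumeration p c
enumerate {zero} p refl = (λ ()) , (λ { {()} }) , (λ ()) , λ ()
enumerate {suc n} p {c} ∑≡c with p zero in p0 | enumerate (p ∘ suc) refl
enumerate {suc n} p refl | true | g , inj , sound , complete = g′ , inj′ , sound′ , complete′
  where
  g′ : Fin (suc (∑ (bit ∘ p ∘ suc))) → Fin (suc n)
  g′ zero    = zero
  g′ (suc i) = suc (g i)
  inj′ : ∀ {i j} → g′ i ≡ g′ j → i ≡ j
  inj′ {zero}  {zero}  _ = refl
  inj′ {suc i} {suc j} e = cong suc (inj (Fin.suc-injective e))
  sound′ : ∀ i → p (g′ i) ≡ true
  sound′ zero    = p0
  sound′ (suc i) = sound i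
  complete′ : ∀ v → p v ≡ true → ∃[ i ] g′ i ≡ v
  complete′ zero    _  = zero , refl
  complete′ (suc v) pv = let i , e = complete v pv in suc i , cong suc e
enumerate {suc n} p refl | false | g , inj , sound , complete =
  suc ∘ g , inj ∘ Fin.suc-injective , sound , complete′
  where
  complete′ : ∀ v → p v ≡ true → ∃[ i ] suc (g i) ≡ v
  complete′ zero    pv with trans (sym p0) pv
  ... | ()
  complete′ (suc v) pv = let i , e = complete v pv in i , cong suc e

-- Graphs without short cycles

module _ {n} (G : Graph (Fin n)) where

  a : Fin n → Fin n → ℕ
  a u v = bit (adj G u v)

  a-sym : ∀ u v → a u v ≡ a v u
  a-sym u v = cong bit (symm G u v)

  a-adj : ∀ {u v} → Adj G u v → a u v ≡ 1
  a-adj = cong bit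

  Adj-sym : ∀ {u v} → Adj G u v → Adj G v u
  Adj-sym {u} {v} u~v = trans (symm G v u) u~v

  Adj⇒≢ : ∀ {u v} → Adj G u v → u ≢ v
  Adj⇒≢ {u} u~v refl with trans (sym u~v) (irrefl G u)
  ... | ()

  degree-∑ : ∀ v → degree G v ≡ ∑ (a v)
  degree-∑ v = count-tabulate (adj G v)

  codegree : Fin n → Fin n → ℕ
  codegree u v = ∑ λ w → a u w * a w v

  -- The hypothesis on c only matters for the neighbours other than p and q.
  ∑-neighbours≤ : ∀ {v p q} (f : Fin n → ℕ) c → p ≢ q → Adj G v p → Adj G v q →
    (∀ w → Adj G v w → w ≢ p → w ≢ q → f w ≤ c) →
    ∑ (λ w → a v w * f w) + 2 * c ≤ f p + f q + degree G v * c
  ∑-neighbours≤ {v} {p} {q} f c p≢q v~p v~q f≤c = begin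
    ∑ (λ w → a v w * f w) + 2 * c
      ≡⟨ cong (∑ (λ w → a v w * f w) ℕ.+_) (sym (cong₂ (λ s t → s + (t + 0)) (∑-δ* p λ _ → c) (∑-δ* q λ _ → c))) ⟩
    ∑ (λ w → a v w * f w) + (∑ (λ w → δ p w * c) + (∑ (λ w → δ q w * c) + 0))
      ≡⟨ cong (∑ (λ w → a v w * f w) ℕ.+_) (cong (∑ (λ w → δ p w * c) ℕ.+_) (ℕ.+-identityʳ _)) ⟩
    ∑ (λ w → a v w * f w) + (∑ (λ w → δ p w * c) + ∑ (λ w → δ q w * c))
      ≡⟨ sym (trans (∑-+ (λ w → a v w * f w) _) (cong (∑ (λ w → a v w * f w) ℕ.+_) (∑-+ (λ w → δ p w * c) (λ w → δ q w * c)))) ⟩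
    ∑ (λ w → a v w * f w + (δ p w * c + δ q w * c))
      ≤⟨ ∑-mono pointwise ⟩
    ∑ (λ w → δ p w * f w + δ q w * f w + a v w * c)
      ≡⟨ trans (∑-+ (λ w → δ p w * f w + δ q w * f w) _) (cong₂ _+_ (∑-+ (λ w → δ p w * f w) _) (∑-*ʳ (a v) c)) ⟩
    ∑ (λ w → δ p w * f w) + ∑ (λ w → δ q w * f w) + ∑ (a v) * c
      ≡⟨ cong₂ _+_ (cong₂ _+_ (∑-δ* p f) (∑-δ* q f)) (cong (_* c) (sym (degree-∑ v))) ⟩
    f p + f q + degree G v * c ∎
    where
    open ℕ.≤-Reasoning
    pointwise : ∀ w → a v w * f w + (δ p w * c + δ q w * c) ≤ δ p w * f w + δ q w * f w + a v w * c
    pointwise w with p Fin.≟ w | q Fin.≟ w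
    ... | yes refl | yes refl = contradiction refl p≢q
    ... | yes refl | no _ rewrite a-adj v~p = ℕ.≤-reflexive (regroup (f p) c)
      where
      regroup : ∀ x c → 1 * x + (1 * c + 0 * c) ≡ 1 * x + 0 * x + 1 * c
      regroup = solve-∀
    ... | no _ | yes refl rewrite a-adj v~q = ℕ.≤-reflexive (regroup (f q) c)
      where
      regroup : ∀ x c → 1 * x + (0 * c + 1 * c) ≡ 0 * x + 1 * x + 1 * c
      regroup = solve-∀
    ... | no p≢w | no q≢w with adj G v w in v~w
    ...   | false = z≤n
    ...   | true  = ℕ.≤-trans (ℕ.≤-reflexive (regroup (f w) c))
      (ℕ.+-monoˡ-≤ 0 (f≤c w v~w (p≢w ∘ sym) (q≢w ∘ sym)))
      where
      regroup : ∀ x c → 1 * x + (0 * c + 0 * c) ≡ x + 0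
      regroup = solve-∀

  ∑-pair≤ : ∀ {v p q} (f : Fin n → ℕ) → p ≢ q → Adj G v p → Adj G v q →
    (∀ w → Adj G v w → w ≢ p → w ≢ q → ⊥) → ∑ (λ w → a v w * f w) ≤ f p + f q
  ∑-pair≤ {v} {p} {q} f p≢q v~p v~q only = begin
    ∑ (λ w → a v w * f w)          ≡⟨ sym (ℕ.+-identityʳ _) ⟩
    ∑ (λ w → a v w * f w) + 2 * 0  ≤⟨ ∑-neighbours≤ f 0 p≢q v~p v~q (λ w v~w w≢p w≢q → ⊥-elim (only w v~w w≢p w≢q)) ⟩
    f p + f q + degree G v * 0     ≡⟨ cong (f p + f q ℕ.+_) (ℕ.*-zeroʳ (degree G v)) ⟩
    f p + f q + 0                  ≡⟨ ℕ.+-identityʳ _ ⟩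
    f p + f q                      ∎
    where open ℕ.≤-Reasoning

  degree≤2 : ∀ {v p q} → p ≢ q → Adj G v p → Adj G v q →
    (∀ w → Adj G v w → w ≢ p → w ≢ q → ⊥) → degree G v ≤ 2
  degree≤2 {v} p≢q v~p v~q only = subst (_≤ 2)
    (trans (∑-cong λ w → ℕ.*-identityʳ (a v w)) (sym (degree-∑ v)))
    (∑-pair≤ (λ _ → 1) p≢q v~p v~q only)

  otherNeighbour : ∀ {v} u → 2 ≤ degree G v → ∃[ w ] (Adj G v w × w ≢ u)
  otherNeighbour {v} u 2≤d = let w , h = ∑-witness f 1≤∑ in w , extract w h
    where
    f : Fin n → ℕ
    f w = a v w ∸ δ u w
    1≤∑ : 1 ≤ ∑ f
    1≤∑ = ℕ.+-cancelˡ-≤ 1 1 (∑ f) (begin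
      2                       ≤⟨ 2≤d ⟩
      degree G v              ≡⟨ degree-∑ v ⟩
      ∑ (a v)                 ≤⟨ ∑-mono (λ w → ℕ.m≤n+m∸n (a v w) (δ u w)) ⟩
      ∑ (λ w → δ u w + f w)   ≡⟨ ∑-+ (δ u) f ⟩
      ∑ (δ u) + ∑ f           ≡⟨ cong (_+ ∑ f) (∑-δ u) ⟩
      1 + ∑ f                 ∎)
      where open ℕ.≤-Reasoning
    extract : ∀ w → 1 ≤ f w → Adj G v w × w ≢ u
    extract w h with adj G v w | u Fin.≟ w
    extract w () | false | yes _
    extract w () | false | no _
    extract w () | true | yes _
    ... | true | no u≢w = refl , u≢w ∘ sym

  module ShortCycleFree (free : Free (C₃ ∷ C₄ ∷ []) G) where

    noTriangle : ∀ {u v w} → Adj G u v → Adj G v w → Adj G w u → ⊥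
    noTriangle {u} {v} {w} u~v v~w w~u =
      All.head free (f , (λ {i} {j} → inj i j) , (λ {i} {j} → hom i j))
      where
      f : Fin 3 → Fin n
      f 0F = u
      f 1F = v
      f 2F = w
      inj : ∀ i j → f i ≡ f j → i ≡ j
      inj 0F 0F _ = refl
      inj 0F 1F e = contradiction e (Adj⇒≢ u~v)
      inj 0F 2F e = contradiction (sym e) (Adj⇒≢ w~u)
      inj 1F 0F e = contradiction (sym e) (Adj⇒≢ u~v)
      inj 1F 1F _ = refl
      inj 1F 2F e = contradiction e (Adj⇒≢ v~w)
      inj 2F 0F e = contradiction e (Adj⇒≢ w~u)
      inj 2F 1F e = contradiction (sym e) (Adj⇒≢ v~w)
      inj 2F 2F _ = refl
      hom : ∀ i j → Adj (proj₂ C₃) i j → Adj G (f i) (f j)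
      hom 0F 1F _ = u~v
      hom 0F 2F _ = Adj-sym w~u
      hom 1F 0F _ = Adj-sym u~v
      hom 1F 2F _ = v~w
      hom 2F 0F _ = w~u
      hom 2F 1F _ = Adj-sym v~w
      hom 2F 2F ()

    noSquare : ∀ {u v w x} → Adj G u v → Adj G v w → Adj G w x → Adj G x u → u ≢ w → v ≡ x
    noSquare {u} {v} {w} {x} u~v v~w w~x x~u u≢w with v Fin.≟ x
    ... | yes v≡x = v≡x
    ... | no v≢x =
      ⊥-elim (All.head (All.tail free) (f , (λ {i} {j} → inj i j) , (λ {i} {j} → hom i j)))
      where
      f : Fin 4 → Fin n
      f 0F = u
      f 1F = v
      f 2F = w
      f 3F = x
      inj : ∀ i j → f i ≡ f j → i ≡ j
      inj 0F 0F _ = refl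
      inj 0F 1F e = contradiction e (Adj⇒≢ u~v)
      inj 0F 2F e = contradiction e u≢w
      inj 0F 3F e = contradiction (sym e) (Adj⇒≢ x~u)
      inj 1F 0F e = contradiction (sym e) (Adj⇒≢ u~v)
      inj 1F 1F _ = refl
      inj 1F 2F e = contradiction e (Adj⇒≢ v~w)
      inj 1F 3F e = contradiction e v≢x
      inj 2F 0F e = contradiction (sym e) u≢w
      inj 2F 1F e = contradiction (sym e) (Adj⇒≢ v~w)
      inj 2F 2F _ = refl
      inj 2F 3F e = contradiction e (Adj⇒≢ w~x)
      inj 3F 0F e = contradiction e (Adj⇒≢ x~u)
      inj 3F 1F e = contradiction (sym e) v≢x
      inj 3F 2F e = contradiction (sym e) (Adj⇒≢ w~x)
      inj 3F 3F _ = refl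
      hom : ∀ i j → Adj (proj₂ C₄) i j → Adj G (f i) (f j)
      hom 0F 1F _ = u~v
      hom 0F 3F _ = Adj-sym x~u
      hom 1F 0F _ = Adj-sym u~v
      hom 1F 2F _ = v~w
      hom 1F 3F ()
      hom 2F 1F _ = Adj-sym v~w
      hom 2F 3F _ = w~x
      hom 3F 0F _ = x~u
      hom 3F 2F _ = Adj-sym w~x
      hom 3F 3F ()

    commonNeighbour-unique : ∀ {u v w x} → u ≢ v →
      Adj G u w → Adj G v w → Adj G u x → Adj G v x → w ≡ x
    commonNeighbour-unique u≢v u~w v~w u~x v~x =
      noSquare u~w (Adj-sym v~w) v~x (Adj-sym u~x) u≢v

    codegree-adj : ∀ {u v} → Adj G u v → codegree u v ≡ 0
    codegree-adj {u} {v} u~v = trans (∑-cong term) (∑-zero n)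
      where
      term : ∀ w → a u w * a w v ≡ 0
      term w with adj G u w in u~w | adj G w v in w~v
      ... | false | _     = refl
      ... | true  | false = refl
      ... | true  | true  = ⊥-elim (noTriangle u~w w~v (Adj-sym u~v))

    codegree≤1 : ∀ {u v} → u ≢ v → codegree u v ≤ 1
    codegree≤1 {u} {v} u≢v with 1 ≤? codegree u v
    ... | no ≰ = ℕ.≤-trans (ℕ.n≤1+n _) (ℕ.≰⇒> ≰)
    ... | yes 1≤c with ∑-witness (λ w → a u w * a w v) 1≤c
    ...   | w , h = ℕ.≤-trans (∑-mono term) (ℕ.≤-reflexive (∑-δ w))
      where
      common : ∀ x → 1 ≤ a u x * a x v → Adj G u x × Adj G v x
      common x h with adj G u x in u~x | adj G x v in x~v
      ... | true | true = refl , trans (symm G v x) x~v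
      term : ∀ x → a u x * a x v ≤ δ w x
      term x with w Fin.≟ x
      ... | yes _ = ℕ.*-mono-≤ (bit≤1 (adj G u x)) (bit≤1 (adj G x v))
      ... | no w≢x with 1 ≤? a u x * a x v
      ...   | no ≰ = ℕ.≤-pred (ℕ.≰⇒> ≰)
      ...   | yes 1≤x with common w h | common x 1≤x
      ...     | u~w , v~w | u~x , v~x =
        contradiction (commonNeighbour-unique u≢v u~w v~w u~x v~x) w≢x

    -- Walks of length two inside a set of vertices

    module _ (p : Fin n → Bool) where

      relDegree : Fin n → ℕ
      relDegree v = ∑ λ w → a v w * bit (p w)

      relCodegree : Fin n → Fin n → ℕ
      relCodegree u v = ∑ λ w → a u w * (bit (p w) * a w v)

      relCodegree≤ : ∀ u v → relCodegree u v ≤ codegree u v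
      relCodegree≤ u v = ∑-mono λ w → ℕ.*-monoʳ-≤ (a u w)
        (ℕ.≤-trans (ℕ.*-monoˡ-≤ (a w v) (bit≤1 (p w))) (ℕ.≤-reflexive (ℕ.+-identityʳ _)))

      relCodegree-refl : ∀ v → relCodegree v v ≡ relDegree v
      relCodegree-refl v = ∑-cong term
        where
        term : ∀ w → a v w * (bit (p w) * a w v) ≡ a v w * bit (p w)
        term w rewrite a-sym w v with adj G v w | p w
        ... | true  | true  = refl
        ... | true  | false = refl
        ... | false | _     = refl

      relCodegree-adj : ∀ {u v} → Adj G u v → relCodegree u v ≡ 0
      relCodegree-adj {u} {v} u~v =
        ℕ.n≤0⇒n≡0 (ℕ.≤-trans (relCodegree≤ u v) (ℕ.≤-reflexive (codegree-adj u~v)))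

      relCodegree≤1 : ∀ {u v} → u ≢ v → relCodegree u v ≤ 1
      relCodegree≤1 {u} {v} u≢v = ℕ.≤-trans (relCodegree≤ u v) (codegree≤1 u≢v)

      -- Both sides count the walks v, w, x with w and x in the set, once by the middle vertex and
      -- once by the end.
      walks : ∀ v → ∑ (λ w → a v w * (bit (p w) * relDegree w)) ≡ ∑ λ x → bit (p x) * relCodegree v x
      walks v = begin
        ∑ (λ w → a v w * (bit (p w) * relDegree w))
          ≡⟨ ∑-cong (λ w → trans (sym (ℕ.*-assoc (a v w) (bit (p w)) _)) (sym (∑-* {n} (a v w * bit (p w)) _))) ⟩
        ∑ (λ w → ∑ λ x → a v w * bit (p w) * (a w x * bit (p x)))
          ≡⟨ ℕΣ.∑-comm (λ w x → a v w * bit (p w) * (a w x * bit (p x))) ⟩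
        ∑ (λ x → ∑ λ w → a v w * bit (p w) * (a w x * bit (p x)))
          ≡⟨ ∑-cong (λ x → trans (∑-cong λ w → regroup (a v w) (bit (p w)) (a w x) (bit (p x))) (∑-* {n} (bit (p x)) _)) ⟩
        ∑ (λ x → bit (p x) * relCodegree v x) ∎
        where
        open ≡-Reasoning
        regroup : ∀ a b c d → a * b * (c * d) ≡ d * (a * (b * c))
        regroup = solve-∀

      -- Of the walks of length two from v, exactly `relDegree v` return to v, none ends at a
      -- neighbour of v (no triangle), and at most one ends at any other vertex (no 4-cycle). The
      -- returning walks thus fill the room left empty by the neighbours, and only v itself is lost.
      -- Adding `relDegree v` on both sides avoids subtraction.
      ∑relDegree-inside : ∀ {v} → p v ≡ true →
        1 + ∑ (λ w → a v w * (bit (p w) * relDegree w)) ≤ ∑ (bit ∘ p)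
      ∑relDegree-inside {v} pv = ℕ.+-cancelʳ-≤ (relDegree v) _ _ (begin
        1 + ∑ (λ w → a v w * (bit (p w) * relDegree w)) + relDegree v
          ≡⟨ cong (λ s → 1 + s + relDegree v) (walks v) ⟩
        1 + ∑ (λ x → bit (p x) * relCodegree v x) + relDegree v
          ≡⟨ cong (λ s → s + ∑ (λ x → bit (p x) * relCodegree v x) + relDegree v) (sym (∑-δ v)) ⟩
        ∑ (δ v) + ∑ (λ x → bit (p x) * relCodegree v x) + relDegree v
          ≡⟨ sym (trans (∑-+ (λ x → δ v x + bit (p x) * relCodegree v x) _) (cong (_+ relDegree v) (∑-+ (δ v) _))) ⟩
        ∑ (λ x → δ v x + bit (p x) * relCodegree v x + a v x * bit (p x))
          ≤⟨ ∑-mono pointwise ⟩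
        ∑ (λ x → bit (p x) + δ v x * relDegree x)
          ≡⟨ trans (∑-+ (bit ∘ p) _) (cong (∑ (bit ∘ p) ℕ.+_) (∑-δ* v relDegree)) ⟩
        ∑ (bit ∘ p) + relDegree v ∎)
        where
        open ℕ.≤-Reasoning
        pointwise : ∀ x → δ v x + bit (p x) * relCodegree v x + a v x * bit (p x)
          ≤ bit (p x) + δ v x * relDegree x
        pointwise x with v Fin.≟ x
        ... | yes refl rewrite pv | irrefl G v | relCodegree-refl v = ℕ.≤-reflexive (regroup (relDegree v))
          where
          regroup : ∀ h → 1 + 1 * h + 0 ≡ 1 + 1 * h
          regroup = solve-∀
        ... | no v≢x with p x
        ...   | false = ℕ.≤-reflexive (ℕ.*-zeroʳ (a v x))
        ...   | true with adj G v x in v~x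
        ...     | true rewrite relCodegree-adj v~x = ℕ.≤-refl
        ...     | false = ℕ.≤-trans (ℕ.≤-reflexive (regroup (relCodegree v x))) (relCodegree≤1 v≢x)
          where
          regroup : ∀ c → 1 * c + 0 * 1 ≡ c
          regroup = solve-∀

      -- No counted walk returns to v, which lies outside the set, so every end is reached at most
      -- once.
      ∑relDegree-outside : ∀ {v} → p v ≡ false →
        ∑ (λ w → a v w * (bit (p w) * relDegree w)) ≤ ∑ (bit ∘ p)
      ∑relDegree-outside {v} pv = ℕ.≤-trans (ℕ.≤-reflexive (walks v)) (∑-mono pointwise)
        where
        pointwise : ∀ x → bit (p x) * relCodegree v x ≤ bit (p x)
        pointwise x with v Fin.≟ x
        ... | yes refl rewrite pv = z≤n
        ... | no v≢x = ℕ.≤-trans (ℕ.*-monoʳ-≤ (bit (p x)) (relCodegree≤1 v≢x)) (ℕ.≤-reflexive (ℕ.*-identityʳ _))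

    ∑degree≤ : ∀ v → 1 + ∑ (λ w → a v w * degree G w) ≤ n
    ∑degree≤ v = begin
      1 + ∑ (λ w → a v w * degree G w)
        ≡⟨ cong suc (∑-cong λ w → cong (a v w *_) (trans (degree-∑ w) (trans (∑-cong λ x → sym (ℕ.*-identityʳ (a w x))) (sym (ℕ.+-identityʳ _))))) ⟩
      1 + ∑ (λ w → a v w * (1 * relDegree (λ _ → true) w))
        ≤⟨ ∑relDegree-inside (λ _ → true) refl ⟩
      ∑ {n} (λ _ → 1)
        ≡⟨ trans (∑-const n 1) (ℕ.*-identityʳ n) ⟩
      n ∎
      where open ℕ.≤-Reasoning

-- Rational arithmetic

abstract
  -- Opaque, so that type checking does not unfold the normalisation of fractions; `ι-def` gives
  -- access when a literal has to be matched.
  ι : ℕ → ℚ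
  ι m = + m ℚ./ 1

  ι-def : ∀ m → ι m ≡ + m ℚ./ 1
  ι-def m = refl

  ι-1 : ι 1 ≡ 1ℚ
  ι-1 = refl

  ι-+ : ∀ m n → ι (m + n) ≡ ι m ℚ.+ ι n
  ι-+ m n = ℚ.toℚᵘ-injective (begin
    ℚ.toℚᵘ (ι (m + n))                    ≈⟨ ℚ.toℚᵘ-fromℚᵘ (mkℚᵘ (+ (m + n)) 0) ⟩
    mkℚᵘ (+ (m + n)) 0                    ≈⟨ *≡* (cong (ℤ._* + 1) (cong₂ ℤ._+_ (sym (ℤ.*-identityʳ (+ m))) (sym (ℤ.*-identityʳ (+ n))))) ⟩
    mkℚᵘ (+ m) 0 ℚᵘ.+ mkℚᵘ (+ n) 0        ≈⟨ ℚᵘ.+-cong (ℚᵘ.≃-sym (ℚ.toℚᵘ-fromℚᵘ (mkℚᵘ (+ m) 0))) (ℚᵘ.≃-sym (ℚ.toℚᵘ-fromℚᵘ (mkℚᵘ (+ n) 0))) ⟩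
    ℚ.toℚᵘ (ι m) ℚᵘ.+ ℚ.toℚᵘ (ι n)        ≈⟨ ℚᵘ.≃-sym (ℚ.toℚᵘ-homo-+ (ι m) (ι n)) ⟩
    ℚ.toℚᵘ (ι m ℚ.+ ι n)                  ∎)
    where open ℚᵘ.≃-Reasoning

  ι-* : ∀ m n → ι (m * n) ≡ ι m ℚ.* ι n
  ι-* zero    n = sym (ℚ.*-zeroˡ (ι n))
  ι-* (suc m) n = begin
    ι (n + m * n)               ≡⟨ ι-+ n (m * n) ⟩
    ι n ℚ.+ ι (m * n)           ≡⟨ cong₂ ℚ._+_ (sym (ℚ.*-identityˡ (ι n))) (ι-* m n) ⟩
    1ℚ ℚ.* ι n ℚ.+ ι m ℚ.* ι n  ≡⟨ sym (ℚ.*-distribʳ-+ (ι n) 1ℚ (ι m)) ⟩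
    (1ℚ ℚ.+ ι m) ℚ.* ι n        ≡⟨ cong (ℚ._* ι n) (sym (ι-+ 1 m)) ⟩
    ι (suc m) ℚ.* ι n           ∎
    where open ≡-Reasoning

  0≤ι : ∀ m → 0ℚ ℚ.≤ ι m
  0≤ι m = ℚ.nonNegative⁻¹ (ι m) {{ℚ.normalize-nonNeg m 1}}

  0<ι : ∀ m .{{_ : NonZero m}} → 0ℚ ℚ.< ι m
  0<ι m = ℚ.positive⁻¹ (ι m) {{ℚ.normalize-pos m 1}}

  archimedean : ∀ p → ∃[ N ] p ℚ.≤ ι N
  -- The absolute value of the numerator is large enough, because the denominator is at least one.
  archimedean p@(mkℚ n d _) = ℤ.∣ n ∣ , ℚ.toℚᵘ-cancel-≤ (ℚᵘ.≤-trans
    (ℚᵘ.*≤* (bound n)) (ℚᵘ.≤-reflexive (ℚᵘ.≃-sym (ℚ.toℚᵘ-fromℚᵘ (mkℚᵘ (+ ℤ.∣ n ∣) 0)))))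
    where
    bound : ∀ n → n ℤ.* + 1 ℤ.≤ + ℤ.∣ n ∣ ℤ.* + suc d
    bound (+ m) = subst₂ ℤ._≤_ (ℤ.pos-* m 1) (ℤ.pos-* m (suc d)) (ℤ.+≤+ (ℕ.*-monoʳ-≤ m (s≤s z≤n)))
    bound -[1+ m ] = subst (-[1+ m ] ℤ.* + 1 ℤ.≤_) (ℤ.pos-* (suc m) (suc d)) ℤ.-≤+

ι-suc : ∀ m → ι (suc m) ≡ 1ℚ ℚ.+ ι m
ι-suc m = trans (ι-+ 1 m) (cong (ℚ._+ ι m) ι-1)

≤-by : ∀ {p q} d → 0ℚ ℚ.≤ d → q ≡ p ℚ.+ d → p ℚ.≤ q
≤-by {p} d 0≤d refl = subst (ℚ._≤ p ℚ.+ d) (ℚ.+-identityʳ p) (ℚ.+-monoʳ-≤ p 0≤d)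

<-by : ∀ {p q} d → 0ℚ ℚ.< d → q ≡ p ℚ.+ d → p ℚ.< q
<-by {p} d 0<d refl = subst (ℚ._< p ℚ.+ d) (ℚ.+-identityʳ p) (ℚ.+-monoʳ-< p 0<d)

0≤-diff : ∀ {p q} → p ℚ.≤ q → 0ℚ ℚ.≤ q ℚ.- p
0≤-diff {p} {q} p≤q = subst (ℚ._≤ q ℚ.- p) (ℚ.+-inverseʳ p) (ℚ.+-monoˡ-≤ (ℚ.- p) p≤q)

ι-mono : ∀ {m n} → m ≤ n → ι m ℚ.≤ ι n
ι-mono {m} {n} m≤n = ≤-by (ι (n ∸ m)) (0≤ι (n ∸ m))
  (trans (cong ι (sym (ℕ.m+[n∸m]≡n m≤n))) (ι-+ m (n ∸ m)))

*-monoˡ : ∀ {r p q} → 0ℚ ℚ.≤ r → p ℚ.≤ q → r ℚ.* p ℚ.≤ r ℚ.* q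
*-monoˡ {r} 0≤r = ℚ.*-monoˡ-≤-nonNeg r {{ℚ.nonNegative 0≤r}}

*-cancelˡ : ∀ {r p q} → 0ℚ ℚ.< r → r ℚ.* p ℚ.≤ r ℚ.* q → p ℚ.≤ q
*-cancelˡ {r} 0<r = ℚ.*-cancelˡ-≤-pos r {{ℚ.positive 0<r}}

0≤* : ∀ {p q} → 0ℚ ℚ.≤ p → 0ℚ ℚ.≤ q → 0ℚ ℚ.≤ p ℚ.* q
0≤* {p} {q} 0≤p 0≤q = subst (ℚ._≤ p ℚ.* q) (ℚ.*-zeroʳ p) (*-monoˡ 0≤p 0≤q)

0<* : ∀ {p q} → 0ℚ ℚ.< p → 0ℚ ℚ.< q → 0ℚ ℚ.< p ℚ.* q
0<* {p} {q} 0<p 0<q = subst (ℚ._< p ℚ.* q) (ℚ.*-zeroʳ p) (ℚ.*-monoʳ-<-pos p {{ℚ.positive 0<p}} 0<q)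

0<+ : ∀ {p q} → 0ℚ ℚ.< p → 0ℚ ℚ.≤ q → 0ℚ ℚ.< p ℚ.+ q
0<+ {p} {q} 0<p 0≤q = subst (ℚ._< p ℚ.+ q) (ℚ.+-identityʳ 0ℚ) (ℚ.+-mono-<-≤ 0<p 0≤q)

p≤∣p∣ : ∀ p → p ℚ.≤ ∣ p ∣
p≤∣p∣ p with ℚ.∣p∣≡p∨∣p∣≡-p p
... | inj₁ eq = ℚ.≤-reflexive (sym eq)
... | inj₂ eq = ≤-by (∣ p ∣ ℚ.+ ∣ p ∣) (ℚ.+-mono-≤ (ℚ.0≤∣p∣ p) (ℚ.0≤∣p∣ p))
  (trans eq (trans (regroup p) (cong (λ t → p ℚ.+ (t ℚ.+ t)) (sym eq))))
  where
  regroup : ∀ p → ℚ.- p ≡ p ℚ.+ (ℚ.- p ℚ.+ ℚ.- p)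
  regroup = solve 1 (λ p → :- p := p :+ (:- p :+ :- p)) refl
    where open +-*-Solver

-p≤∣p∣ : ∀ p → ℚ.- p ℚ.≤ ∣ p ∣
-p≤∣p∣ p = subst (ℚ.- p ℚ.≤_) (ℚ.∣-p∣≡∣p∣ p) (p≤∣p∣ (ℚ.- p))

∣∣≤ : ∀ {p b} → p ℚ.≤ b → ℚ.- p ℚ.≤ b → ∣ p ∣ ℚ.≤ b
∣∣≤ {p} p≤b -p≤b with ℚ.∣p∣≡p∨∣p∣≡-p p
... | inj₁ eq = subst (ℚ._≤ _) (sym eq) p≤b
... | inj₂ eq = subst (ℚ._≤ _) (sym eq) -p≤b

≤+∣-∣ : ∀ p q → p ℚ.≤ q ℚ.+ ∣ p ℚ.- q ∣
≤+∣-∣ p q = ℚ.≤-trans (ℚ.≤-reflexive (regroup p q)) (ℚ.+-monoʳ-≤ q (p≤∣p∣ (p ℚ.- q)))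
  where
  regroup : ∀ p q → p ≡ q ℚ.+ (p ℚ.- q)
  regroup = solve 2 (λ p q → p := q :+ (p :- q)) refl
    where open +-*-Solver

∣-∣-sym : ∀ p q → ∣ p ℚ.- q ∣ ≡ ∣ q ℚ.- p ∣
∣-∣-sym p q = trans (sym (ℚ.∣-p∣≡∣p∣ (p ℚ.- q))) (cong ∣_∣ (regroup p q))
  where
  regroup : ∀ p q → ℚ.- (p ℚ.- q) ≡ q ℚ.- p
  regroup = solve 2 (λ p q → :- (p :- q) := q :- p) refl
    where open +-*-Solver

-- Rational sums

module ℚΣ = Sum (CommutativeRing.semiring ℚ.+-*-commutativeRing)

∑ℚ : ∀ {n} → (Fin n → ℚ) → ℚ
∑ℚ = ℚΣ.sum

∑ℚ-mono : ∀ {n} {f g : Fin n → ℚ} → (∀ i → f i ℚ.≤ g i) → ∑ℚ f ℚ.≤ ∑ℚ g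
∑ℚ-mono {zero}  f≤g = ℚ.≤-refl
∑ℚ-mono {suc n} f≤g = ℚ.+-mono-≤ (f≤g zero) (∑ℚ-mono (f≤g ∘ suc))

∑ℚ-cong : ∀ {n} {f g : Fin n → ℚ} → (∀ i → f i ≡ g i) → ∑ℚ f ≡ ∑ℚ g
∑ℚ-cong = ℚΣ.sum-cong-≗

0≤∑ℚ : ∀ {n} {f : Fin n → ℚ} → (∀ i → 0ℚ ℚ.≤ f i) → 0ℚ ℚ.≤ ∑ℚ f
0≤∑ℚ {zero}  0≤f = ℚ.≤-refl
0≤∑ℚ {suc n} 0≤f = ℚ.≤-trans (ℚ.≤-reflexive (sym (ℚ.+-identityʳ 0ℚ))) (ℚ.+-mono-≤ (0≤f zero) (0≤∑ℚ (0≤f ∘ suc)))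

term≤∑ℚ : ∀ {n} {f : Fin n → ℚ} → (∀ i → 0ℚ ℚ.≤ f i) → ∀ i → f i ℚ.≤ ∑ℚ f
term≤∑ℚ 0≤f zero    = ≤-by _ (0≤∑ℚ (0≤f ∘ suc)) refl
term≤∑ℚ {f = f} 0≤f (suc i) = ℚ.≤-trans (term≤∑ℚ (0≤f ∘ suc) i)
  (≤-by (f zero) (0≤f zero) (ℚ.+-comm (f zero) _))

∣∑∣≤∑∣∣ : ∀ {n} (f : Fin n → ℚ) → ∣ ∑ℚ f ∣ ℚ.≤ ∑ℚ (∣_∣ ∘ f)
∣∑∣≤∑∣∣ {zero}  f = ℚ.≤-refl
∣∑∣≤∑∣∣ {suc n} f = ℚ.≤-trans (ℚ.∣p+q∣≤∣p∣+∣q∣ (f zero) (∑ℚ (f ∘ suc)))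
  (ℚ.+-monoʳ-≤ ∣ f zero ∣ (∣∑∣≤∑∣∣ (f ∘ suc)))

-- Real numbers

≤ℝ-trans : ∀ {x y z} → x ≤ℝ y → y ≤ℝ z → x ≤ℝ z
≤ℝ-trans {x} {y} {z} x≤y y≤z ε 0<ε with x≤y (½ ℚ.* ε) (0<½* 0<ε) | y≤z (½ ℚ.* ε) (0<½* 0<ε)
... | N₁ , h₁ | N₂ , h₂ = N₁ ⊔ N₂ , λ n N≤n → begin
  seq x n                               ≤⟨ h₁ n (ℕ.m⊔n≤o⇒m≤o N₁ N₂ N≤n) ⟩
  seq y n ℚ.+ ½ ℚ.* ε                   ≤⟨ ℚ.+-monoˡ-≤ (½ ℚ.* ε) (h₂ n (ℕ.m⊔n≤o⇒n≤o N₁ N₂ N≤n)) ⟩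
  seq z n ℚ.+ ½ ℚ.* ε ℚ.+ ½ ℚ.* ε       ≡⟨ ℚ.+-assoc (seq z n) _ _ ⟩
  seq z n ℚ.+ (½ ℚ.* ε ℚ.+ ½ ℚ.* ε)     ≡⟨ cong (seq z n ℚ.+_) (½+½ ε) ⟩
  seq z n ℚ.+ ε                         ∎
  where open ℚ.≤-Reasoning

≃⇒≤ : ∀ {x y} → x ≃ y → x ≤ℝ y
≃⇒≤ {x} {y} x≃y ε 0<ε with x≃y ε 0<ε
... | N , h = N , λ n N≤n → ℚ.≤-trans (≤+∣-∣ (seq x n) (seq y n)) (ℚ.+-monoʳ-≤ (seq y n) (h n N≤n))

≃-sym : ∀ {x y} → x ≃ y → y ≃ x
≃-sym {x} {y} x≃y ε 0<ε with x≃y ε 0<ε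
... | N , h = N , λ n N≤n → subst (ℚ._≤ ε) (∣-∣-sym (seq x n) (seq y n)) (h n N≤n)

≤ℝ-antisym : ∀ {x y} → x ≤ℝ y → y ≤ℝ x → x ≃ y
≤ℝ-antisym {x} {y} x≤y y≤x ε 0<ε with x≤y ε 0<ε | y≤x ε 0<ε
... | N₁ , h₁ | N₂ , h₂ = N₁ ⊔ N₂ , λ n N≤n → ∣∣≤
  (≤-by _ (0≤-diff (h₁ n (ℕ.m⊔n≤o⇒m≤o N₁ N₂ N≤n))) (regroup₁ ε (seq x n) (seq y n)))
  (≤-by _ (0≤-diff (h₂ n (ℕ.m⊔n≤o⇒n≤o N₁ N₂ N≤n))) (regroup₂ ε (seq x n) (seq y n)))
  where
  open +-*-Solver
  regroup₁ : ∀ ε x y → ε ≡ x ℚ.- y ℚ.+ (y ℚ.+ ε ℚ.- x)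
  regroup₁ = solve 3 (λ ε x y → ε := x :- y :+ (y :+ ε :- x)) refl
  regroup₂ : ∀ ε x y → ε ≡ ℚ.- (x ℚ.- y) ℚ.+ (x ℚ.+ ε ℚ.- y)
  regroup₂ = solve 3 (λ ε x y → ε := :- (x :- y) :+ (x :+ ε :- y)) refl

fromℚ-cancel-≤ : ∀ {p q} → fromℚ p ≤ℝ fromℚ q → p ℚ.≤ q
fromℚ-cancel-≤ {p} {q} p≤q = ℚ.≮⇒≥ λ q<p →
  let ε   = ½ ℚ.* (p ℚ.- q)
      0<d = subst (ℚ._< p ℚ.- q) (ℚ.+-inverseʳ q) (ℚ.+-monoˡ-< (ℚ.- q) q<p)
      N , h = p≤q ε (0<½* 0<d)
  in ℚ.<-irrefl refl (ℚ.<-≤-trans (<-by ε (0<½* 0<d) (regroup p q)) (h N ℕ.≤-refl))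
  where
  open +-*-Solver
  regroup : ∀ p q → p ≡ q ℚ.+ ½ ℚ.* (p ℚ.- q) ℚ.+ ½ ℚ.* (p ℚ.- q)
  regroup = solve 2 (λ p q → p := q :+ con ½ :* (p :- q) :+ con ½ :* (p :- q)) refl

seq-sum : ∀ {n} (f : Fin n → ℝ) m → seq (sum f) m ≡ ∑ℚ (λ i → seq (f i) m)
seq-sum {zero}  f m = refl
seq-sum {suc n} f m = cong (seq (f zero) m ℚ.+_) (seq-sum (f ∘ suc) m)

eventuallyAll : ∀ {n} {P : Fin n → ℕ → Set} →
  (∀ i → ∃[ N ] ∀ m → N ≤ m → P i m) → ∃[ N ] ∀ m → N ≤ m → ∀ i → P i m
eventuallyAll {zero}  ev = 0 , λ _ _ ()
eventuallyAll {suc n} {P} ev with ev zero | eventuallyAll {P = P ∘ suc} (ev ∘ suc)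
... | N₁ , h₁ | N₂ , h₂ = N₁ ⊔ N₂ , λ where
  m N≤m zero    → h₁ m (ℕ.m⊔n≤o⇒m≤o N₁ N₂ N≤m)
  m N≤m (suc i) → h₂ m (ℕ.m⊔n≤o⇒n≤o N₁ N₂ N≤m) i

-- Collatz–Wielandt bound

module _ {n} (M : Fin n → Fin n → ℚ) (0≤M : ∀ i j → 0ℚ ℚ.≤ M i j) (M-sym : ∀ i j → M i j ≡ M j i)
         (x : Fin n → ℚ) (0<x : ∀ i → 0ℚ ℚ.< x i) (ℓ : ℚ)
         (Mx≤ℓx : ∀ i → ∑ℚ (λ j → M i j ℚ.* x j) ℚ.≤ ℓ ℚ.* x i) where

  private
    0≤x : ∀ i → 0ℚ ℚ.≤ x i
    0≤x = ℚ.<⇒≤ ∘ 0<x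

  -- As M is symmetric, pairing M∣v∣ with x transfers the bound on Mx to the
  -- weighted ℓ¹-norm of v.
  weightedNorm≤ : ∀ (v : Fin n → ℚ) q η d → 0ℚ ℚ.≤ d → ℓ ℚ.+ η ℚ.≤ q →
    (∀ i → ∣ ∑ℚ (λ j → M i j ℚ.* v j) ℚ.- q ℚ.* v i ∣ ℚ.≤ d) →
    η ℚ.* ∑ℚ (λ i → x i ℚ.* ∣ v i ∣) ℚ.≤ d ℚ.* ∑ℚ x
  weightedNorm≤ v q η d 0≤d ℓ+η≤q residual = ≤-by _ (0≤-diff total) (regroup ℓ η (∑ℚ (λ i → x i ℚ.* ∣ v i ∣)) (d ℚ.* ∑ℚ x))
    where
    open ℚ.≤-Reasoning
    open +-*-Solver using (solve; _:+_; _:*_; _:-_; _:=_)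
    regroup : ∀ ℓ η S D → D ≡ η ℚ.* S ℚ.+ (ℓ ℚ.* S ℚ.+ D ℚ.- (ℓ ℚ.+ η) ℚ.* S)
    regroup = solve 4 (λ ℓ η S D → D := η :* S :+ (ℓ :* S :+ D :- (ℓ :+ η) :* S)) refl
    pointwise : ∀ i → (ℓ ℚ.+ η) ℚ.* (x i ℚ.* ∣ v i ∣) ℚ.≤ ∑ℚ (λ j → x i ℚ.* (M i j ℚ.* ∣ v j ∣)) ℚ.+ d ℚ.* x i
    pointwise i = begin
      (ℓ ℚ.+ η) ℚ.* (x i ℚ.* ∣ v i ∣)
        ≡⟨ swap (ℓ ℚ.+ η) (x i) ∣ v i ∣ ⟩
      x i ℚ.* (∣ v i ∣ ℚ.* (ℓ ℚ.+ η))
        ≤⟨ *-monoˡ (0≤x i) (*-monoˡ (ℚ.0≤∣p∣ (v i)) (ℚ.≤-trans ℓ+η≤q (p≤∣p∣ q))) ⟩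
      x i ℚ.* (∣ v i ∣ ℚ.* ∣ q ∣)
        ≡⟨ cong (x i ℚ.*_) (trans (ℚ.*-comm ∣ v i ∣ ∣ q ∣) (sym (ℚ.∣p*q∣≡∣p∣*∣q∣ q (v i)))) ⟩
      x i ℚ.* ∣ q ℚ.* v i ∣
        ≡⟨ cong (λ t → x i ℚ.* ∣ t ∣) (split (q ℚ.* v i) (∑ℚ (λ j → M i j ℚ.* v j))) ⟩
      x i ℚ.* ∣ ∑ℚ (λ j → M i j ℚ.* v j) ℚ.+ (q ℚ.* v i ℚ.- ∑ℚ (λ j → M i j ℚ.* v j)) ∣
        ≤⟨ *-monoˡ (0≤x i) (ℚ.≤-trans (ℚ.∣p+q∣≤∣p∣+∣q∣ (∑ℚ (λ j → M i j ℚ.* v j)) (q ℚ.* v i ℚ.- ∑ℚ (λ j → M i j ℚ.* v j)))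
             (ℚ.+-mono-≤ (∣∑∣≤∑∣∣ (λ j → M i j ℚ.* v j)) (subst (ℚ._≤ d) (∣-∣-sym (∑ℚ (λ j → M i j ℚ.* v j)) (q ℚ.* v i)) (residual i)))) ⟩
      x i ℚ.* (∑ℚ (λ j → ∣ M i j ℚ.* v j ∣) ℚ.+ d)
        ≡⟨ cong (λ s → x i ℚ.* (s ℚ.+ d)) (∑ℚ-cong λ j → trans (ℚ.∣p*q∣≡∣p∣*∣q∣ (M i j) (v j)) (cong (ℚ._* ∣ v j ∣) (ℚ.0≤p⇒∣p∣≡p (0≤M i j)))) ⟩
      x i ℚ.* (∑ℚ (λ j → M i j ℚ.* ∣ v j ∣) ℚ.+ d)
        ≡⟨ trans (ℚ.*-distribˡ-+ (x i) (∑ℚ (λ j → M i j ℚ.* ∣ v j ∣)) d)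
             (cong₂ ℚ._+_ (ℚΣ.*-distribˡ-sum (x i) (λ j → M i j ℚ.* ∣ v j ∣)) (ℚ.*-comm (x i) d)) ⟩
      ∑ℚ (λ j → x i ℚ.* (M i j ℚ.* ∣ v j ∣)) ℚ.+ d ℚ.* x i ∎
      where
      swap : ∀ l x a → l ℚ.* (x ℚ.* a) ≡ x ℚ.* (a ℚ.* l)
      swap = solve 3 (λ l x a → l :* (x :* a) := x :* (a :* l)) refl
      split : ∀ p s → p ≡ s ℚ.+ (p ℚ.- s)
      split = solve 2 (λ p s → p := s :+ (p :- s)) refl
    column : ∀ j → ∑ℚ (λ i → x i ℚ.* (M i j ℚ.* ∣ v j ∣)) ℚ.≤ ℓ ℚ.* (x j ℚ.* ∣ v j ∣)
    column j = begin
      ∑ℚ (λ i → x i ℚ.* (M i j ℚ.* ∣ v j ∣))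
        ≡⟨ ∑ℚ-cong (λ i → trans (cong (λ t → x i ℚ.* (t ℚ.* ∣ v j ∣)) (M-sym i j)) (rotate (x i) (M j i) ∣ v j ∣)) ⟩
      ∑ℚ (λ i → ∣ v j ∣ ℚ.* (M j i ℚ.* x i))
        ≡⟨ sym (ℚΣ.*-distribˡ-sum ∣ v j ∣ (λ i → M j i ℚ.* x i)) ⟩
      ∣ v j ∣ ℚ.* ∑ℚ (λ i → M j i ℚ.* x i)
        ≤⟨ *-monoˡ (ℚ.0≤∣p∣ (v j)) (Mx≤ℓx j) ⟩
      ∣ v j ∣ ℚ.* (ℓ ℚ.* x j)
        ≡⟨ rotate′ ∣ v j ∣ ℓ (x j) ⟩
      ℓ ℚ.* (x j ℚ.* ∣ v j ∣) ∎
      where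
      rotate : ∀ x m a → x ℚ.* (m ℚ.* a) ≡ a ℚ.* (m ℚ.* x)
      rotate = solve 3 (λ x m a → x :* (m :* a) := a :* (m :* x)) refl
      rotate′ : ∀ a l x → a ℚ.* (l ℚ.* x) ≡ l ℚ.* (x ℚ.* a)
      rotate′ = solve 3 (λ a l x → a :* (l :* x) := l :* (x :* a)) refl
    total : (ℓ ℚ.+ η) ℚ.* ∑ℚ (λ i → x i ℚ.* ∣ v i ∣) ℚ.≤ ℓ ℚ.* ∑ℚ (λ i → x i ℚ.* ∣ v i ∣) ℚ.+ d ℚ.* ∑ℚ x
    total = begin
      (ℓ ℚ.+ η) ℚ.* ∑ℚ (λ i → x i ℚ.* ∣ v i ∣)
        ≡⟨ ℚΣ.*-distribˡ-sum (ℓ ℚ.+ η) (λ i → x i ℚ.* ∣ v i ∣) ⟩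
      ∑ℚ (λ i → (ℓ ℚ.+ η) ℚ.* (x i ℚ.* ∣ v i ∣))
        ≤⟨ ∑ℚ-mono pointwise ⟩
      ∑ℚ (λ i → ∑ℚ (λ j → x i ℚ.* (M i j ℚ.* ∣ v j ∣)) ℚ.+ d ℚ.* x i)
        ≡⟨ ℚΣ.∑-distrib-+ (λ i → ∑ℚ (λ j → x i ℚ.* (M i j ℚ.* ∣ v j ∣))) (λ i → d ℚ.* x i) ⟩
      ∑ℚ (λ i → ∑ℚ (λ j → x i ℚ.* (M i j ℚ.* ∣ v j ∣))) ℚ.+ ∑ℚ (λ i → d ℚ.* x i)
        ≡⟨ cong₂ ℚ._+_ (ℚΣ.∑-comm (λ i j → x i ℚ.* (M i j ℚ.* ∣ v j ∣))) (sym (ℚΣ.*-distribˡ-sum d x)) ⟩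
      ∑ℚ (λ j → ∑ℚ (λ i → x i ℚ.* (M i j ℚ.* ∣ v j ∣))) ℚ.+ d ℚ.* ∑ℚ x
        ≤⟨ ℚ.+-monoˡ-≤ (d ℚ.* ∑ℚ x) (∑ℚ-mono column) ⟩
      ∑ℚ (λ j → ℓ ℚ.* (x j ℚ.* ∣ v j ∣)) ℚ.+ d ℚ.* ∑ℚ x
        ≡⟨ cong (ℚ._+ d ℚ.* ∑ℚ x) (sym (ℚΣ.*-distribˡ-sum ℓ (λ i → x i ℚ.* ∣ v i ∣))) ⟩
      ℓ ℚ.* ∑ℚ (λ i → x i ℚ.* ∣ v i ∣) ℚ.+ d ℚ.* ∑ℚ x ∎

  -- One late approximation of q is compared with ℓ + ε/2, a decidable question about rationals. If
  -- it is larger, then q stays at least ε/4 above ℓ from there on, and `weightedNorm≤` forces every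
  -- coordinate of v to vanish, contrary to v being nonzero.
  eigenvalue≤ : (A : Matrix n) → (∀ i j m → seq (A i j) m ≡ M i j) →
    ∀ {q} → IsEigenvalue A q → q ≤ℝ fromℚ ℓ
  eigenvalue≤ A A≡M {q} (v , v≄0 , Av≃qv) ε 0<ε = decide (cauchy q ε/4 0<ε/4)
    where
    ε/4 : ℚ
    ε/4 = ½ ℚ.* (½ ℚ.* ε)
    0<ε/4 : 0ℚ ℚ.< ε/4
    0<ε/4 = 0<½* (0<½* 0<ε)

    residual : ∀ i m → ∣ seq (sum (λ j → A i j *ℝ v j)) m ℚ.- seq (q *ℝ v i) m ∣
      ≡ ∣ ∑ℚ (λ j → M i j ℚ.* seq (v j) m) ℚ.- seq q m ℚ.* seq (v i) m ∣
    residual i m = cong (λ s → ∣ s ℚ.- seq q m ℚ.* seq (v i) m ∣)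
      (trans (seq-sum (λ j → A i j *ℝ v j) m) (∑ℚ-cong λ j → cong (ℚ._* seq (v j) m) (A≡M i j m)))

    vanish : ∀ N → (∀ m → N ≤ m → ℓ ℚ.+ ε/4 ℚ.≤ seq q m) → ∀ i → v i ≃ 0ℝ
    vanish N₀ large i e 0<e =
      let 0<X = ℚ.<-≤-trans (0<x i) (term≤∑ℚ 0≤x i)
          0<r = 0<* 0<ε/4 (0<* (0<x i) 0<e)
          -- The residual `d` is chosen so that the bound on the weighted norm of v becomes ε/4
          -- times `x i * e`; comparing with the single term at i then leaves an absolute value of
          -- at most e.
          d , 0<d , Xd≡ = scale (∑ℚ x) (ε/4 ℚ.* (x i ℚ.* e)) 0<X 0<r
          N₁ , h = eventuallyAll λ j → Av≃qv j d 0<d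
      in N₀ ⊔ N₁ , λ m N≤m →
        let open ℚ.≤-Reasoning
            V = λ j → seq (v j) m
            norm≤ = weightedNorm≤ V (seq q m) ε/4 d (ℚ.<⇒≤ 0<d) (large m (ℕ.m⊔n≤o⇒m≤o N₀ N₁ N≤m))
                      (λ j → subst (ℚ._≤ d) (residual j m) (h m (ℕ.m⊔n≤o⇒n≤o N₀ N₁ N≤m) j))
        in subst (ℚ._≤ e) (cong ∣_∣ (sym (ℚ.+-identityʳ (V i))))
          (*-cancelˡ (0<x i) (*-cancelˡ 0<ε/4 (begin
            ε/4 ℚ.* (x i ℚ.* ∣ V i ∣)
              ≤⟨ *-monoˡ (ℚ.<⇒≤ 0<ε/4) (term≤∑ℚ {f = λ j → x j ℚ.* ∣ V j ∣} (λ j → 0≤* (0≤x j) (ℚ.0≤∣p∣ (V j))) i) ⟩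
            ε/4 ℚ.* ∑ℚ (λ j → x j ℚ.* ∣ V j ∣)
              ≤⟨ norm≤ ⟩
            d ℚ.* ∑ℚ x
              ≡⟨ trans (ℚ.*-comm d (∑ℚ x)) Xd≡ ⟩
            ε/4 ℚ.* (x i ℚ.* e) ∎)))

    decide : (∃[ N ] ∀ m n → N ≤ m → N ≤ n → ∣ seq q m ℚ.- seq q n ∣ ℚ.≤ ε/4) →
      ∃[ N ] ∀ m → N ≤ m → seq q m ℚ.≤ ℓ ℚ.+ ε
    decide (N , close) with seq q N ℚ.≤? ℓ ℚ.+ ½ ℚ.* ε
    ... | yes qN≤ = N , λ m N≤m → let open ℚ.≤-Reasoning in begin
      seq q m                                    ≤⟨ ≤+∣-∣ (seq q m) (seq q N) ⟩
      seq q N ℚ.+ ∣ seq q m ℚ.- seq q N ∣        ≤⟨ ℚ.+-mono-≤ qN≤ (close m N N≤m ℕ.≤-refl) ⟩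
      ℓ ℚ.+ ½ ℚ.* ε ℚ.+ ε/4                      ≤⟨ ≤-by ε/4 (ℚ.<⇒≤ 0<ε/4) (regroup ℓ ε) ⟩
      ℓ ℚ.+ ε                                    ∎
      where
      open +-*-Solver
      regroup : ∀ ℓ ε → ℓ ℚ.+ ε ≡ ℓ ℚ.+ ½ ℚ.* ε ℚ.+ ½ ℚ.* (½ ℚ.* ε) ℚ.+ ½ ℚ.* (½ ℚ.* ε)
      regroup = solve 2 (λ ℓ ε → ℓ :+ ε := ℓ :+ con ½ :* ε :+ con ½ :* (con ½ :* ε) :+ con ½ :* (con ½ :* ε)) refl
    ... | no qN≰ = ⊥-elim (v≄0 (vanish N λ m N≤m → ≤-by _ (ℚ.+-mono-≤ (0≤-diff (ℚ.<⇒≤ (ℚ.≰⇒> qN≰)))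
        (ℚ.+-mono-≤ (0≤-diff (close N m ℕ.≤-refl N≤m)) (0≤-diff (p≤∣p∣ (seq q N ℚ.- seq q m)))))
        (regroup ℓ ε (seq q m) (seq q N) ∣ seq q N ℚ.- seq q m ∣)))
      where
      open +-*-Solver
      regroup : ∀ ℓ ε q p a → q ≡ ℓ ℚ.+ ½ ℚ.* (½ ℚ.* ε) ℚ.+ (p ℚ.- (ℓ ℚ.+ ½ ℚ.* ε) ℚ.+ (½ ℚ.* (½ ℚ.* ε) ℚ.- a ℚ.+ (a ℚ.- (p ℚ.- q))))
      regroup = solve 5 (λ ℓ ε q p a → q := ℓ :+ con ½ :* (con ½ :* ε) :+ (p :- (ℓ :+ con ½ :* ε) :+ (con ½ :* (con ½ :* ε) :- a :+ (a :- (p :- q))))) refl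

-- Roots by bisection. The approximating sequence alternates between the two
-- ends of the shrinking interval, so f takes both signs on every tail of it;
-- hence f of the limit vanishes because it is a Cauchy sequence itself.

module Bisection (f : ℚ → ℚ) (lo₀ hi₀ : ℚ) (lo₀<hi₀ : lo₀ ℚ.< hi₀)
                 (f[lo₀]≤0 : f lo₀ ℚ.≤ 0ℚ) (0≤f[hi₀] : 0ℚ ℚ.≤ f hi₀) where

  middle : ℚ → ℚ → ℚ
  middle p q = ½ ℚ.* (p ℚ.+ q)

  record Bracket : Set where
    field
      lo hi    : ℚ
      lo≤hi    : lo ℚ.≤ hi
      f[lo]≤0  : f lo ℚ.≤ 0ℚ
      0≤f[hi]  : 0ℚ ℚ.≤ f hi

  open Bracket

  lo≤middle : ∀ {p q} → p ℚ.≤ q → p ℚ.≤ middle p q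
  lo≤middle {p} {q} p≤q = ≤-by _ (0≤* (ℚ.nonNegative⁻¹ ½) (0≤-diff p≤q)) (regroup p q)
    where
    open +-*-Solver
    regroup : ∀ p q → ½ ℚ.* (p ℚ.+ q) ≡ p ℚ.+ ½ ℚ.* (q ℚ.- p)
    regroup = solve 2 (λ p q → con ½ :* (p :+ q) := p :+ con ½ :* (q :- p)) refl

  middle≤hi : ∀ {p q} → p ℚ.≤ q → middle p q ℚ.≤ q
  middle≤hi {p} {q} p≤q = ≤-by _ (0≤* (ℚ.nonNegative⁻¹ ½) (0≤-diff p≤q)) (regroup p q)
    where
    open +-*-Solver
    regroup : ∀ p q → q ≡ ½ ℚ.* (p ℚ.+ q) ℚ.+ ½ ℚ.* (q ℚ.- p)
    regroup = solve 2 (λ p q → q := con ½ :* (p :+ q) :+ con ½ :* (q :- p)) refl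

  width : Bracket → ℚ
  width b = hi b ℚ.- lo b

  halve : (b : Bracket) → Σ[ c ∈ Bracket ]
    (lo b ℚ.≤ lo c × hi c ℚ.≤ hi b × width c ≡ ½ ℚ.* width b)
  halve b with f (middle (lo b) (hi b)) ℚ.≤? 0ℚ
  ... | yes ≤0 =
    record { lo = middle (lo b) (hi b) ; hi = hi b ; lo≤hi = middle≤hi (lo≤hi b) ; f[lo]≤0 = ≤0 ; 0≤f[hi] = 0≤f[hi] b } ,
    lo≤middle (lo≤hi b) , ℚ.≤-refl , regroup (lo b) (hi b)
    where
    open +-*-Solver
    regroup : ∀ p q → q ℚ.- ½ ℚ.* (p ℚ.+ q) ≡ ½ ℚ.* (q ℚ.- p)
    regroup = solve 2 (λ p q → q :- con ½ :* (p :+ q) := con ½ :* (q :- p)) refl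
  ... | no ≰0 =
    record { lo = lo b ; hi = middle (lo b) (hi b) ; lo≤hi = lo≤middle (lo≤hi b) ; f[lo]≤0 = f[lo]≤0 b ; 0≤f[hi] = ℚ.<⇒≤ (ℚ.≰⇒> ≰0) } ,
    ℚ.≤-refl , middle≤hi (lo≤hi b) , regroup (lo b) (hi b)
    where
    open +-*-Solver
    regroup : ∀ p q → ½ ℚ.* (p ℚ.+ q) ℚ.- p ≡ ½ ℚ.* (q ℚ.- p)
    regroup = solve 2 (λ p q → con ½ :* (p :+ q) :- p := con ½ :* (q :- p)) refl

  bracket : ℕ → Bracket
  bracket zero    = record { lo = lo₀ ; hi = hi₀ ; lo≤hi = ℚ.<⇒≤ lo₀<hi₀ ; f[lo]≤0 = f[lo₀]≤0 ; 0≤f[hi] = 0≤f[hi₀] }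
  bracket (suc m) = proj₁ (halve (bracket m))

  nested : ∀ {m n} → m ≤′ n → lo (bracket m) ℚ.≤ lo (bracket n) × hi (bracket n) ℚ.≤ hi (bracket m)
  nested ≤′-refl = ℚ.≤-refl , ℚ.≤-refl
  nested (≤′-step {n} m≤n) =
    let l , h = nested m≤n ; _ , l′ , h′ , _ = halve (bracket n)
    in ℚ.≤-trans l l′ , ℚ.≤-trans h′ h

  0≤width : ∀ b → 0ℚ ℚ.≤ width b
  0≤width b = 0≤-diff (lo≤hi b)

  -- Linear decay suffices and avoids powers of two: a halving step turns the factor m + 2 into (m +
  -- 2)/2 ≤ m + 1.
  width≤ : ∀ m → ι (suc m) ℚ.* width (bracket m) ℚ.≤ width (bracket 0)
  width≤ zero    = ℚ.≤-reflexive (trans (cong (ℚ._* width (bracket 0)) ι-1) (ℚ.*-identityˡ (width (bracket 0))))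
  width≤ (suc m) = begin
    ι (2 + m) ℚ.* width (bracket (suc m))
      ≡⟨ cong₂ ℚ._*_ (trans (ι-suc (suc m)) (cong (1ℚ ℚ.+_) (ι-suc m))) (proj₂ (proj₂ (proj₂ (halve (bracket m))))) ⟩
    (1ℚ ℚ.+ (1ℚ ℚ.+ ι m)) ℚ.* (½ ℚ.* w)
      ≤⟨ ≤-by _ (0≤* (0≤* (ℚ.nonNegative⁻¹ ½) (0≤ι m)) (0≤width (bracket m))) (regroup (ι m) w) ⟩
    (1ℚ ℚ.+ ι m) ℚ.* w
      ≡⟨ cong (ℚ._* w) (sym (ι-suc m)) ⟩
    ι (suc m) ℚ.* w
      ≤⟨ width≤ m ⟩
    width (bracket 0) ∎
    where
    open ℚ.≤-Reasoning
    open +-*-Solver using (solve; con; _:+_; _:*_; _:=_)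
    w = width (bracket m)
    regroup : ∀ m w → (1ℚ ℚ.+ m) ℚ.* w ≡ (1ℚ ℚ.+ (1ℚ ℚ.+ m)) ℚ.* (½ ℚ.* w) ℚ.+ ½ ℚ.* m ℚ.* w
    regroup = solve 2 (λ m w → (con 1ℚ :+ m) :* w := (con 1ℚ :+ (con 1ℚ :+ m)) :* (con ½ :* w) :+ con ½ :* m :* w) refl

  0<width₀ : 0ℚ ℚ.< width (bracket 0)
  0<width₀ = subst (ℚ._< hi₀ ℚ.- lo₀) (ℚ.+-inverseʳ lo₀) (ℚ.+-monoˡ-< (ℚ.- lo₀) lo₀<hi₀)

  narrow : ∀ ε → 0ℚ ℚ.< ε → ∃[ N ] width (bracket N) ℚ.≤ ε
  narrow ε 0<ε =
    let c , 0<c , εc≡w = scale ε (width (bracket 0)) 0<ε 0<width₀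
        N , c≤N = archimedean c
    in N , *-cancelˡ (0<ι (suc N)) (let open ℚ.≤-Reasoning in begin
      ι (suc N) ℚ.* width (bracket N)  ≤⟨ width≤ N ⟩
      width (bracket 0)                ≡⟨ sym εc≡w ⟩
      ε ℚ.* c                          ≤⟨ *-monoˡ (ℚ.<⇒≤ 0<ε) (ℚ.≤-trans c≤N (ι-mono (ℕ.n≤1+n N))) ⟩
      ε ℚ.* ι (suc N)                  ≡⟨ ℚ.*-comm ε (ι (suc N)) ⟩
      ι (suc N) ℚ.* ε                  ∎)

  alternate : ℕ → ℚ → ℚ → ℚ
  alternate zero          p q = p
  alternate (suc zero)    p q = q
  alternate (suc (suc m)) p q = alternate m p q

  approx : ℕ → ℚ
  approx m = alternate m (lo (bracket m)) (hi (bracket m))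

  alternate-bounds : ∀ m {p q} → p ℚ.≤ q → p ℚ.≤ alternate m p q × alternate m p q ℚ.≤ q
  alternate-bounds zero          p≤q = ℚ.≤-refl , p≤q
  alternate-bounds (suc zero)    p≤q = p≤q , ℚ.≤-refl
  alternate-bounds (suc (suc m)) p≤q = alternate-bounds m p≤q

  approx-bounds : ∀ {N m} → N ≤ m → lo (bracket N) ℚ.≤ approx m × approx m ℚ.≤ hi (bracket N)
  approx-bounds {N} {m} N≤m =
    let l , h = nested (ℕ.≤⇒≤′ N≤m) ; l′ , h′ = alternate-bounds m (lo≤hi (bracket m))
    in ℚ.≤-trans l l′ , ℚ.≤-trans h′ h

  within : ∀ {l h p q} → l ℚ.≤ p → p ℚ.≤ h → l ℚ.≤ q → q ℚ.≤ h → ∣ p ℚ.- q ∣ ℚ.≤ h ℚ.- l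
  within {l} {h} {p} {q} l≤p p≤h l≤q q≤h = ∣∣≤
    (≤-by _ (ℚ.+-mono-≤ (0≤-diff p≤h) (0≤-diff l≤q)) (regroup₁ l h p q))
    (≤-by _ (ℚ.+-mono-≤ (0≤-diff q≤h) (0≤-diff l≤p)) (regroup₂ l h p q))
    where
    open +-*-Solver
    regroup₁ : ∀ l h p q → h ℚ.- l ≡ p ℚ.- q ℚ.+ (h ℚ.- p ℚ.+ (q ℚ.- l))
    regroup₁ = solve 4 (λ l h p q → h :- l := p :- q :+ (h :- p :+ (q :- l))) refl
    regroup₂ : ∀ l h p q → h ℚ.- l ≡ ℚ.- (p ℚ.- q) ℚ.+ (h ℚ.- q ℚ.+ (p ℚ.- l))
    regroup₂ = solve 4 (λ l h p q → h :- l := :- (p :- q) :+ (h :- q :+ (p :- l))) refl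

  root : ℝ
  root = mkℝ approx λ ε 0<ε →
    let N , w≤ε = narrow ε 0<ε
    in N , λ m n N≤m N≤n →
      let l , h = approx-bounds N≤m ; l′ , h′ = approx-bounds N≤n
      in ℚ.≤-trans (within l h l′ h′) w≤ε

  -- Consecutive approximations are opposite ends of their brackets, so the values of f there have
  -- opposite signs, and neither can exceed their distance in absolute value.
  signs : ∀ m {p q} r s → f p ℚ.≤ 0ℚ → 0ℚ ℚ.≤ f q → f r ℚ.≤ 0ℚ → 0ℚ ℚ.≤ f s →
    ∣ f (alternate m p q) ∣ ℚ.≤ ∣ f (alternate m p q) ℚ.- f (alternate (suc m) r s) ∣
  signs zero {p} {q} r s fp fq fr fs = ∣∣≤
    (ℚ.≤-trans fp (ℚ.0≤∣p∣ _))
    (ℚ.≤-trans (≤-by (f s) fs (regroup (f p) (f s))) (-p≤∣p∣ (f p ℚ.- f s)))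
    where
    open +-*-Solver
    regroup : ∀ p q → ℚ.- (p ℚ.- q) ≡ ℚ.- p ℚ.+ q
    regroup = solve 2 (λ p q → :- (p :- q) := :- p :+ q) refl
  signs (suc zero) {p} {q} r s fp fq fr fs = ∣∣≤
    (ℚ.≤-trans (≤-by (ℚ.- f r) (ℚ.neg-antimono-≤ fr) refl) (p≤∣p∣ (f q ℚ.- f r)))
    (ℚ.≤-trans (ℚ.neg-antimono-≤ fq) (ℚ.0≤∣p∣ _))
  signs (suc (suc m)) r s fp fq fr fs = signs m r s fp fq fr fs

  oscillation : ∀ m → ∣ f (approx m) ∣ ℚ.≤ ∣ f (approx m) ℚ.- f (approx (suc m)) ∣
  oscillation m = signs m {lo b} {hi b} (lo c) (hi c) (f[lo]≤0 b) (0≤f[hi] b) (f[lo]≤0 c) (0≤f[hi] c)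
    where
    b = bracket m
    c = bracket (suc m)

  isRoot : (F : ℝ → ℝ) → (∀ x m → seq (F x) m ≡ f (seq x m)) → F root ≃ 0ℝ
  isRoot F F≡f ε 0<ε = proj₁ tail , λ m N≤m →
    subst (ℚ._≤ ε) (cong ∣_∣ (trans (sym (F≡f root m)) (sym (ℚ.+-identityʳ (seq (F root) m)))))
      (ℚ.≤-trans (oscillation m)
        (subst (ℚ._≤ ε) (cong₂ (λ s t → ∣ s ℚ.- t ∣) (F≡f root m) (F≡f root (suc m)))
          (proj₂ tail m (suc m) N≤m (ℕ.m≤n⇒m≤1+n N≤m))))
    where
    tail = cauchy (F root) ε 0<ε

  lo₀≤root : fromℚ lo₀ ≤ℝ root
  lo₀≤root ε 0<ε = 0 , λ m _ → ℚ.≤-trans (proj₁ (approx-bounds {0} {m} z≤n)) (≤-by ε (ℚ.<⇒≤ 0<ε) refl)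

  -- From some index on, `root` lies above the lower end of a narrow bracket, hence less than its
  -- width below the upper end.
  ≤root : ∀ {q} → (∀ m → q ≤ℝ fromℚ (hi (bracket m))) → q ≤ℝ root
  ≤root {q} q≤hi ε 0<ε =
    let N₁ , w≤ = narrow (½ ℚ.* ε) (0<½* 0<ε)
        N₂ , h  = q≤hi N₁ (½ ℚ.* ε) (0<½* 0<ε)
    in N₁ ⊔ N₂ , λ m N≤m → ≤-by _
      (ℚ.+-mono-≤ (0≤-diff (h m (ℕ.m⊔n≤o⇒n≤o N₁ N₂ N≤m)))
        (ℚ.+-mono-≤ (0≤-diff w≤) (0≤-diff (proj₁ (approx-bounds {N₁} (ℕ.m⊔n≤o⇒m≤o N₁ N₂ N≤m))))))
      (regroup (seq q m) (hi (bracket N₁)) (lo (bracket N₁)) (approx m) ε)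
    where
    open +-*-Solver
    regroup : ∀ q h l r ε → r ℚ.+ ε ≡ q ℚ.+ (h ℚ.+ ½ ℚ.* ε ℚ.- q ℚ.+ (½ ℚ.* ε ℚ.- (h ℚ.- l) ℚ.+ (r ℚ.- l)))
    regroup = solve 5 (λ q h l r ε → r :+ ε := q :+ (h :+ con ½ :* ε :- q :+ (con ½ :* ε :- (h :- l) :+ (r :- l)))) refl

-- Numerical inequalities

between : ∀ {a b c} → a ≤ b → b ≤ c → ∃[ p ] ∃[ r ] (b ≡ a + p × c ≡ a + p + r)
between {a} {b} {c} a≤b b≤c = b ∸ a , c ∸ b , sym (ℕ.m+[n∸m]≡n a≤b) ,
  sym (trans (cong (_+ (c ∸ b)) (ℕ.m+[n∸m]≡n a≤b)) (ℕ.m+[n∸m]≡n b≤c))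

-- Lower bounds on k become half-planes p + r ≥ c in the slack variables, whereas `byCoefficients`
-- accepts only boxes; this covers the half-plane by two of them.
split-large : ∀ a b {p r} → a + b ≤ suc (p + r) → a ≤ p ⊎ b ≤ r
split-large a b {p} {r} large with a ≤? p
... | yes a≤p = inj₁ a≤p
... | no a≰p  = inj₂ (ℕ.+-cancelˡ-≤ (suc p) b r (ℕ.≤-trans (ℕ.+-monoˡ-≤ b (ℕ.≰⇒> a≰p)) large))

module DegreeBound where
  -- The inequality for a vertex of degree d whose neighbours have degree sum S.
  Bound : ℕ → ℕ → ℕ → Set
  Bound k d S = k * d * (k * k * d) + k * (k * k * S) + 5 * (k * k + k + 3)
    ≤ (k * k + k + 3) * (k * k * d) + 10 * (k * d)

  private
    K D s L lhs rhs : Expr 3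
    K = arg 0F
    D = arg 1F
    s = arg 2F
    L = K ⊠ K ⊞ K ⊞ lit 3
    lhs = K ⊠ D ⊠ (K ⊠ K ⊠ D) ⊞ K ⊠ (K ⊠ K ⊠ s) ⊞ lit 5 ⊠ L
    rhs = L ⊠ (K ⊠ K ⊠ D) ⊞ lit 10 ⊠ (K ⊠ D)

  weaken : ∀ {k d S S′} → S ≤ S′ → Bound k d S′ → Bound k d S
  weaken {k} {d} S≤S′ = ℕ.≤-trans (ℕ.+-monoˡ-≤ (5 * (k * k + k + 3)) (ℕ.+-monoʳ-≤ (k * d * (k * k * d)) (ℕ.*-monoʳ-≤ k (ℕ.*-monoʳ-≤ (k * k) S≤S′))))

  -- When all degrees are below k, the two neighbours have degree sum at most 2 (k - 1), written
  -- here as k + (k ∸ 2).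
  minimal : ∀ {k} → 22 ≤ k → Bound k 2 (k + (k ∸ 2))
  minimal {k} 22≤k = byCoefficients {ρ = k ∸ 2 ∷ []} {k ∷ 2 ∷ k + (k ∸ 2) ∷ []}
    {lit 2 ⊞ arg 0F ∷ lit 2 ∷ lit 2 ⊞ arg 0F ⊞ arg 0F ∷ []}
    (k≡ ∷ refl ∷ cong (_+ (k ∸ 2)) k≡ ∷ []) (ℕ.∸-monoˡ-≤ 2 22≤k ∷ []) lhs rhs refl
    where
    k≡ : k ≡ 2 + (k ∸ 2)
    k≡ = sym (ℕ.m+[n∸m]≡n (ℕ.≤-trans (s≤s (s≤s z≤n)) 22≤k))

  -- The case d = k - 1, which forces the shift by 5: with the bare degrees as vector the quotient
  -- would be k + 1 + 3/(k - 1).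
  maximal : ∀ {d} → 21 ≤ d → Bound (1 + d) d (2 * (1 + d) + 1)
  maximal {d} 21≤d = byCoefficients {ρ = d ∷ []} {1 + d ∷ d ∷ 2 * (1 + d) + 1 ∷ []}
    {lit 1 ⊞ arg 0F ∷ arg 0F ∷ lit 2 ⊠ (lit 1 ⊞ arg 0F) ⊞ lit 1 ∷ []}
    (refl ∷ refl ∷ refl ∷ []) (21≤d ∷ []) lhs rhs refl

  intermediate : ∀ {k d} → 22 ≤ k → 3 ≤ d → d + 2 ≤ k → Bound k d (2 * k + 1)
  intermediate {k} {d} 22≤k 3≤d d+2≤k with between (ℕ.+-monoˡ-≤ 2 3≤d) d+2≤k
  -- A positive p or r makes all coefficients nonnegative. At p = r = 0, that is k = 5 and d = 3,
  -- the inequality is false, so a single check over the whole quadrant cannot succeed.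
  ... | p , r , d+2≡ , k≡ with split-large 1 1 {p} {r} (ℕ.+-cancelˡ-≤ 5 2 _ (ℕ.≤-trans (ℕ.m≤m+n 7 16) (ℕ.≤-trans (s≤s 22≤k) (ℕ.≤-reflexive (trans (cong suc k≡) (sym (ℕ.+-suc 5 (p + r))))))))
  ...   | inj₁ 1≤p = byCoefficients {ρ = p ∷ r ∷ []} {k ∷ d ∷ 2 * k + 1 ∷ []}
    {lit 5 ⊞ arg 0F ⊞ arg 1F ∷ lit 3 ⊞ arg 0F ∷ lit 2 ⊠ (lit 5 ⊞ arg 0F ⊞ arg 1F) ⊞ lit 1 ∷ []}
    (k≡ ∷ ℕ.+-cancelʳ-≡ 2 d (3 + p) (trans d+2≡ (ℕ.+-comm 2 (3 + p))) ∷ cong (λ k → 2 * k + 1) k≡ ∷ []) (1≤p ∷ z≤n ∷ []) lhs rhs refl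
  ...   | inj₂ 1≤r = byCoefficients {ρ = p ∷ r ∷ []} {k ∷ d ∷ 2 * k + 1 ∷ []}
    {lit 5 ⊞ arg 0F ⊞ arg 1F ∷ lit 3 ⊞ arg 0F ∷ lit 2 ⊠ (lit 5 ⊞ arg 0F ⊞ arg 1F) ⊞ lit 1 ∷ []}
    (k≡ ∷ ℕ.+-cancelʳ-≡ 2 d (3 + p) (trans d+2≡ (ℕ.+-comm 2 (3 + p))) ∷ cong (λ k → 2 * k + 1) k≡ ∷ []) (z≤n ∷ 1≤r ∷ []) lhs rhs refl

  bound : ∀ {k d S} → 22 ≤ k → 2 ≤ d → suc d ≤ k → S ≤ 2 * k + 1 → S + d ≤ d * k → Bound k d S
  bound {k} {d} {S} 22≤k 2≤d d<k S≤ S+d≤ with 3 ≤? d | d + 2 ≤? k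
  ... | yes 3≤d | yes d+2≤k = weaken {k} {d} S≤ (intermediate 22≤k 3≤d d+2≤k)
  ... | yes 3≤d | no d+2≰k rewrite ℕ.≤-antisym (ℕ.≤-pred (ℕ.≤-trans (ℕ.≰⇒> d+2≰k) (ℕ.≤-reflexive (ℕ.+-comm d 2)))) d<k =
    weaken {suc d} {d} S≤ (maximal (ℕ.≤-pred 22≤k))
  ... | no 3≰d | _ with ℕ.≤-antisym (ℕ.≤-pred (ℕ.≰⇒> 3≰d)) 2≤d
  ...   | refl = weaken {k} {2} (ℕ.+-cancelʳ-≤ 2 S _ (ℕ.≤-trans S+d≤ (ℕ.≤-reflexive
      (sym (trans (ℕ.+-assoc k (k ∸ 2) 2) (cong (k ℕ.+_) (trans (ℕ.m∸n+n≡m (ℕ.≤-trans (s≤s (s≤s z≤n)) 22≤k)) (sym (ℕ.+-identityʳ k))))))))) (minimal 22≤k)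

-- k² - 2k + 3 for k ≥ 2.
scaleQ : ℕ → ℕ
scaleQ k = k * (k ∸ 2) + 3

module StarBound where
  private
    k≥2 : ∀ {k} → 22 ≤ k → 2 ≤ k
    k≥2 = ℕ.≤-trans (s≤s (s≤s z≤n))

    K H Q L ξ y lhs lhs′ rhs : Expr 3
    K = arg 0F
    H = arg 1F
    Q = arg 2F
    L = K ⊠ K ⊞ K ⊞ lit 3
    ξ = K ⊠ (lit 3 ⊠ (K ⊠ K) ⊞ lit 9 ⊠ (K ⊞ lit 1) ⊞ lit 10)
    y = (lit 9 ⊠ H ⊞ lit 5) ⊠ Q
    lhs  = K ⊠ ((H ⊞ lit 1) ⊠ y ⊞ (ξ ⊞ Q ⊠ (lit 9 ⊠ K ⊞ lit 5 ⊠ H)))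
    lhs′ = K ⊠ (H ⊠ y ⊞ Q ⊠ (lit 9 ⊠ K ⊞ lit 5 ⊠ H))
    rhs  = L ⊠ y

  -- For a far vertex of degree h + 1 that shares a neighbour with the centre; the term k (3k² + 9
  -- (k + 1) + 10) bounds the entry of that neighbour. The inequality is most delicate towards both
  -- ends, h = 1 and h = k - 2.
  linked : ∀ {k h} → 22 ≤ k → 1 ≤ h → h + 2 ≤ k →
    k * ((h + 1) * ((9 * h + 5) * scaleQ k) + (k * (3 * (k * k) + 9 * (k + 1) + 10) + scaleQ k * (9 * k + 5 * h)))
      ≤ (k * k + k + 3) * ((9 * h + 5) * scaleQ k)
  linked {k} {h} 22≤k 1≤h h+2≤k with between (ℕ.+-monoˡ-≤ 2 1≤h) h+2≤k
  -- Here p = h - 1, r = k - h - 2 and p + r ≥ 19. Three boxes cover this region: p ≥ 9, r ≥ 14, and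
  -- p ≥ 6 together with r ≥ 11.
  ... | p , r , h+2≡ , k≡ = cases (split-large 6 14 large) (split-large 9 11 large)
    where
    Kₛ Hₛ Qₛ : Expr 2
    Kₛ = lit 3 ⊞ arg 0F ⊞ arg 1F
    Hₛ = lit 1 ⊞ arg 0F
    Qₛ = Kₛ ⊠ (lit 1 ⊞ arg 0F ⊞ arg 1F) ⊞ lit 3
    h≡ : h ≡ 1 + p
    h≡ = ℕ.+-cancelʳ-≡ 2 h (1 + p) (trans h+2≡ (ℕ.+-comm 2 (1 + p)))
    eqs : Defines (p ∷ r ∷ []) (k ∷ h ∷ scaleQ k ∷ []) (Kₛ ∷ Hₛ ∷ Qₛ ∷ [])
    eqs = k≡ ∷ h≡ ∷ cong (λ k → k * (k ∸ 2) + 3) k≡ ∷ []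
    large : 20 ≤ suc (p + r)
    large = ℕ.+-cancelˡ-≤ 3 20 _ (ℕ.≤-trans (s≤s 22≤k) (ℕ.≤-reflexive (trans (cong suc k≡) (sym (ℕ.+-suc 3 (p + r))))))
    cases : 6 ≤ p ⊎ 14 ≤ r → 9 ≤ p ⊎ 11 ≤ r → _
    cases _           (inj₁ 9≤p)  = byCoefficients eqs (9≤p ∷ z≤n ∷ []) lhs rhs refl
    cases (inj₂ 14≤r) _           = byCoefficients eqs (z≤n ∷ 14≤r ∷ []) lhs rhs refl
    cases (inj₁ 6≤p)  (inj₂ 11≤r) = byCoefficients eqs (6≤p ∷ 11≤r ∷ []) lhs rhs refl

  -- For a far vertex without a common neighbour with the centre: its degree is h itself, so h ≥ 2,
  -- and all its neighbours are far.
  unlinked : ∀ {k h} → 2 ≤ h → h + 1 ≤ k →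
    k * (h * ((9 * h + 5) * scaleQ k) + scaleQ k * (9 * k + 5 * h)) ≤ (k * k + k + 3) * ((9 * h + 5) * scaleQ k)
  unlinked {k} {h} 2≤h h+1≤k with between (ℕ.+-monoˡ-≤ 1 2≤h) h+1≤k
  ... | p , r , h+1≡ , k≡ = byCoefficients eqs (z≤n ∷ z≤n ∷ []) lhs′ rhs refl
    where
    Kₛ Hₛ Qₛ : Expr 2
    Kₛ = lit 3 ⊞ arg 0F ⊞ arg 1F
    Hₛ = lit 2 ⊞ arg 0F
    Qₛ = Kₛ ⊠ (lit 1 ⊞ arg 0F ⊞ arg 1F) ⊞ lit 3
    eqs : Defines (p ∷ r ∷ []) (k ∷ h ∷ scaleQ k ∷ []) (Kₛ ∷ Hₛ ∷ Qₛ ∷ [])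
    eqs = k≡ ∷ ℕ.+-cancelʳ-≡ 1 h (2 + p) (trans h+1≡ (ℕ.+-comm 1 (2 + p))) ∷ cong (λ k → k * (k ∸ 2) + 3) k≡ ∷ []

  centre : ∀ {k} → 22 ≤ k →
    8 * (k * k * (3 * (k * k) * scaleQ k)) + k * k * (24 * (k * k * k) + 9 * ((k + 1) * (k + 16)) + 40 * (k + 1))
      ≤ 8 * ((k * k + k + 3) * (3 * (k * k) * scaleQ k))
  centre {k} 22≤k = byCoefficients {ρ = k ∸ 2 ∷ []} {k ∷ 0 ∷ scaleQ k ∷ []}
    {lit 2 ⊞ arg 0F ∷ lit 0 ∷ (lit 2 ⊞ arg 0F) ⊠ arg 0F ⊞ lit 3 ∷ []}
    (k≡ ∷ refl ∷ cong (λ j → j * (k ∸ 2) + 3) k≡ ∷ []) (ℕ.∸-monoˡ-≤ 2 22≤k ∷ [])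
    (lit 8 ⊠ (K ⊠ K ⊠ X) ⊞ K ⊠ K ⊠ (lit 24 ⊠ (K ⊠ K ⊠ K) ⊞ lit 9 ⊠ ((K ⊞ lit 1) ⊠ (K ⊞ lit 16)) ⊞ lit 40 ⊠ (K ⊞ lit 1)))
    (lit 8 ⊠ (L ⊠ X)) refl
    where
    X = lit 3 ⊠ (K ⊠ K) ⊠ Q
    k≡ : k ≡ 2 + (k ∸ 2)
    k≡ = sym (ℕ.m+[n∸m]≡n (k≥2 22≤k))

  -- Writing ℓ = k + 1 + 3/k, this says that `scaleQ k` is k (ℓ - 3). The factor ℓ - 3 appears when
  -- the eigenvalue equation is solved at a vertex of degree three, or at the two equal inner
  -- vertices of a path of length three.
  scaleQ-identity : ∀ {k} → 22 ≤ k → 3 * k + scaleQ k ≡ k * k + k + 3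
  scaleQ-identity {k} 22≤k = subst (λ k → 3 * k + scaleQ k ≡ k * k + k + 3) (ℕ.m+[n∸m]≡n (k≥2 22≤k)) (identity (k ∸ 2))
    where
    identity : ∀ j → 3 * (2 + j) + ((2 + j) * j + 3) ≡ (2 + j) * (2 + j) + (2 + j) + 3
    identity = solve-∀

module PathBound where
  private
    K Q F e X M O P L : Expr 3
    K = arg 0F
    Q = arg 1F
    F = arg 2F
    e = Q ⊞ K
    X = e ⊠ F ⊠ Q
    M = lit 2 ⊠ K ⊠ F ⊠ Q
    O = K ⊠ e ⊠ F
    P = K ⊠ e ⊠ e ⊠ Q
    L = K ⊠ K ⊞ K ⊞ lit 3

  -- e² - 2k² for e = scaleQ k + k.
  scaleF : ℕ → ℕ
  scaleF k = j * (j * (j * (j + 6) + 17) + 22) + 17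
    where j = k ∸ 2

  -- With ℓ = k + 1 + 3/k, `scaleQ k + k` is k (ℓ - 2), so `scaleF k` is k² ((ℓ - 2)² - 2), the
  -- determinant met on eliminating the inner vertices of a path of length four with equal ends. The
  -- Horner form in k - 2 keeps it free of truncated subtraction.
  scaleF-identity : ∀ {k} → 22 ≤ k → scaleF k + 2 * (k * k) ≡ (scaleQ k + k) * (scaleQ k + k)
  scaleF-identity {k} 22≤k = subst (λ i → scaleF k + 2 * (i * i) ≡ (i * (k ∸ 2) + 3 + i) * (i * (k ∸ 2) + 3 + i))
    (ℕ.m+[n∸m]≡n (ℕ.≤-trans (s≤s (s≤s z≤n)) 22≤k)) (identity (k ∸ 2))
    where
    identity : ∀ j → j * (j * (j * (j + 6) + 17) + 22) + 17 + 2 * ((2 + j) * (2 + j)) ≡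
      ((2 + j) * j + 3 + (2 + j)) * ((2 + j) * j + 3 + (2 + j))
    identity = solve-∀

  private
    module _ {k} (22≤k : 22 ≤ k) where
      σ : Vec (Expr 1) 3
      σ = lit 2 ⊞ j ∷ (lit 2 ⊞ j) ⊠ j ⊞ lit 3 ∷ j ⊠ (j ⊠ (j ⊠ (j ⊞ lit 6) ⊞ lit 17) ⊞ lit 22) ⊞ lit 17 ∷ []
        where j = arg 0F
      eqs : Defines (k ∸ 2 ∷ []) (k ∷ scaleQ k ∷ scaleF k ∷ []) σ
      eqs = k≡ ∷ cong (λ j → j * (k ∸ 2) + 3) k≡ ∷ refl ∷ []
        where
        k≡ : k ≡ 2 + (k ∸ 2)
        k≡ = sym (ℕ.m+[n∸m]≡n (ℕ.≤-trans (s≤s (s≤s z≤n)) 22≤k))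

  -- Cancelling k² `scaleQ k` leaves k³ ≤ (k + 3) (k² - 2k + 3).
  threePaths : ∀ {k} → 22 ≤ k → k * (k * scaleQ k + k * k) ≤ (k * k + k + 3) * scaleQ k
  threePaths 22≤k = byCoefficients (eqs 22≤k) (ℕ.∸-monoˡ-≤ 2 22≤k ∷ []) (K ⊠ (K ⊠ Q ⊞ K ⊠ K)) (L ⊠ Q) refl

  -- The inequality at a centre with k - 2 ordinary neighbours; it is stated with k of them, and the
  -- two extra ones are compensated on the right, which avoids subtraction.
  fourPath : ∀ {k} → 22 ≤ k → let Q = scaleQ k; F = scaleF k; e = Q + k in
    k * (k * (e * F * Q) + (2 * k * F * Q + k * e * e * Q + k * (k * e * F))) ≤
    (k * k + k + 3) * (e * F * Q) + k * (2 * (k * e * F))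
  fourPath 22≤k = byCoefficients (eqs 22≤k) (ℕ.∸-monoˡ-≤ 2 22≤k ∷ [])
    (K ⊠ (K ⊠ X ⊞ (M ⊞ P ⊞ K ⊠ O))) (L ⊠ X ⊞ K ⊠ (lit 2 ⊠ O)) refl

-- Positive vectors x with Q x ≤ (k + 1 + 3/k) x, Q the signless Laplacian

Certificate : ∀ {n} → Graph (Fin n) → ℕ → Set
Certificate {n} G k = Σ[ x ∈ (Fin n → ℕ) ] (∀ v → 1 ≤ x v) ×
  (∀ v → k * (degree G v * x v + ∑ λ w → a G v w * x w) ≤ (k * k + k + 3) * x v)

-- Degrees in a graph of order 2k + 2

module Setting (k n : ℕ) (22≤k : 22 ≤ k) (n≡ : n ≡ 2 * k + 2) (G : Graph (Fin n))
               (free : Free (C₃ ∷ C₄ ∷ []) G) (2≤degree : ∀ v → 2 ≤ degree G v) where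

  open ShortCycleFree G free

  d : Fin n → ℕ
  d = degree G

  A : Fin n → Fin n → ℕ
  A = a G

  ∑A : (Fin n → ℕ) → Fin n → ℕ
  ∑A f v = ∑ λ w → A v w * f w

  ∑A1 : ∀ v c → ∑A (λ _ → c) v ≡ d v * c
  ∑A1 v c = trans (∑-*ʳ (A v) c) (cong (_* c) (sym (degree-∑ G v)))

  ∑A-mono : ∀ {f g} v → (∀ w → Adj G v w → f w ≤ g w) → ∑A f v ≤ ∑A g v
  ∑A-mono {f} {g} v f≤g = ∑-mono term
    where
    term : ∀ w → A v w * f w ≤ A v w * g w
    term w with adj G v w in v~w
    ... | false = z≤n
    ... | true  = ℕ.+-monoˡ-≤ 0 (f≤g w v~w)

  ∑A-+ : ∀ f g v → ∑A (λ w → f w + g w) v ≡ ∑A f v + ∑A g v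
  ∑A-+ f g v = trans (∑-cong λ w → ℕ.*-distribˡ-+ (A v w) (f w) (g w)) (∑-+ (λ w → A v w * f w) (λ w → A v w * g w))

  ∑A-* : ∀ c f v → ∑A (λ w → c * f w) v ≡ c * ∑A f v
  ∑A-* c f v = trans (∑-cong λ w → swap (A v w) c (f w)) (∑-* c (λ w → A v w * f w))
    where
    swap : ∀ a c f → a * (c * f) ≡ c * (a * f)
    swap = solve-∀

  ∑A-δ : ∀ u (f : Fin n → ℕ) v → ∑A (λ w → δ u w * f w) v ≡ A v u * f u
  ∑A-δ u f v = trans (∑-cong λ w → swap (A v w) (δ u w) (f w)) (∑-δ* u (λ w → A v w * f w))
    where
    swap : ∀ a c f → a * (c * f) ≡ c * (a * f)
    swap = solve-∀

  ∑d≤ : ∀ v → ∑A d v ≤ 2 * k + 1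
  ∑d≤ v = ℕ.≤-pred (ℕ.≤-trans (∑degree≤ v) (ℕ.≤-reflexive (trans n≡ (ℕ.+-suc (2 * k) 1))))

  degree≤k : ∀ v → d v ≤ k
  degree≤k v = ℕ.≤-pred (ℕ.*-cancelˡ-< 2 (d v) (suc k) (begin-strict
    2 * d v      ≡⟨ trans (ℕ.*-comm 2 (d v)) (sym (∑A1 v 2)) ⟩
    ∑A (λ _ → 2) v ≤⟨ ∑A-mono v (λ w _ → 2≤degree w) ⟩
    ∑A d v       ≤⟨ ∑d≤ v ⟩
    2 * k + 1    <⟨ ℕ.n<1+n _ ⟩
    suc (2 * k + 1)  ≡⟨ regroup k ⟩
    2 * suc k    ∎))
    where
    open ℕ.≤-Reasoning
    regroup : ∀ k → suc (2 * k + 1) ≡ 2 * suc k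
    regroup = solve-∀

  -- The k neighbours of u have degrees at least two with sum at most 2k + 1, so their total excess
  -- over two is at most one.
  degree-neighbour≤3 : ∀ {u v} → d u ≡ k → Adj G u v → d v ≤ 3
  degree-neighbour≤3 {u} {v} du≡k u~v = ℕ.≤-trans (ℕ.m≤n+m∸n (d v) 2) (ℕ.+-monoʳ-≤ 2 (ℕ.+-cancelˡ-≤ (2 * k) (d v ∸ 2) 1 (begin
    2 * k + (d v ∸ 2)
      ≡⟨ cong₂ _+_ (trans (ℕ.*-comm 2 k) (trans (cong (_* 2) (sym du≡k)) (sym (∑A1 u 2)))) (sym (trans (∑A-δ v (λ w → d w ∸ 2) u) (trans (cong (_* (d v ∸ 2)) (a-adj G u~v)) (ℕ.*-identityˡ _)))) ⟩
    ∑A (λ _ → 2) u + ∑A (λ w → δ v w * (d w ∸ 2)) u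
      ≡⟨ sym (∑A-+ (λ _ → 2) (λ w → δ v w * (d w ∸ 2)) u) ⟩
    ∑A (λ w → 2 + δ v w * (d w ∸ 2)) u
      ≤⟨ ∑A-mono u (λ w _ → term w) ⟩
    ∑A d u
      ≤⟨ ∑d≤ u ⟩
    2 * k + 1 ∎)))
    where
    open ℕ.≤-Reasoning
    term : ∀ w → 2 + δ v w * (d w ∸ 2) ≤ d w
    term w = ℕ.≤-trans (ℕ.+-monoʳ-≤ 2 (ℕ.≤-trans (ℕ.*-monoˡ-≤ (d w ∸ 2) (bit≤1 ⌊ v Fin.≟ w ⌋)) (ℕ.≤-reflexive (ℕ.*-identityˡ _))))
      (ℕ.≤-reflexive (ℕ.m+[n∸m]≡n (2≤degree w)))

  1≤k : 1 ≤ k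
  1≤k = ℕ.≤-trans (s≤s z≤n) 22≤k

  6≤k*k*d : ∀ v → 6 ≤ k * k * d v
  6≤k*k*d v = ℕ.≤-trans (ℕ.m≤m+n 6 (22 * 22 * 2 ∸ 6)) (ℕ.*-mono-≤ (ℕ.*-mono-≤ 22≤k 22≤k) (2≤degree v))

  -- The vector is d - c/k² scaled by k², with c = 5. To leading order in k, a vertex of degree k -
  -- 1 with degree sum 2k + 1 asks for c ≥ 3, and a vertex of degree two with degree sum 2k - 2 for
  -- c ≤ 6.
  degreeCertificate : (∀ v → suc (d v) ≤ k) → Certificate G k
  degreeCertificate d<k = x , (λ v → ℕ.∸-monoˡ-≤ 5 (6≤k*k*d v)) , bound
    where
    x : Fin n → ℕ
    x v = k * k * d v ∸ 5
    x+5 : ∀ v → x v + 5 ≡ k * k * d v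
    x+5 v = ℕ.m∸n+n≡m (ℕ.≤-trans (ℕ.n≤1+n 5) (6≤k*k*d v))
    ∑x+5d : ∀ v → ∑A x v + d v * 5 ≡ k * k * ∑A d v
    ∑x+5d v = begin
      ∑A x v + d v * 5           ≡⟨ cong (∑A x v ℕ.+_) (sym (∑A1 v 5)) ⟩
      ∑A x v + ∑A (λ _ → 5) v    ≡⟨ sym (∑A-+ x (λ _ → 5) v) ⟩
      ∑A (λ w → x w + 5) v       ≡⟨ ∑-cong (λ w → cong (A v w *_) (x+5 w)) ⟩
      ∑A (λ w → k * k * d w) v   ≡⟨ ∑A-* (k * k) d v ⟩
      k * k * ∑A d v             ∎
      where open ≡-Reasoning
    ∑d+d≤ : ∀ v → ∑A d v + d v ≤ d v * k
    ∑d+d≤ v = begin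
      ∑A d v + d v               ≡⟨ cong (∑A d v ℕ.+_) (sym (trans (∑A1 v 1) (ℕ.*-identityʳ (d v)))) ⟩
      ∑A d v + ∑A (λ _ → 1) v    ≡⟨ sym (∑A-+ d (λ _ → 1) v) ⟩
      ∑A (λ w → d w + 1) v       ≤⟨ ∑A-mono v (λ w _ → ℕ.≤-trans (ℕ.≤-reflexive (ℕ.+-comm (d w) 1)) (d<k w)) ⟩
      ∑A (λ _ → k) v             ≡⟨ ∑A1 v k ⟩
      d v * k                    ∎
      where open ℕ.≤-Reasoning
    bound : ∀ v → k * (d v * x v + ∑A x v) ≤ (k * k + k + 3) * x v
    bound v = ℕ.+-cancelʳ-≤ (10 * (k * d v) + 5 * (k * k + k + 3)) _ _ (begin
      k * (d v * x v + ∑A x v) + (10 * (k * d v) + 5 * (k * k + k + 3))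
        ≡⟨ regroup₁ k (d v) (x v) (∑A x v) ⟩
      k * d v * (x v + 5) + k * (∑A x v + d v * 5) + 5 * (k * k + k + 3)
        ≡⟨ cong₂ (λ s t → k * d v * s + k * t + 5 * (k * k + k + 3)) (x+5 v) (∑x+5d v) ⟩
      k * d v * (k * k * d v) + k * (k * k * ∑A d v) + 5 * (k * k + k + 3)
        ≤⟨ DegreeBound.bound 22≤k (2≤degree v) (d<k v) (∑d≤ v) (∑d+d≤ v) ⟩
      (k * k + k + 3) * (k * k * d v) + 10 * (k * d v)
        ≡⟨ cong (λ s → (k * k + k + 3) * s + 10 * (k * d v)) (sym (x+5 v)) ⟩
      (k * k + k + 3) * (x v + 5) + 10 * (k * d v)
        ≡⟨ regroup₂ k (d v) (x v) ⟩
      (k * k + k + 3) * x v + (10 * (k * d v) + 5 * (k * k + k + 3)) ∎)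
      where
      open ℕ.≤-Reasoning
      regroup₁ : ∀ k d x s → k * (d * x + s) + (10 * (k * d) + 5 * (k * k + k + 3)) ≡
        k * d * (x + 5) + k * (s + d * 5) + 5 * (k * k + k + 3)
      regroup₁ = solve-∀
      regroup₂ : ∀ k d x → (k * k + k + 3) * (x + 5) + 10 * (k * d) ≡
        (k * k + k + 3) * x + (10 * (k * d) + 5 * (k * k + k + 3))
      regroup₂ = solve-∀

  -- Exactly one vertex of degree k

  module OneCentre (u : Fin n) (du≡k : d u ≡ k) (d<k : ∀ v → v ≢ u → suc (d v) ≤ k) where

    -- The far vertices, neither the centre nor adjacent to it. There are k + 1 of them, one less
    -- than the centre and its neighbours leave in a graph of order 2k + 3, and `h` below is the
    -- degree into this layer.
    p : Fin n → Bool
    p w = not ⌊ u Fin.≟ w ⌋ ∧ not (adj G u w)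

    partition : ∀ w → bit (p w) + δ u w + A u w ≡ 1
    partition w with u Fin.≟ w
    ... | yes refl rewrite irrefl G u = refl
    ... | no _ with adj G u w
    ...   | true  = refl
    ...   | false = refl

    ∑p : ∑ (bit ∘ p) ≡ k + 1
    ∑p = ℕ.+-cancelʳ-≡ (1 + k) (∑ (bit ∘ p)) (k + 1) (begin
      ∑ (bit ∘ p) + (1 + k)
        ≡⟨ cong₂ (λ s t → ∑ (bit ∘ p) + (s + t)) (sym (∑-δ u)) (trans (sym du≡k) (degree-∑ G u)) ⟩
      ∑ (bit ∘ p) + (∑ (δ u) + ∑ (A u))
        ≡⟨ sym (ℕ.+-assoc (∑ (bit ∘ p)) (∑ (δ u)) (∑ (A u))) ⟩
      ∑ (bit ∘ p) + ∑ (δ u) + ∑ (A u)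
        ≡⟨ sym (trans (∑-+ (λ w → bit (p w) + δ u w) (A u)) (cong (_+ ∑ (A u)) (∑-+ (bit ∘ p) (δ u)))) ⟩
      ∑ (λ w → bit (p w) + δ u w + A u w)
        ≡⟨ trans (∑-cong partition) (trans (∑-const n 1) (ℕ.*-identityʳ n)) ⟩
      n
        ≡⟨ trans n≡ (regroup k) ⟩
      k + 1 + (1 + k) ∎)
      where
      open ≡-Reasoning
      regroup : ∀ k → 2 * k + 2 ≡ k + 1 + (1 + k)
      regroup = solve-∀

    h : Fin n → ℕ
    h = relDegree p

    -- A neighbour of v is either far, or the centre, or a neighbour of the centre.
    degree-split : ∀ v → d v ≡ h v + A v u + codegree G v u
    degree-split v = begin
      d v
        ≡⟨ degree-∑ G v ⟩
      ∑ (A v)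
        ≡⟨ ∑-cong (λ w → trans (sym (ℕ.*-identityʳ (A v w))) (trans (cong (A v w *_) (sym (partition w))) (expand (A v w) (bit (p w)) (δ u w) (A u w)))) ⟩
      ∑ (λ w → A v w * bit (p w) + A v w * (δ u w * 1) + A v w * A u w)
        ≡⟨ trans (∑-+ (λ w → A v w * bit (p w) + A v w * (δ u w * 1)) (λ w → A v w * A u w)) (cong (_+ ∑ (λ w → A v w * A u w)) (∑-+ (λ w → A v w * bit (p w)) (λ w → A v w * (δ u w * 1)))) ⟩
      h v + ∑A (λ w → δ u w * 1) v + ∑ (λ w → A v w * A u w)
        ≡⟨ cong₂ (λ s t → h v + s + t) (trans (∑A-δ u (λ _ → 1) v) (ℕ.*-identityʳ (A v u))) (∑-cong λ w → cong (A v w *_) (a-sym G u w)) ⟩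
      h v + A v u + codegree G v u ∎
      where
      open ≡-Reasoning
      expand : ∀ a b c d → a * (b + c + d) ≡ a * b + a * (c * 1) + a * d
      expand = solve-∀

    degree-neighbour : ∀ {v} → Adj G u v → d v ≡ h v + 1
    degree-neighbour {v} u~v = trans (degree-split v)
      (trans (cong₂ (λ s t → h v + s + t) (a-adj G v~u) (codegree-adj v~u)) (ℕ.+-identityʳ (h v + 1)))
      where
      v~u : Adj G v u
      v~u = Adj-sym G u~v

    ph : Fin n → ℕ
    ph w = bit (p w) * h w

    ∑ph-inside : ∀ {w} → p w ≡ true → ∑A ph w ≤ k
    ∑ph-inside pw = ℕ.≤-pred (ℕ.≤-trans (∑relDegree-inside p pw) (ℕ.≤-reflexive (trans ∑p (ℕ.+-comm k 1))))

    p-neighbour : ∀ {v} → Adj G u v → p v ≡ false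
    p-neighbour {v} u~v with u Fin.≟ v
    ... | yes _ = refl
    ... | no _ rewrite u~v = refl

    ∑ph-outside : ∀ {v} → Adj G u v → ∑A ph v ≤ k + 1
    ∑ph-outside u~v = ℕ.≤-trans (∑relDegree-outside p (p-neighbour u~v)) (ℕ.≤-reflexive ∑p)

    -- Double counting gives ∑ h² ≤ k (k + 1), and 8 h ≤ h² + 16.
    8∑h≤ : 8 * ∑ ph ≤ (k + 1) * (k + 16)
    8∑h≤ = begin
      8 * ∑ ph
        ≡⟨ sym (∑-* 8 ph) ⟩
      ∑ (λ w → 8 * ph w)
        ≤⟨ ∑-mono (λ w → square (bit (p w)) (h w)) ⟩
      ∑ (λ w → ph w * h w + bit (p w) * 16)
        ≡⟨ trans (∑-+ (λ w → ph w * h w) (λ w → bit (p w) * 16)) (cong₂ _+_ ∑h² (trans (∑-*ʳ (bit ∘ p) 16) (cong (_* 16) ∑p))) ⟩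
      ∑ (λ j → bit (p j) * ∑A ph j) + (k + 1) * 16
        ≤⟨ ℕ.+-monoˡ-≤ ((k + 1) * 16) (∑-mono term) ⟩
      ∑ (λ j → bit (p j) * k) + (k + 1) * 16
        ≡⟨ cong (_+ (k + 1) * 16) (trans (∑-*ʳ (bit ∘ p) k) (cong (_* k) ∑p)) ⟩
      (k + 1) * k + (k + 1) * 16
        ≡⟨ sym (ℕ.*-distribˡ-+ (k + 1) k 16) ⟩
      (k + 1) * (k + 16) ∎
      where
      open ℕ.≤-Reasoning
      -- This is (h - 4)² ≥ 0, split by the sign of h - 4. The quadratic bound allows a mean of h up
      -- to √k, and the integer 4 stays close to that for the smallest k.
      square′ : ∀ h → 8 * h ≤ h * h + 16
      square′ h with ℕ.≤-total 4 h
      ... | inj₁ 4≤h with ℕ.m≤n⇒∃[o]m+o≡n 4≤h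
      ...   | t , refl = ℕ.≤-trans (ℕ.m≤m+n _ (t * t)) (ℕ.≤-reflexive (identity t))
        where
        identity : ∀ t → 8 * (4 + t) + t * t ≡ (4 + t) * (4 + t) + 16
        identity = solve-∀
      square′ h | inj₂ h≤4 with ℕ.m≤n⇒∃[o]m+o≡n h≤4
      ...   | t , h+t≡4 = subst (λ c → 2 * c * h ≤ h * h + c * c) h+t≡4
        (ℕ.≤-trans (ℕ.m≤m+n _ (t * t)) (ℕ.≤-reflexive (identity h t)))
        where
        identity : ∀ h t → 2 * (h + t) * h + t * t ≡ h * h + (h + t) * (h + t)
        identity = solve-∀
      square : ∀ b h → 8 * (b * h) ≤ b * h * h + b * 16
      square b h = begin
        8 * (b * h)          ≡⟨ regroup b h ⟩
        b * (8 * h)          ≤⟨ ℕ.*-monoʳ-≤ b (square′ h) ⟩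
        b * (h * h + 16)     ≡⟨ regroup′ b h ⟩
        b * h * h + b * 16   ∎
        where
        regroup : ∀ b h → 8 * (b * h) ≡ b * (8 * h)
        regroup = solve-∀
        regroup′ : ∀ b h → b * (h * h + 16) ≡ b * h * h + b * 16
        regroup′ = solve-∀
      ∑h² : ∑ (λ w → ph w * h w) ≡ ∑ (λ j → bit (p j) * ∑A ph j)
      ∑h² = begin-equality
        ∑ (λ w → ph w * h w)
          ≡⟨ ∑-cong (λ w → sym (∑-* (ph w) (λ j → A w j * bit (p j)))) ⟩
        ∑ (λ w → ∑ λ j → ph w * (A w j * bit (p j)))
          ≡⟨ ℕΣ.∑-comm (λ w j → ph w * (A w j * bit (p j))) ⟩
        ∑ (λ j → ∑ λ w → ph w * (A w j * bit (p j)))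
          ≡⟨ ∑-cong (λ j → trans (∑-cong λ w → trans (cong (λ t → ph w * (t * bit (p j))) (a-sym G w j)) (regroup (ph w) (A j w) (bit (p j)))) (∑-* (bit (p j)) (λ w → A j w * ph w))) ⟩
        ∑ (λ j → bit (p j) * ∑A ph j) ∎
        where
        regroup : ∀ x a b → x * (a * b) ≡ b * (a * x)
        regroup = solve-∀
      term : ∀ j → bit (p j) * ∑A ph j ≤ bit (p j) * k
      term j with p j in pj
      ... | false = z≤n
      ... | true  = ℕ.+-monoˡ-≤ 0 (∑ph-inside pj)

    Q : ℕ
    Q = scaleQ k

    g : Fin n → ℕ
    g w = bit (p w) * (9 * h w + 5)

    z : Fin n → ℕ
    z = ∑A g

    g-split : ∀ w → g w ≡ 9 * ph w + 5 * bit (p w)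
    g-split w = regroup (bit (p w)) (h w)
      where
      regroup : ∀ b h → b * (9 * h + 5) ≡ 9 * (b * h) + 5 * b
      regroup = solve-∀

    z-split : ∀ v → z v ≡ 9 * ∑A ph v + 5 * h v
    z-split v = begin
      ∑A g v                                        ≡⟨ ∑-cong (λ w → cong (A v w *_) (g-split w)) ⟩
      ∑A (λ w → 9 * ph w + 5 * bit (p w)) v         ≡⟨ ∑A-+ (λ w → 9 * ph w) (λ w → 5 * bit (p w)) v ⟩
      ∑A (λ w → 9 * ph w) v + ∑A (λ w → 5 * bit (p w)) v  ≡⟨ cong₂ _+_ (∑A-* 9 ph v) (∑A-* 5 (bit ∘ p) v) ⟩
      9 * ∑A ph v + 5 * h v                         ∎
      where open ≡-Reasoning

    -- The entry of a neighbour v of the centre solves (ℓ - 3) x v = x u + Q z v for ℓ = k + 1 +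
    -- 3/k, the exact equation at degree three when all other neighbours of v are far. For far
    -- entries α h + β and centre entry γ k², all times Q, the leading terms in k ask for γ ≤ β at h
    -- = 1, for β + γ ≤ α at h = k - 2, and for α/8 ≤ γ at the centre. The choice α = 9, β = 5, γ =
    -- 3 makes all three strict.
    x : Fin n → ℕ
    x w = if ⌊ u Fin.≟ w ⌋ then 3 * (k * k) * Q else
          if adj G u w then k * (3 * (k * k) + z w) else (9 * h w + 5) * Q

    x-centre : x u ≡ 3 * (k * k) * Q
    x-centre with u Fin.≟ u
    ... | yes _  = refl
    ... | no u≢u = contradiction refl u≢u

    x-neighbour : ∀ {v} → Adj G u v → x v ≡ k * (3 * (k * k) + z v)
    x-neighbour {v} u~v with u Fin.≟ v
    ... | yes u≡v = contradiction u≡v (Adj⇒≢ G u~v)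
    ... | no _ rewrite u~v = refl

    x-far : ∀ {w} → p w ≡ true → x w ≡ (9 * h w + 5) * Q
    x-far {w} pw with u Fin.≟ w | adj G u w
    x-far {w} () | yes _ | _
    x-far {w} () | no _ | true
    ... | no _ | false = refl

    data Position : Fin n → Set where
      isCentre    : Position u
      isNeighbour : ∀ {v} → Adj G u v → Position v
      isFar       : ∀ {w} → p w ≡ true → Position w

    position : ∀ v → Position v
    position v with u Fin.≟ v in eq₁ | adj G u v in eq₂
    ... | yes refl | _     = isCentre
    ... | no _     | true  = isNeighbour eq₂
    ... | no _     | false = isFar (trans (cong (λ b → not ⌊ b ⌋ ∧ not (adj G u v)) eq₁) (cong not eq₂))

    1≤Q : 1 ≤ Q
    1≤Q = ℕ.≤-trans (s≤s z≤n) (ℕ.m≤n+m 3 (k * (k ∸ 2)))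

    1≤x : ∀ v → 1 ≤ x v
    1≤x v with position v
    ... | isCentre = subst (1 ≤_) (sym x-centre) (ℕ.*-mono-≤ {1} {3 * (k * k)} {1} {Q} (ℕ.*-mono-≤ {1} {3} {1} {k * k} (s≤s z≤n) (ℕ.*-mono-≤ 1≤k 1≤k)) 1≤Q)
    ... | isNeighbour u~v = subst (1 ≤_) (sym (x-neighbour u~v)) (ℕ.*-mono-≤ {1} {k} {1} 1≤k
      (ℕ.≤-trans (ℕ.*-mono-≤ {1} {3} {1} {k * k} (s≤s z≤n) (ℕ.*-mono-≤ 1≤k 1≤k)) (ℕ.m≤m+n _ (z v))))
    ... | isFar pv = subst (1 ≤_) (sym (x-far pv)) (ℕ.*-mono-≤ {1} {9 * h v + 5} {1} {Q} (ℕ.≤-trans (s≤s z≤n) (ℕ.m≤n+m 5 (9 * h v))) 1≤Q)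

    -- A far vertex shares at most one neighbour with the centre, so each value of `g` is counted at
    -- most once; `8∑h≤` then bounds the total.
    ∑z≤ : 8 * ∑A z u ≤ 9 * ((k + 1) * (k + 16)) + 40 * (k + 1)
    ∑z≤ = begin
      8 * ∑A z u
        ≡⟨ cong (8 *_) (begin-equality
          ∑ (λ v → A u v * ∑ (λ w → A v w * g w))
            ≡⟨ ∑-cong (λ v → sym (∑-* (A u v) (λ w → A v w * g w))) ⟩
          ∑ (λ v → ∑ λ w → A u v * (A v w * g w))
            ≡⟨ ℕΣ.∑-comm (λ v w → A u v * (A v w * g w)) ⟩
          ∑ (λ w → ∑ λ v → A u v * (A v w * g w))
            ≡⟨ ∑-cong (λ w → trans (∑-cong λ v → sym (ℕ.*-assoc (A u v) (A v w) (g w))) (∑-*ʳ (λ v → A u v * A v w) (g w))) ⟩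
          ∑ (λ w → codegree G u w * g w) ∎) ⟩
      8 * ∑ (λ w → codegree G u w * g w)
        ≤⟨ ℕ.*-monoʳ-≤ 8 (∑-mono term) ⟩
      8 * ∑ g
        ≡⟨ cong (8 *_) (trans (∑-cong g-split) (trans (∑-+ (λ w → 9 * ph w) (λ w → 5 * bit (p w))) (cong₂ _+_ (∑-* 9 ph) (trans (∑-* 5 (bit ∘ p)) (cong (5 *_) ∑p))))) ⟩
      8 * (9 * ∑ ph + 5 * (k + 1))
        ≡⟨ regroup (∑ ph) k ⟩
      9 * (8 * ∑ ph) + 40 * (k + 1)
        ≤⟨ ℕ.+-monoˡ-≤ (40 * (k + 1)) (ℕ.*-monoʳ-≤ 9 8∑h≤) ⟩
      9 * ((k + 1) * (k + 16)) + 40 * (k + 1) ∎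
      where
      open ℕ.≤-Reasoning
      regroup : ∀ s k → 8 * (9 * s + 5 * (k + 1)) ≡ 9 * (8 * s) + 40 * (k + 1)
      regroup = solve-∀
      term : ∀ w → codegree G u w * g w ≤ g w
      term w with u Fin.≟ w
      ... | yes refl = ℕ.≤-reflexive (ℕ.*-zeroʳ (codegree G u u))
      ... | no u≢w = ℕ.≤-trans (ℕ.*-monoˡ-≤ (bit (not (adj G u w)) * (9 * h w + 5)) (codegree≤1 u≢w)) (ℕ.≤-reflexive (ℕ.*-identityˡ _))

    bound-centre : k * (d u * x u + ∑A x u) ≤ (k * k + k + 3) * x u
    bound-centre = ℕ.*-cancelˡ-≤ 8 (begin
      8 * (k * (d u * x u + ∑A x u))
        ≤⟨ ℕ.*-monoʳ-≤ 8 (ℕ.*-monoʳ-≤ k (ℕ.+-mono-≤ (ℕ.≤-reflexive (cong₂ _*_ du≡k x-centre))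
             (ℕ.≤-trans (∑A-mono u (λ w u~w → ℕ.≤-reflexive (x-neighbour u~w))) (ℕ.≤-reflexive (trans (∑A-* k (λ w → 3 * (k * k) + z w) u) (cong (k *_) (trans (∑A-+ (λ _ → 3 * (k * k)) z u) (cong (_+ ∑A z u) (trans (∑A1 u (3 * (k * k))) (cong (_* (3 * (k * k))) du≡k)))))))))) ⟩
      8 * (k * (k * (3 * (k * k) * Q) + k * (k * (3 * (k * k)) + ∑A z u)))
        ≡⟨ regroup k Q (∑A z u) ⟩
      8 * (k * k * (3 * (k * k) * Q)) + k * k * (24 * (k * k * k) + 8 * ∑A z u)
        ≤⟨ ℕ.+-monoʳ-≤ (8 * (k * k * (3 * (k * k) * Q))) (ℕ.*-monoʳ-≤ (k * k) (ℕ.+-monoʳ-≤ (24 * (k * k * k)) ∑z≤)) ⟩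
      8 * (k * k * (3 * (k * k) * Q)) + k * k * (24 * (k * k * k) + (9 * ((k + 1) * (k + 16)) + 40 * (k + 1)))
        ≡⟨ cong (λ t → 8 * (k * k * (3 * (k * k) * Q)) + k * k * t) (sym (ℕ.+-assoc (24 * (k * k * k)) (9 * ((k + 1) * (k + 16))) (40 * (k + 1)))) ⟩
      8 * (k * k * (3 * (k * k) * Q)) + k * k * (24 * (k * k * k) + 9 * ((k + 1) * (k + 16)) + 40 * (k + 1))
        ≤⟨ StarBound.centre 22≤k ⟩
      8 * ((k * k + k + 3) * (3 * (k * k) * Q))
        ≡⟨ cong (λ t → 8 * ((k * k + k + 3) * t)) (sym x-centre) ⟩
      8 * ((k * k + k + 3) * x u) ∎)
      where
      open ℕ.≤-Reasoning
      regroup : ∀ k q s → 8 * (k * (k * (3 * (k * k) * q) + k * (k * (3 * (k * k)) + s))) ≡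
        8 * (k * k * (3 * (k * k) * q)) + k * k * (24 * (k * k * k) + 8 * s)
      regroup = solve-∀

    -- The entry was chosen to give equality at degree three, through 3k + Q = k² + k + 3; a smaller
    -- degree only helps.
    bound-neighbour : ∀ {v} → Adj G u v → k * (d v * x v + ∑A x v) ≤ (k * k + k + 3) * x v
    bound-neighbour {v} u~v = begin
      k * (d v * x v + ∑A x v)
        ≤⟨ ℕ.*-monoʳ-≤ k (ℕ.+-mono-≤ (ℕ.*-monoˡ-≤ (x v) (degree-neighbour≤3 du≡k u~v)) (∑A-mono v term)) ⟩
      k * (3 * x v + ∑A (λ w → δ u w * (3 * (k * k) * Q) + Q * g w) v)
        ≡⟨ cong₂ (λ s t → k * (3 * s + t)) (x-neighbour u~v) (trans (∑A-+ (λ w → δ u w * (3 * (k * k) * Q)) (λ w → Q * g w) v) (cong₂ _+_ (trans (∑A-δ u (λ _ → 3 * (k * k) * Q) v) (trans (cong (_* (3 * (k * k) * Q)) (a-adj G (Adj-sym G u~v))) (ℕ.*-identityˡ _))) (∑A-* Q g v))) ⟩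
      k * (3 * (k * (3 * (k * k) + z v)) + (3 * (k * k) * Q + Q * z v))
        ≡⟨ regroup k Q (z v) ⟩
      (3 * k + Q) * (k * (3 * (k * k) + z v))
        ≡⟨ cong₂ _*_ (StarBound.scaleQ-identity 22≤k) (sym (x-neighbour u~v)) ⟩
      (k * k + k + 3) * x v ∎
      where
      open ℕ.≤-Reasoning
      regroup : ∀ k q z → k * (3 * (k * (3 * (k * k) + z)) + (3 * (k * k) * q + q * z)) ≡
        (3 * k + q) * (k * (3 * (k * k) + z))
      regroup = solve-∀
      term : ∀ w → Adj G v w → x w ≤ δ u w * (3 * (k * k) * Q) + Q * g w
      term w v~w with position w
      ... | isCentre = ℕ.≤-trans (ℕ.≤-reflexive (trans x-centre (trans (sym (ℕ.*-identityˡ _)) (cong (_* (3 * (k * k) * Q)) (sym (δ-refl u)))))) (ℕ.m≤m+n _ _)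
      ... | isNeighbour u~w = ⊥-elim (noTriangle u~v v~w (Adj-sym G u~w))
      ... | isFar pw = ℕ.≤-trans (ℕ.≤-reflexive (trans (x-far pw) (trans (ℕ.*-comm (9 * h w + 5) Q) (cong (Q *_) (trans (sym (ℕ.*-identityˡ _)) (cong (λ b → bit b * (9 * h w + 5)) (sym pw))))))) (ℕ.m≤n+m _ _)

    -- Upper bound for the entries of neighbours of the centre: the values `h` of the far neighbours
    -- sum to at most k + 1, and there are at most two such neighbours, whence 10 = 5 · 2.
    ξ : ℕ
    ξ = k * (3 * (k * k) + 9 * (k + 1) + 10)

    x-neighbour≤ : ∀ {v} → Adj G u v → x v ≤ ξ
    x-neighbour≤ {v} u~v = begin
      x v                                                ≡⟨ x-neighbour u~v ⟩
      k * (3 * (k * k) + z v)                            ≡⟨ cong (λ t → k * (3 * (k * k) + t)) (z-split v) ⟩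
      k * (3 * (k * k) + (9 * ∑A ph v + 5 * h v))        ≤⟨ ℕ.*-monoʳ-≤ k (ℕ.+-monoʳ-≤ (3 * (k * k)) (ℕ.+-mono-≤ (ℕ.*-monoʳ-≤ 9 (∑ph-outside u~v)) (ℕ.*-monoʳ-≤ 5 h≤2))) ⟩
      k * (3 * (k * k) + (9 * (k + 1) + 10))             ≡⟨ cong (k *_) (sym (ℕ.+-assoc (3 * (k * k)) (9 * (k + 1)) 10)) ⟩
      ξ                                                  ∎
      where
      open ℕ.≤-Reasoning
      h≤2 : h v ≤ 2
      h≤2 = ℕ.+-cancelʳ-≤ 1 (h v) 2 (ℕ.≤-trans (ℕ.≤-reflexive (sym (degree-neighbour u~v))) (degree-neighbour≤3 du≡k u~v))

    far≢u : ∀ {w} → p w ≡ true → w ≢ u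
    far≢u pu refl with u Fin.≟ u
    far≢u () refl | yes _
    ... | no u≢u = u≢u refl

    far≁u : ∀ {w} → p w ≡ true → A w u ≡ 0
    far≁u {w} pw with adj G w u in w~u
    ... | false = refl
    ... | true with trans (sym pw) (p-neighbour (Adj-sym G w~u))
    ...   | ()

    bound-far : ∀ {w} → p w ≡ true → k * (d w * x w + ∑A x w) ≤ (k * k + k + 3) * x w
    bound-far {w} pw = begin
      k * (d w * x w + ∑A x w)
        ≤⟨ ℕ.*-monoʳ-≤ k (ℕ.+-monoʳ-≤ (d w * x w) ∑≤) ⟩
      k * (d w * x w + (codegree G w u * ξ + Q * (9 * k + 5 * h w)))
        ≡⟨ cong₂ (λ s t → k * (s * t + (codegree G w u * ξ + Q * (9 * k + 5 * h w)))) d≡ (x-far pw) ⟩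
      k * ((h w + codegree G w u) * ((9 * h w + 5) * Q) + (codegree G w u * ξ + Q * (9 * k + 5 * h w)))
        ≤⟨ byCodegree (codegree G w u) (codegree≤1 (far≢u pw)) d≡ ⟩
      (k * k + k + 3) * ((9 * h w + 5) * Q)
        ≡⟨ cong ((k * k + k + 3) *_) (sym (x-far pw)) ⟩
      (k * k + k + 3) * x w ∎
      where
      open ℕ.≤-Reasoning
      d≡ : d w ≡ h w + codegree G w u
      d≡ = trans (degree-split w) (cong (_+ codegree G w u) (trans (cong (h w ℕ.+_) (far≁u pw)) (ℕ.+-identityʳ (h w))))
      term : ∀ j → Adj G w j → x j ≤ A j u * ξ + Q * g j
      term j w~j with position j
      ... | isCentre with trans (sym (far≁u pw)) (a-adj G w~j)
      ...   | ()
      term j w~j | isNeighbour u~j = ℕ.≤-trans (x-neighbour≤ u~j) (ℕ.≤-trans (ℕ.≤-reflexive (trans (sym (ℕ.*-identityˡ ξ)) (cong (_* ξ) (sym (a-adj G (Adj-sym G u~j)))))) (ℕ.m≤m+n _ _))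
      term j w~j | isFar pj = ℕ.≤-trans (ℕ.≤-reflexive (trans (x-far pj) (trans (ℕ.*-comm (9 * h j + 5) Q) (cong (Q *_) (trans (sym (ℕ.*-identityˡ _)) (cong (λ b → bit b * (9 * h j + 5)) (sym pj))))))) (ℕ.m≤n+m _ _)
      ∑≤ : ∑A x w ≤ codegree G w u * ξ + Q * (9 * k + 5 * h w)
      ∑≤ = begin
        ∑A x w
          ≤⟨ ∑A-mono w term ⟩
        ∑A (λ j → A j u * ξ + Q * g j) w
          ≡⟨ trans (∑A-+ (λ j → A j u * ξ) (λ j → Q * g j) w) (cong₂ _+_ (trans (∑-cong λ j → sym (ℕ.*-assoc (A w j) (A j u) ξ)) (∑-*ʳ (λ j → A w j * A j u) ξ)) (∑A-* Q g w)) ⟩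
        codegree G w u * ξ + Q * z w
          ≤⟨ ℕ.+-monoʳ-≤ (codegree G w u * ξ) (ℕ.*-monoʳ-≤ Q (ℕ.≤-trans (ℕ.≤-reflexive (z-split w)) (ℕ.+-monoˡ-≤ (5 * h w) (ℕ.*-monoʳ-≤ 9 (∑ph-inside pw))))) ⟩
        codegree G w u * ξ + Q * (9 * k + 5 * h w) ∎
      byCodegree : ∀ c → c ≤ 1 → d w ≡ h w + c →
        k * ((h w + c) * ((9 * h w + 5) * Q) + (c * ξ + Q * (9 * k + 5 * h w))) ≤ (k * k + k + 3) * ((9 * h w + 5) * Q)
      byCodegree zero _ d≡h = ℕ.≤-trans
        (ℕ.≤-reflexive (cong (λ s → k * (s * ((9 * h w + 5) * Q) + Q * (9 * k + 5 * h w))) (ℕ.+-identityʳ (h w))))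
        (StarBound.unlinked {k} {h w} (subst (2 ≤_) d≡h′ (2≤degree w)) (subst (λ t → t + 1 ≤ k) d≡h′ (ℕ.≤-trans (ℕ.≤-reflexive (ℕ.+-comm (d w) 1)) (d<k w (far≢u pw)))))
        where
        d≡h′ : d w ≡ h w
        d≡h′ = trans d≡h (ℕ.+-identityʳ (h w))
      byCodegree (suc zero) _ d≡h = ℕ.≤-trans
        (ℕ.≤-reflexive (cong (λ s → k * ((h w + 1) * ((9 * h w + 5) * Q) + (s + Q * (9 * k + 5 * h w)))) (ℕ.*-identityˡ ξ)))
        (StarBound.linked {k} {h w} 22≤k (ℕ.+-cancelʳ-≤ 1 1 (h w) (subst (2 ≤_) d≡h (2≤degree w)))
          (ℕ.≤-trans (ℕ.≤-reflexive (trans (ℕ.+-suc (h w) 1) (cong suc (sym d≡h)))) (d<k w (far≢u pw))))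
      byCodegree (suc (suc _)) (s≤s ()) _

    certificate : Certificate G k
    certificate = x , 1≤x , bound
      where
      bound : ∀ v → k * (d v * x v + ∑A x v) ≤ (k * k + k + 3) * x v
      bound v with position v
      ... | isCentre        = bound-centre
      ... | isNeighbour u~v = bound-neighbour u~v
      ... | isFar pv        = bound-far pv

  -- Two vertices of degree k

  centres-nonadjacent : ∀ {u y} → d u ≡ k → d y ≡ k → ¬ Adj G u y
  centres-nonadjacent du≡k dy≡k u~y = ℕ.<⇒≱ (ℕ.≤-trans (s≤s (s≤s (s≤s (s≤s z≤n)))) 22≤k)
    (subst (_≤ 3) dy≡k (degree-neighbour≤3 du≡k u~y))

  Adj? : ∀ u v → Dec (Adj G u v)
  Adj? u v = adj G u v Bool.≟ true

  ¬Adj⇒A≡0 : ∀ {u v} → ¬ Adj G u v → A u v ≡ 0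
  ¬Adj⇒A≡0 {u} {v} u≁v with adj G u v
  ... | false = refl
  ... | true  = contradiction refl u≁v

  Q F L : ℕ
  Q = scaleQ k
  F = PathBound.scaleF k
  L = k * k + k + 3

  L≡ : L ≡ 3 * k + Q
  L≡ = sym (StarBound.scaleQ-identity 22≤k)

  1≤Q : 1 ≤ Q
  1≤Q = ℕ.≤-trans (s≤s z≤n) (ℕ.m≤n+m 3 (k * (k ∸ 2)))

  1≤F : 1 ≤ F
  1≤F = ℕ.≤-trans (s≤s z≤n) (ℕ.m≤n+m 17 _)

  -- With the factor L rewritten as 3k + Q, the condition at a vertex with only two neighbours
  -- becomes a ring identity between the chosen entries.
  pairBound : ∀ {v p q} (x : Fin n → ℕ) {b s t} → p ≢ q → Adj G v p → Adj G v q →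
    (∀ w → Adj G v w → w ≢ p → w ≢ q → ⊥) → x v ≡ b → x p ≡ s → x q ≡ t →
    k * (2 * b + (s + t)) ≡ (3 * k + Q) * b → k * (d v * x v + ∑A x v) ≤ L * x v
  pairBound {v} {p} {q} x {b} {s} {t} p≢q v~p v~q only xv xp xq eq = begin
    k * (d v * x v + ∑A x v)     ≤⟨ ℕ.*-monoʳ-≤ k (ℕ.+-mono-≤ (ℕ.*-monoˡ-≤ (x v) (degree≤2 G p≢q v~p v~q only)) (∑-pair≤ G x p≢q v~p v~q only)) ⟩
    k * (2 * x v + (x p + x q))  ≡⟨ cong (k *_) (cong₂ _+_ (cong (2 *_) xv) (cong₂ _+_ xp xq)) ⟩
    k * (2 * b + (s + t))        ≡⟨ eq ⟩
    (3 * k + Q) * b              ≡⟨ cong₂ _*_ (sym L≡) (sym xv) ⟩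
    L * x v                      ∎
    where open ℕ.≤-Reasoning

  module TwoCentres {u y : Fin n} (u≢y : u ≢ y) (du≡k : d u ≡ k) (dy≡k : d y ≡ k) where

    u≁y : ¬ Adj G u y
    u≁y = centres-nonadjacent du≡k dy≡k

    y≁u : ¬ Adj G y u
    y≁u = u≁y ∘ Adj-sym G

    Outside : Fin n → Set
    Outside v = v ≢ u × v ≢ y × ¬ Adj G u v × ¬ Adj G y v

    Outside? : ∀ v → Dec (Outside v)
    Outside? v = ¬? (v Fin.≟ u) ×-dec ¬? (v Fin.≟ y) ×-dec ¬? (Adj? u v) ×-dec ¬? (Adj? y v)

    -- Counts how many of the sets {u}, {y}, N(u), N(y) contain v. Their sizes add up to exactly n,
    -- so vertices counted twice are balanced by vertices counted not at all.
    e : Fin n → ℕ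
    e v = A u v + A y v + (δ u v + δ y v)

    ∑e : ∑ e ≡ n
    ∑e = begin
      ∑ e                                    ≡⟨ trans (∑-+ (λ v → A u v + A y v) (λ v → δ u v + δ y v)) (cong₂ _+_ (∑-+ (A u) (A y)) (∑-+ (δ u) (δ y))) ⟩
      ∑ (A u) + ∑ (A y) + (∑ (δ u) + ∑ (δ y))  ≡⟨ cong₂ _+_ (cong₂ _+_ (trans (sym (degree-∑ G u)) du≡k) (trans (sym (degree-∑ G y)) dy≡k)) (cong₂ _+_ (∑-δ u) (∑-δ y)) ⟩
      k + k + 2                              ≡⟨ cong (_+ 2) (cong (k ℕ.+_) (sym (ℕ.+-identityʳ k))) ⟩
      2 * k + 2                              ≡⟨ sym n≡ ⟩
      n                                      ∎
      where open ≡-Reasoning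

    e-u : e u ≡ 1
    e-u rewrite irrefl G u | ¬Adj⇒A≡0 y≁u | δ-refl u | δ-≢ (u≢y ∘ sym) = refl

    e-y : e y ≡ 1
    e-y rewrite irrefl G y | ¬Adj⇒A≡0 u≁y | δ-refl y | δ-≢ u≢y = refl

    e-other : ∀ {v} → v ≢ u → v ≢ y → e v ≡ A u v + A y v
    e-other {v} v≢u v≢y rewrite δ-≢ (v≢u ∘ sym) | δ-≢ (v≢y ∘ sym) = ℕ.+-identityʳ (A u v + A y v)

    e-outside : ∀ {v} → Outside v → e v ≡ 0
    e-outside (v≢u , v≢y , u≁v , y≁v) = trans (e-other v≢u v≢y) (cong₂ _+_ (¬Adj⇒A≡0 u≁v) (¬Adj⇒A≡0 y≁v))

    e-common : ∀ {m} → Adj G u m → Adj G y m → e m ≡ 2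
    e-common u~m y~m = trans (e-other (Adj⇒≢ G u~m ∘ sym) (Adj⇒≢ G y~m ∘ sym)) (cong₂ _+_ (a-adj G u~m) (a-adj G y~m))

    e≤1 : ∀ v → ¬ (Adj G u v × Adj G y v) → e v ≤ 1
    e≤1 v ¬common = case (v Fin.≟ u) (v Fin.≟ y)
      where
      A+A≤1 : A u v + A y v ≤ 1
      A+A≤1 with adj G u v in u~v | adj G y v in y~v
      ... | true  | true  = contradiction (refl , refl) ¬common
      ... | true  | false = ℕ.≤-refl
      ... | false | b     = bit≤1 b
      case : Dec (v ≡ u) → Dec (v ≡ y) → e v ≤ 1
      case (yes refl) _          = ℕ.≤-reflexive e-u
      case (no _)     (yes refl) = ℕ.≤-reflexive e-y
      case (no v≢u)   (no v≢y)   = ℕ.≤-trans (ℕ.≤-reflexive (e-other v≢u v≢y)) A+A≤1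

    1≤e : ∀ v → ¬ Outside v → 1 ≤ e v
    1≤e v inside = case (v Fin.≟ u) (v Fin.≟ y)
      where
      1≤A+A : v ≢ u → v ≢ y → 1 ≤ A u v + A y v
      1≤A+A v≢u v≢y with Adj? u v | Adj? y v
      ... | yes u~v | _       = ℕ.≤-trans (ℕ.≤-reflexive (sym (a-adj G u~v))) (ℕ.m≤m+n (A u v) (A y v))
      ... | no _    | yes y~v = ℕ.≤-trans (ℕ.≤-reflexive (sym (a-adj G y~v))) (ℕ.m≤n+m (A y v) (A u v))
      ... | no u≁v  | no y≁v  = contradiction (v≢u , v≢y , u≁v , y≁v) inside
      case : Dec (v ≡ u) → Dec (v ≡ y) → 1 ≤ e v
      case (yes refl) _          = ℕ.≤-reflexive (sym e-u)
      case (no _)     (yes refl) = ℕ.≤-reflexive (sym e-y)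
      case (no v≢u)   (no v≢y)   = ℕ.≤-trans (1≤A+A v≢u v≢y) (ℕ.≤-reflexive (sym (e-other v≢u v≢y)))

    ∑1 : ∑ {n} (λ _ → 1) ≡ n
    ∑1 = trans (∑-const n 1) (ℕ.*-identityʳ n)

    -- Two centres without a common neighbour

    module Disjoint (disjoint : ∀ v → ¬ (Adj G u v × Adj G y v)) where

      noOutside : ∀ v → ¬ Outside v
      noOutside w out = ℕ.<⇒≱ (ℕ.n<1+n n) (begin
        suc n                    ≡⟨ cong₂ _+_ (sym (∑-δ w)) (sym ∑e) ⟩
        ∑ (δ w) + ∑ e            ≡⟨ sym (∑-+ (δ w) e) ⟩
        ∑ (λ v → δ w v + e v)    ≤⟨ ∑-mono term ⟩
        ∑ {n} (λ _ → 1)          ≡⟨ ∑1 ⟩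
        n                        ∎)
        where
        open ℕ.≤-Reasoning
        term : ∀ v → δ w v + e v ≤ 1
        term v with w Fin.≟ v
        ... | yes refl = ℕ.≤-reflexive (cong suc (e-outside out))
        ... | no _     = e≤1 v (disjoint v)

      -- Proportional to ℓ - 3 at the centres and to 1 elsewhere, for ℓ = k + 1 + 3/k: the exact
      -- solution on the inner vertices of a path of length three.
      x : Fin n → ℕ
      x v = if ⌊ v Fin.≟ u ⌋ then Q else if ⌊ v Fin.≟ y ⌋ then Q else k

      x-u : x u ≡ Q
      x-u with u Fin.≟ u
      ... | yes _  = refl
      ... | no u≢u = contradiction refl u≢u

      x-y : x y ≡ Q
      x-y with y Fin.≟ u | y Fin.≟ y
      ... | yes _ | _      = refl
      ... | no _  | yes _  = refl
      ... | no _  | no y≢y = contradiction refl y≢y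

      x-other : ∀ {v} → v ≢ u → v ≢ y → x v ≡ k
      x-other {v} v≢u v≢y with v Fin.≟ u | v Fin.≟ y
      ... | yes v≡u | _       = contradiction v≡u v≢u
      ... | no _    | yes v≡y = contradiction v≡y v≢y
      ... | no _    | no _    = refl

      bound-centre : ∀ {c} → d c ≡ k → x c ≡ Q → (∀ w → Adj G c w → w ≢ u × w ≢ y) →
        k * (d c * x c + ∑A x c) ≤ L * x c
      bound-centre {c} dc≡k xc≡Q off = begin
        k * (d c * x c + ∑A x c)
          ≤⟨ ℕ.*-monoʳ-≤ k (ℕ.+-monoʳ-≤ (d c * x c) (∑A-mono c (λ w c~w → let w≢u , w≢y = off w c~w in ℕ.≤-reflexive (x-other w≢u w≢y)))) ⟩
        k * (d c * x c + ∑A (λ _ → k) c)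
          ≡⟨ cong (k *_) (cong₂ _+_ (cong₂ _*_ dc≡k xc≡Q) (trans (∑A1 c k) (cong (_* k) dc≡k))) ⟩
        k * (k * Q + k * k)
          ≤⟨ PathBound.threePaths 22≤k ⟩
        L * Q
          ≡⟨ cong (L *_) (sym xc≡Q) ⟩
        L * x c ∎
        where open ℕ.≤-Reasoning

      -- Apart from c, all neighbours of v are adjacent to the other centre c′. Two of them would
      -- close a 4-cycle through v and c′, so v has degree two.
      bound-neighbour : ∀ {c c′ v} → x c ≡ Q → Adj G c v →
        (∀ w → Adj G v w → w ≢ c → Adj G c′ w) → (∀ w → Adj G v w → w ≢ c → x w ≡ k) →
        v ≢ c′ → x v ≡ k → k * (d v * x v + ∑A x v) ≤ L * x v
      bound-neighbour {c} {c′} {v} xc≡Q c~v across x≡k v≢c′ xv≡k =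
        let w , v~w , w≢c = otherNeighbour G c (2≤degree v)
        in pairBound x (w≢c ∘ sym) (Adj-sym G c~v) v~w
             (λ w′ v~w′ w′≢c w′≢w → w′≢w (commonNeighbour-unique v≢c′ v~w′ (across w′ v~w′ w′≢c) v~w (across w v~w w≢c)))
             xv≡k xc≡Q (x≡k w v~w w≢c) (regroup k Q)
        where
        regroup : ∀ k q → k * (2 * k + (q + k)) ≡ (3 * k + q) * k
        regroup = solve-∀

      across-u : ∀ {v} → Adj G u v → ∀ w → Adj G v w → w ≢ u → Adj G y w × w ≢ y
      across-u {v} u~v w v~w w≢u with w Fin.≟ y | Adj? y w | Adj? u w
      ... | yes refl | _       | _       = contradiction (u~v , Adj-sym G v~w) (disjoint v)
      ... | no w≢y   | yes y~w | _       = y~w , w≢y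
      ... | no _     | no _    | yes u~w = ⊥-elim (noTriangle u~v v~w (Adj-sym G u~w))
      ... | no w≢y   | no y≁w  | no u≁w  = contradiction (w≢u , w≢y , u≁w , y≁w) (noOutside w)

      across-y : ∀ {v} → Adj G y v → ∀ w → Adj G v w → w ≢ y → Adj G u w × w ≢ u
      across-y {v} y~v w v~w w≢y with w Fin.≟ u | Adj? u w | Adj? y w
      ... | yes refl | _       | _       = contradiction (Adj-sym G v~w , y~v) (disjoint v)
      ... | no w≢u   | yes u~w | _       = u~w , w≢u
      ... | no _     | no _    | yes y~w = ⊥-elim (noTriangle y~v v~w (Adj-sym G y~w))
      ... | no w≢u   | no u≁w  | no y≁w  = contradiction (w≢u , w≢y , u≁w , y≁w) (noOutside w)

      Adj-u⇒≢ : ∀ {v} → Adj G u v → v ≢ u × v ≢ y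
      Adj-u⇒≢ u~v = Adj⇒≢ G u~v ∘ sym , λ { refl → u≁y u~v }

      Adj-y⇒≢ : ∀ {v} → Adj G y v → v ≢ u × v ≢ y
      Adj-y⇒≢ y~v = (λ { refl → y≁u y~v }) , Adj⇒≢ G y~v ∘ sym

      certificate : Certificate G k
      certificate = x , 1≤x , λ v → bound v (v Fin.≟ u) (v Fin.≟ y) (Adj? u v) (Adj? y v)
        where
        1≤x : ∀ v → 1 ≤ x v
        1≤x v with v Fin.≟ u | v Fin.≟ y
        ... | yes _ | _     = 1≤Q
        ... | no _  | yes _ = 1≤Q
        ... | no _  | no _  = 1≤k
        bound : ∀ v → Dec (v ≡ u) → Dec (v ≡ y) → Dec (Adj G u v) → Dec (Adj G y v) →
          k * (d v * x v + ∑A x v) ≤ L * x v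
        bound v (yes refl) _ _ _ = bound-centre du≡k x-u (λ w → Adj-u⇒≢)
        bound v (no _) (yes refl) _ _ = bound-centre dy≡k x-y (λ w → Adj-y⇒≢)
        bound v (no v≢u) (no v≢y) (yes u~v) _ = bound-neighbour x-u u~v
          (λ w v~w w≢u → proj₁ (across-u u~v w v~w w≢u))
          (λ w v~w w≢u → x-other w≢u (proj₂ (across-u u~v w v~w w≢u))) v≢y (x-other v≢u v≢y)
        bound v (no v≢u) (no v≢y) (no _) (yes y~v) = bound-neighbour x-y y~v
          (λ w v~w w≢y → proj₁ (across-y y~v w v~w w≢y))
          (λ w v~w w≢y → x-other (proj₂ (across-y y~v w v~w w≢y)) w≢y) v≢u (x-other v≢u v≢y)
        bound v (no v≢u) (no v≢y) (no u≁v) (no y≁v) = contradiction (v≢u , v≢y , u≁v , y≁v) (noOutside v)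

    -- Two centres with a common neighbour

    module Meeting {m : Fin n} (u~m : Adj G u m) (y~m : Adj G y m) where

      common≡m : ∀ {v} → Adj G u v → Adj G y v → v ≡ m
      common≡m u~v y~v = commonNeighbour-unique u≢y u~v y~v u~m y~m

      ∑1+δ : ∑ (λ v → 1 + δ m v) ≡ suc n
      ∑1+δ = trans (∑-+ (λ _ → 1) (δ m)) (trans (cong₂ _+_ ∑1 (∑-δ m)) (ℕ.+-comm n 1))

      someOutside : ∃[ w ] Outside w
      someOutside with Fin.any? Outside?
      ... | yes out = out
      ... | no none = contradiction (begin
        suc n                  ≡⟨ sym ∑1+δ ⟩
        ∑ (λ v → 1 + δ m v)    ≤⟨ ∑-mono term ⟩
        ∑ e                    ≡⟨ ∑e ⟩
        n                      ∎) (ℕ.<⇒≱ (ℕ.n<1+n n))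
        where
        open ℕ.≤-Reasoning
        term : ∀ v → 1 + δ m v ≤ e v
        term v with m Fin.≟ v
        ... | yes refl = ℕ.≤-reflexive (sym (e-common u~m y~m))
        ... | no _     = 1≤e v (λ out → none (v , out))

      outside-unique : ∀ {w w′} → Outside w → Outside w′ → w ≡ w′
      outside-unique {w} {w′} out out′ with w Fin.≟ w′
      ... | yes w≡w′ = w≡w′
      ... | no w≢w′ = contradiction (begin
        2 + n                              ≡⟨ cong₂ _+_ (cong₂ _+_ (sym (∑-δ w)) (sym (∑-δ w′))) (sym ∑e) ⟩
        ∑ (δ w) + ∑ (δ w′) + ∑ e           ≡⟨ sym (trans (∑-+ (λ v → δ w v + δ w′ v) e) (cong (_+ ∑ e) (∑-+ (δ w) (δ w′)))) ⟩
        ∑ (λ v → δ w v + δ w′ v + e v)     ≤⟨ ∑-mono term ⟩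
        ∑ (λ v → 1 + δ m v)                ≡⟨ ∑1+δ ⟩
        suc n                              ∎) (ℕ.<⇒≱ (ℕ.n<1+n (suc n)))
        where
        open ℕ.≤-Reasoning
        term : ∀ v → δ w v + δ w′ v + e v ≤ 1 + δ m v
        term v with w Fin.≟ v | w′ Fin.≟ v
        ... | yes refl | yes refl = contradiction refl w≢w′
        ... | yes refl | no _     = ℕ.≤-trans (ℕ.≤-reflexive (cong suc (e-outside out))) (ℕ.m≤m+n 1 (δ m v))
        ... | no _     | yes refl = ℕ.≤-trans (ℕ.≤-reflexive (cong suc (e-outside out′))) (ℕ.m≤m+n 1 (δ m v))
        ... | no _     | no _ with m Fin.≟ v
        ...   | yes refl = ℕ.≤-reflexive (e-common u~m y~m)
        ...   | no m≢v   = e≤1 v λ (u~v , y~v) → m≢v (sym (common≡m u~v y~v))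

  data Place (u y w : Fin n) : Fin n → Set where
    at-u   : Place u y w u
    at-y   : Place u y w y
    at-w   : Place u y w w
    near-u : ∀ {v} → Adj G u v → Place u y w v
    near-y : ∀ {v} → Adj G y v → Place u y w v

  -- The vertices u and y of degree k have the common neighbour m; w is the only
  -- vertex that is neither a centre nor adjacent to one, and it has exactly one
  -- neighbour on either side.
  record Skeleton (u y m w p r : Fin n) : Set where
    field
      u≢y   : u ≢ y
      du≡k  : d u ≡ k
      dy≡k  : d y ≡ k
      u~m   : Adj G u m
      y~m   : Adj G y m
      w≢u   : w ≢ u
      w≢y   : w ≢ y
      u≁w   : ¬ Adj G u w
      y≁w   : ¬ Adj G y w
      u~p   : Adj G u p
      y~r   : Adj G y r
      w~p   : Adj G w p
      w~r   : Adj G w r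
      m≁w   : ¬ Adj G m w
      place : ∀ v → Place u y w v

  mirror : ∀ {u y m w p r} → Skeleton u y m w p r → Skeleton y u m w r p
  mirror {u} {y} {w = w} S = record
    { u≢y = u≢y ∘ sym ; du≡k = dy≡k ; dy≡k = du≡k ; u~m = y~m ; y~m = u~m
    ; w≢u = w≢y ; w≢y = w≢u ; u≁w = y≁w ; y≁w = u≁w ; u~p = y~r ; y~r = u~p
    ; w~p = w~r ; w~r = w~p ; m≁w = m≁w ; place = λ v → flip (place v) }
    where
    open Skeleton S
    flip : ∀ {v} → Place u y w v → Place y u w v
    flip at-u         = at-y
    flip at-y         = at-u
    flip at-w         = at-w
    flip (near-u u~v) = near-y u~v
    flip (near-y y~v) = near-u y~v

  skeleton : ∀ {u y m} → u ≢ y → d u ≡ k → d y ≡ k → Adj G u m → Adj G y m →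
    ∃[ w ] ∃[ p ] ∃[ r ] Skeleton u y m w p r
  skeleton {u} {y} {m} u≢y du≡k dy≡k u~m y~m =
    w , p , r , record
      { u≢y = u≢y ; du≡k = du≡k ; dy≡k = dy≡k ; u~m = u~m ; y~m = y~m
      ; w≢u = w≢u ; w≢y = w≢y ; u≁w = u≁w ; y≁w = y≁w
      ; u~p = u~p ; y~r = y~r ; w~p = w~p ; w~r = w~r ; m≁w = m≁w ; place = place }
    where
    open TwoCentres u≢y du≡k dy≡k
    open Meeting u~m y~m
    w = proj₁ someOutside
    w-outside = proj₂ someOutside
    w≢u = proj₁ w-outside
    w≢y = proj₁ (proj₂ w-outside)
    u≁w = proj₁ (proj₂ (proj₂ w-outside))
    y≁w = proj₂ (proj₂ (proj₂ w-outside))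

    place : ∀ v → Place u y w v
    place v with v Fin.≟ u | v Fin.≟ y | Adj? u v | Adj? y v
    ... | yes refl | _        | _       | _       = at-u
    ... | no _     | yes refl | _       | _       = at-y
    ... | no _     | no _     | yes u~v | _       = near-u u~v
    ... | no _     | no _     | no _    | yes y~v = near-y y~v
    ... | no v≢u   | no v≢y   | no u≁v  | no y≁v  =
      subst (Place u y w) (outside-unique w-outside (v≢u , v≢y , u≁v , y≁v)) at-w

    -- Every neighbour of w is adjacent to u or to y, and each codegree is at most one. As w has
    -- degree at least two, there is one neighbour on each side, `p` and `r`.
    d≤ : d w ≤ codegree G w u + codegree G w y
    d≤ = begin
      d w                                     ≡⟨ trans (sym (ℕ.*-identityʳ (d w))) (sym (∑A1 w 1)) ⟩
      ∑A (λ _ → 1) w                          ≤⟨ ∑A-mono w term ⟩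
      ∑A (λ v → A v u + A v y) w              ≡⟨ ∑A-+ (λ v → A v u) (λ v → A v y) w ⟩
      codegree G w u + codegree G w y         ∎
      where
      open ℕ.≤-Reasoning
      term : ∀ v → Adj G w v → 1 ≤ A v u + A v y
      term v w~v with place v
      ... | at-u = contradiction (Adj-sym G w~v) u≁w
      ... | at-y = contradiction (Adj-sym G w~v) y≁w
      ... | at-w = contradiction refl (Adj⇒≢ G w~v)
      ... | near-u u~v = ℕ.≤-trans (ℕ.≤-reflexive (sym (a-adj G (Adj-sym G u~v)))) (ℕ.m≤m+n (A v u) (A v y))
      ... | near-y y~v = ℕ.≤-trans (ℕ.≤-reflexive (sym (a-adj G (Adj-sym G y~v)))) (ℕ.m≤n+m (A v y) (A v u))

    meet : ∀ {c} → 1 ≤ codegree G w c → ∃[ v ] (Adj G c v × Adj G w v)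
    meet {c} 1≤ = let v , 1≤v = ∑-witness (λ v → A w v * A v c) 1≤ in v , extract v 1≤v
      where
      extract : ∀ v → 1 ≤ A w v * A v c → Adj G c v × Adj G w v
      extract v h with adj G w v | adj G v c in v~c
      ... | true | true = trans (symm G c v) v~c , refl

    P : ∃[ v ] (Adj G u v × Adj G w v)
    P = meet (ℕ.+-cancelʳ-≤ 1 1 _ (ℕ.≤-trans (2≤degree w) (ℕ.≤-trans d≤ (ℕ.+-monoʳ-≤ _ (codegree≤1 w≢y)))))

    R : ∃[ v ] (Adj G y v × Adj G w v)
    R = meet (ℕ.+-cancelˡ-≤ 1 1 _ (ℕ.≤-trans (2≤degree w) (ℕ.≤-trans d≤ (ℕ.+-monoˡ-≤ _ (codegree≤1 w≢u)))))

    p = proj₁ P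
    r = proj₁ R
    u~p = proj₁ (proj₂ P)
    w~p = proj₂ (proj₂ P)
    y~r = proj₁ (proj₂ R)
    w~r = proj₂ (proj₂ R)

    -- If m were adjacent to w, it would be the only neighbour of w on both sides, and w would have
    -- degree one.
    m≁w : ¬ Adj G m w
    m≁w m~w = let v , w~v , v≢m = otherNeighbour G m (2≤degree w) in v≢m (only v w~v)
      where
      only : ∀ v → Adj G w v → v ≡ m
      only v w~v with place v
      ... | at-u = contradiction (Adj-sym G w~v) u≁w
      ... | at-y = contradiction (Adj-sym G w~v) y≁w
      ... | at-w = contradiction refl (Adj⇒≢ G w~v)
      ... | near-u u~v = commonNeighbour-unique w≢u w~v u~v (Adj-sym G m~w) u~m
      ... | near-y y~v = commonNeighbour-unique w≢y w~v y~v (Adj-sym G m~w) y~m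

  -- The neighbourhood of one centre

  module Half {u y m w p r} (S : Skeleton u y m w p r) where
    open Skeleton S

    u≁y : ¬ Adj G u y
    u≁y = centres-nonadjacent du≡k dy≡k

    y≁u : ¬ Adj G y u
    y≁u = u≁y ∘ Adj-sym G

    common≡m : ∀ {v} → Adj G u v → Adj G y v → v ≡ m
    common≡m u~v y~v = commonNeighbour-unique u≢y u~v y~v u~m y~m

    m≢p : m ≢ p
    m≢p refl = m≁w (Adj-sym G w~p)

    exits : ∀ {v v′} → Adj G u v → v ≢ m → Adj G v v′ → v′ ≢ u → Adj G y v′ ⊎ (v ≡ p × v′ ≡ w)
    exits {v} {v′} u~v v≢m v~v′ v′≢u with place v′
    ... | at-u         = contradiction refl v′≢u
    ... | at-y         = contradiction (common≡m u~v (Adj-sym G v~v′)) v≢m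
    ... | at-w         = inj₂ (commonNeighbour-unique w≢u (Adj-sym G v~v′) u~v w~p u~p , refl)
    ... | near-u u~v′  = ⊥-elim (noTriangle u~v v~v′ (Adj-sym G u~v′))
    ... | near-y y~v′  = inj₁ y~v′

    HasPartner : Fin n → Set
    HasPartner v = ∃[ v′ ] (Adj G v v′ × Adj G y v′)

    hasPartner? : ∀ v → Dec (HasPartner v)
    hasPartner? v = Fin.any? λ v′ → Adj? v v′ ×-dec Adj? y v′

    partner : ∀ {v} → Adj G u v → v ≢ m → v ≢ p → HasPartner v
    partner {v} u~v v≢m v≢p with otherNeighbour G u (2≤degree v)
    ... | v′ , v~v′ , v′≢u with exits u~v v≢m v~v′ v′≢u
    ...   | inj₁ y~v′      = v′ , v~v′ , y~v′
    ...   | inj₂ (v≡p , _) = contradiction v≡p v≢p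

    partner-unique : ∀ {v s t} → Adj G u v → Adj G v s → Adj G y s → Adj G v t → Adj G y t → s ≡ t
    partner-unique u~v v~s y~s v~t y~t = commonNeighbour-unique (λ { refl → u≁y u~v }) v~s y~s v~t y~t

    partner≢m : ∀ {v v′} → Adj G u v → Adj G v v′ → v′ ≢ m
    partner≢m u~v v~v′ refl = noTriangle u~v v~v′ (Adj-sym G u~m)

    -- The number of edges between the neighbourhoods of u and y.
    crossing : ℕ
    crossing = ∑A (λ v → codegree G v y) u

    1≤codegree : ∀ {v} → HasPartner v → 1 ≤ codegree G v y
    1≤codegree {v} (v′ , v~v′ , y~v′) = ℕ.≤-trans
      (ℕ.≤-reflexive (sym (cong₂ _*_ (a-adj G v~v′) (a-adj G (Adj-sym G y~v′)))))
      (term≤∑ (λ w → A v w * A w y) v′)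

    -- Every neighbour of u other than m then contributes an edge towards the neighbourhood of y.
    crossing≥ : HasPartner p → k ≤ crossing + 1
    crossing≥ p-partner = begin
      k                                        ≡⟨ trans (sym du≡k) (trans (sym (ℕ.*-identityʳ (d u))) (sym (∑A1 u 1))) ⟩
      ∑A (λ _ → 1) u                           ≤⟨ ∑A-mono u term ⟩
      ∑A (λ v → codegree G v y + δ m v * 1) u  ≡⟨ trans (∑A-+ (λ v → codegree G v y) (λ v → δ m v * 1) u) (cong (crossing ℕ.+_) (trans (∑A-δ m (λ _ → 1) u) (trans (ℕ.*-identityʳ (A u m)) (a-adj G u~m)))) ⟩
      crossing + 1                             ∎
      where
      open ℕ.≤-Reasoning
      partner′ : ∀ {v} → Adj G u v → v ≢ m → HasPartner v
      partner′ {v} u~v v≢m with v Fin.≟ p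
      ... | yes refl = p-partner
      ... | no v≢p   = partner u~v v≢m v≢p
      term : ∀ v → Adj G u v → 1 ≤ codegree G v y + δ m v * 1
      term v u~v with m Fin.≟ v
      ... | yes refl = ℕ.m≤n+m 1 (codegree G m y)
      ... | no m≢v   = ℕ.≤-trans (1≤codegree (partner′ u~v (m≢v ∘ sym))) (ℕ.m≤m+n _ 0)

    -- Two neighbours of u contribute nothing: m because of triangles, and p by assumption. Each of
    -- the others contributes at most one edge.
    crossing≤ : ¬ HasPartner p → crossing + 2 ≤ k
    crossing≤ p-alone = begin
      crossing + 2
        ≡⟨ cong (crossing ℕ.+_) (sym (cong₂ (λ s t → s * 1 + t * 1) (a-adj G u~m) (a-adj G u~p))) ⟩
      crossing + (A u m * 1 + A u p * 1)
        ≡⟨ sym (trans (∑A-+ (λ v → codegree G v y) (λ v → δ m v * 1 + δ p v * 1) u) (cong (crossing ℕ.+_) (trans (∑A-+ (λ v → δ m v * 1) (λ v → δ p v * 1) u) (cong₂ _+_ (∑A-δ m (λ _ → 1) u) (∑A-δ p (λ _ → 1) u))))) ⟩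
      ∑A (λ v → codegree G v y + (δ m v * 1 + δ p v * 1)) u
        ≤⟨ ∑A-mono u term ⟩
      ∑A (λ _ → 1) u
        ≡⟨ trans (∑A1 u 1) (trans (ℕ.*-identityʳ (d u)) du≡k) ⟩
      k ∎
      where
      open ℕ.≤-Reasoning
      alone : codegree G p y ≡ 0
      alone = trans (∑-cong λ v → term v (Adj? p v) (Adj? v y)) (∑-zero n)
        where
        term : ∀ v → Dec (Adj G p v) → Dec (Adj G v y) → A p v * A v y ≡ 0
        term v (no p≁v)  _         = cong (_* A v y) (¬Adj⇒A≡0 p≁v)
        term v (yes _)   (no v≁y)  = trans (cong (A p v *_) (¬Adj⇒A≡0 v≁y)) (ℕ.*-zeroʳ (A p v))
        term v (yes p~v) (yes v~y) = contradiction (v , p~v , Adj-sym G v~y) p-alone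
      term : ∀ v → Adj G u v → codegree G v y + (δ m v * 1 + δ p v * 1) ≤ 1
      term v u~v with m Fin.≟ v | p Fin.≟ v
      ... | yes refl | yes refl = contradiction refl m≢p
      ... | yes refl | no _     = ℕ.≤-reflexive (cong (_+ 1) (codegree-adj (Adj-sym G y~m)))
      ... | no _     | yes refl = ℕ.≤-reflexive (cong (_+ 1) alone)
      ... | no _     | no _     = ℕ.≤-trans (ℕ.≤-reflexive (ℕ.+-identityʳ _)) (codegree≤1 (λ { refl → u≁y u~v }))

  module Completion {u y m w p r} (S : Skeleton u y m w p r) where
    open Skeleton S
    module U = Half S
    module Y = Half (mirror S)

    -- The same edges are counted from either side. Since `crossing≥` and `crossing≤` give
    -- incompatible values, p and r either both have partners or both have none.
    crossing-sym : U.crossing ≡ Y.crossing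
    crossing-sym = begin
      ∑ (λ v → A u v * ∑ (λ x → A v x * A x y))      ≡⟨ ∑-cong (λ v → sym (∑-* (A u v) (λ x → A v x * A x y))) ⟩
      ∑ (λ v → ∑ λ x → A u v * (A v x * A x y))      ≡⟨ ℕΣ.∑-comm (λ v x → A u v * (A v x * A x y)) ⟩
      ∑ (λ x → ∑ λ v → A u v * (A v x * A x y))      ≡⟨ ∑-cong (λ x → trans (∑-cong (λ v → term x v)) (∑-* (A y x) (λ v → A x v * A v u))) ⟩
      ∑ (λ x → A y x * ∑ (λ v → A x v * A v u))      ∎
      where
      open ≡-Reasoning
      term : ∀ x v → A u v * (A v x * A x y) ≡ A y x * (A x v * A v u)
      term x v rewrite a-sym G u v | a-sym G v x | a-sym G x y = regroup (A v u) (A x v) (A y x)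
        where
        regroup : ∀ a b c → a * (b * c) ≡ c * (b * a)
        regroup = solve-∀

    unmatched : ∀ {s t} → k ≤ s + 1 → t + 2 ≤ k → s ≢ t
    unmatched {s} k≤ ≤k refl = ℕ.<⇒≱ (ℕ.n<1+n (s + 1)) (ℕ.≤-trans (ℕ.≤-reflexive (sym (ℕ.+-suc s 1))) (ℕ.≤-trans ≤k k≤))

    m≢u : m ≢ u
    m≢u = Adj⇒≢ G u~m ∘ sym
    m≢y : m ≢ y
    m≢y = Adj⇒≢ G y~m ∘ sym
    m≢w : m ≢ w
    m≢w refl = u≁w u~m
    p≢u : p ≢ u
    p≢u = Adj⇒≢ G u~p ∘ sym
    p≢y : p ≢ y
    p≢y refl = U.u≁y u~p
    p≢w : p ≢ w
    p≢w = Adj⇒≢ G w~p ∘ sym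
    r≢u : r ≢ u
    r≢u refl = Y.u≁y y~r
    r≢y : r ≢ y
    r≢y = Adj⇒≢ G y~r ∘ sym
    r≢w : r ≢ w
    r≢w = Adj⇒≢ G w~r ∘ sym
    r≢p : r ≢ p
    r≢p refl = U.m≢p (sym (U.common≡m u~p y~r))

  -- The centres joined by a path of length four

  module FourPath where

    -- Entries solving the eigenvalue equation for ℓ = k + 1 + 3/k off the centres, where e/k = ℓ -
    -- 2, Q/k = ℓ - 3 and F/k² = (ℓ - 2)² - 2. Relative to the centre entry X, these are 2/(ℓ - 2)
    -- at m, 1/(ℓ - 3) on paths of length three, and (ℓ - 2)/((ℓ - 2)² - 2) at p and r, while W is
    -- 2P/(ℓ - 2). X is the product of the three denominators.
    e X M O P W : ℕ
    e = Q + k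
    X = e * F * Q
    M = 2 * k * F * Q
    O = k * e * F
    P = k * e * e * Q
    W = 2 * k * k * e * Q

    F+2k² : F + 2 * (k * k) ≡ e * e
    F+2k² = PathBound.scaleF-identity 22≤k

    record Values {u y m w p r} (S : Skeleton u y m w p r) (x : Fin n → ℕ) : Set where
      field
        x-u : x u ≡ X
        x-y : x y ≡ X
        x-m : x m ≡ M
        x-w : x w ≡ W
        x-p : x p ≡ P
        x-r : x r ≡ P
        x-o : ∀ {v} → v ≢ u → v ≢ y → v ≢ m → v ≢ w → v ≢ p → v ≢ r → x v ≡ O

    mirror-values : ∀ {u y m w p r} {S : Skeleton u y m w p r} {x} → Values S x → Values (mirror S) x
    mirror-values V = record { x-u = x-y ; x-y = x-u ; x-m = x-m ; x-w = x-w ; x-p = x-r ; x-r = x-p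
      ; x-o = λ v≢y v≢u v≢m v≢w v≢r v≢p → x-o v≢u v≢y v≢m v≢w v≢p v≢r }
      where open Values V

    module Bounds {u y m w p r} (S : Skeleton u y m w p r) {x : Fin n → ℕ} (V : Values S x)
                  (p-alone : ¬ Half.HasPartner S p) (r-alone : ¬ Half.HasPartner (mirror S) r) where
      open Skeleton S
      open Values V
      open Half S

      x-near-u : ∀ {v} → Adj G u v → v ≢ m → v ≢ p → x v ≡ O
      x-near-u u~v v≢m v≢p = x-o (Adj⇒≢ G u~v ∘ sym) (λ { refl → u≁y u~v }) v≢m (λ { refl → u≁w u~v }) v≢p
        (λ { refl → v≢m (common≡m u~v y~r) })

      bound-u : k * (d u * x u + ∑A x u) ≤ L * x u
      bound-u = ℕ.+-cancelʳ-≤ (k * (2 * O)) _ _ (begin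
        k * (d u * x u + ∑A x u) + k * (2 * O)
          ≡⟨ trans (sym (ℕ.*-distribˡ-+ k (d u * x u + ∑A x u) (2 * O))) (cong (k *_) (ℕ.+-assoc (d u * x u) (∑A x u) (2 * O))) ⟩
        k * (d u * x u + (∑A x u + 2 * O))
          ≤⟨ ℕ.*-monoʳ-≤ k (ℕ.+-monoʳ-≤ (d u * x u) (∑-neighbours≤ G x O m≢p u~m u~p (λ v u~v v≢m v≢p → ℕ.≤-reflexive (x-near-u u~v v≢m v≢p)))) ⟩
        k * (d u * x u + (x m + x p + d u * O))
          ≡⟨ cong (k *_) (cong₂ _+_ (cong₂ _*_ du≡k x-u) (cong₂ _+_ (cong₂ _+_ x-m x-p) (cong (_* O) du≡k))) ⟩
        k * (k * X + (M + P + k * O))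
          ≤⟨ PathBound.fourPath 22≤k ⟩
        L * X + k * (2 * O)
          ≡⟨ cong (λ t → L * t + k * (2 * O)) (sym x-u) ⟩
        L * x u + k * (2 * O) ∎)
        where open ℕ.≤-Reasoning

      bound-m : k * (d m * x m + ∑A x m) ≤ L * x m
      bound-m = pairBound x u≢y (Adj-sym G u~m) (Adj-sym G y~m) only x-m x-u x-y (regroup k Q F)
        where
        only : ∀ v → Adj G m v → v ≢ u → v ≢ y → ⊥
        only v m~v v≢u v≢y with place v
        ... | at-u = v≢u refl
        ... | at-y = v≢y refl
        ... | at-w = m≁w m~v
        ... | near-u u~v = noTriangle u~m m~v (Adj-sym G u~v)
        ... | near-y y~v = noTriangle y~m m~v (Adj-sym G y~v)
        regroup : ∀ k q f → k * (2 * (2 * k * f * q) + ((q + k) * f * q + (q + k) * f * q)) ≡ (3 * k + q) * (2 * k * f * q)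
        regroup = solve-∀

      bound-w : k * (d w * x w + ∑A x w) ≤ L * x w
      bound-w = pairBound x (λ { refl → m≢p (sym (common≡m u~p y~r)) }) w~p w~r only x-w x-p x-r (regroup k Q)
        where
        only : ∀ v → Adj G w v → v ≢ p → v ≢ r → ⊥
        only v w~v v≢p v≢r with place v
        ... | at-u = u≁w (Adj-sym G w~v)
        ... | at-y = y≁w (Adj-sym G w~v)
        ... | at-w = Adj⇒≢ G w~v refl
        ... | near-u u~v = v≢p (commonNeighbour-unique w≢u w~v u~v w~p u~p)
        ... | near-y y~v = v≢r (commonNeighbour-unique w≢y w~v y~v w~r y~r)
        regroup : ∀ k q → k * (2 * (2 * k * k * (q + k) * q) + (k * (q + k) * (q + k) * q + k * (q + k) * (q + k) * q)) ≡
          (3 * k + q) * (2 * k * k * (q + k) * q)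
        regroup = solve-∀

      bound-p : k * (d p * x p + ∑A x p) ≤ L * x p
      bound-p = pairBound x (w≢u ∘ sym) (Adj-sym G u~p) (Adj-sym G w~p) only x-p x-u x-w (begin
        k * (2 * P + (X + W))
          ≡⟨ regroup₁ k Q e F ⟩
        2 * k * P + k * e * Q * (F + 2 * (k * k))
          -- The entry at w depends on the one at p and feeds back into it; F is defined so that
          -- this loop closes.
          ≡⟨ cong (λ t → 2 * k * P + k * e * Q * t) F+2k² ⟩
        2 * k * P + k * e * Q * (e * e)
          ≡⟨ regroup₂ k Q ⟩
        (3 * k + Q) * P ∎)
        where
        open ≡-Reasoning
        only : ∀ v → Adj G p v → v ≢ u → v ≢ w → ⊥
        only v p~v v≢u v≢w with exits u~p (m≢p ∘ sym) p~v v≢u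
        ... | inj₁ y~v       = p-alone (v , p~v , y~v)
        ... | inj₂ (_ , v≡w) = v≢w v≡w
        regroup₁ : ∀ k q e f → k * (2 * (k * e * e * q) + (e * f * q + 2 * k * k * e * q)) ≡
          2 * k * (k * e * e * q) + k * e * q * (f + 2 * (k * k))
        regroup₁ = solve-∀
        regroup₂ : ∀ k q → 2 * k * (k * (q + k) * (q + k) * q) + k * (q + k) * q * ((q + k) * (q + k)) ≡ (3 * k + q) * (k * (q + k) * (q + k) * q)
        regroup₂ = solve-∀

      bound-near-u : ∀ {v} → Adj G u v → v ≢ m → v ≢ p → k * (d v * x v + ∑A x v) ≤ L * x v
      bound-near-u {v} u~v v≢m v≢p = via (partner u~v v≢m v≢p)
        where
        only : ∀ {v′} → Adj G y v′ → Adj G v v′ → ∀ s → Adj G v s → s ≢ u → s ≢ v′ → ⊥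
        only y~v′ v~v′ s v~s s≢u s≢v′ with exits u~v v≢m v~s s≢u
        ... | inj₁ y~s       = s≢v′ (partner-unique u~v v~s y~s v~v′ y~v′)
        ... | inj₂ (v≡p , _) = v≢p v≡p
        via : HasPartner v → k * (d v * x v + ∑A x v) ≤ L * x v
        via (v′ , v~v′ , y~v′) = pairBound x (λ { refl → y≁u y~v′ }) (Adj-sym G u~v) v~v′ (only y~v′ v~v′)
          (x-near-u u~v v≢m v≢p) x-u
          (x-o (λ { refl → y≁u y~v′ }) (Adj⇒≢ G y~v′ ∘ sym) (partner≢m u~v v~v′) (λ { refl → y≁w y~v′ })
            (λ { refl → m≢p (sym (common≡m u~p y~v′)) })
            (λ { refl → r-alone (v , Adj-sym G v~v′ , u~v) }))
          (regroup k Q F)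
          where
          regroup : ∀ k q f → k * (2 * (k * (q + k) * f) + ((q + k) * f * q + k * (q + k) * f)) ≡ (3 * k + q) * (k * (q + k) * f)
          regroup = solve-∀

    if-yes : ∀ {c v : Fin n} {s t : ℕ} → v ≡ c → (if ⌊ v Fin.≟ c ⌋ then s else t) ≡ s
    if-yes {c} {v} v≡c with v Fin.≟ c
    ... | yes _  = refl
    ... | no v≢c = contradiction v≡c v≢c

    if-no : ∀ {c v : Fin n} {s t : ℕ} → v ≢ c → (if ⌊ v Fin.≟ c ⌋ then s else t) ≡ t
    if-no {c} {v} v≢c with v Fin.≟ c
    ... | yes v≡c = contradiction v≡c v≢c
    ... | no _    = refl

    module _ {u y m w p r} (S : Skeleton u y m w p r)
             (p-alone : ¬ Half.HasPartner S p) (r-alone : ¬ Half.HasPartner (mirror S) r) where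
      open Skeleton S
      open Completion S

      x : Fin n → ℕ
      x v = if ⌊ v Fin.≟ u ⌋ then X else if ⌊ v Fin.≟ y ⌋ then X else if ⌊ v Fin.≟ m ⌋ then M else
            if ⌊ v Fin.≟ w ⌋ then W else if ⌊ v Fin.≟ p ⌋ then P else if ⌊ v Fin.≟ r ⌋ then P else O

      values : Values S x
      values = record
        { x-u = if-yes (refl {x = u})
        ; x-y = trans (if-no (u≢y ∘ sym)) (if-yes (refl {x = y}))
        ; x-m = trans (if-no m≢u) (trans (if-no m≢y) (if-yes (refl {x = m})))
        ; x-w = trans (if-no w≢u) (trans (if-no w≢y) (trans (if-no (m≢w ∘ sym)) (if-yes (refl {x = w}))))
        ; x-p = trans (if-no p≢u) (trans (if-no p≢y) (trans (if-no (U.m≢p ∘ sym)) (trans (if-no p≢w) (if-yes (refl {x = p})))))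
        ; x-r = trans (if-no r≢u) (trans (if-no r≢y) (trans (if-no (Y.m≢p ∘ sym)) (trans (if-no r≢w) (trans (if-no r≢p) (if-yes (refl {x = r}))))))
        ; x-o = λ v≢u v≢y v≢m v≢w v≢p v≢r → trans (if-no v≢u) (trans (if-no v≢y) (trans (if-no v≢m) (trans (if-no v≢w) (trans (if-no v≢p) (if-no v≢r)))))
        }

      certificate : Certificate G k
      certificate = x , 1≤x , bound
        where
        module BU = Bounds S values p-alone r-alone
        module BY = Bounds (mirror S) (mirror-values values) r-alone p-alone
        open Values values
        k≤e : k ≤ e
        k≤e = ℕ.m≤n+m k Q
        1≤e : 1 ≤ e
        1≤e = ℕ.≤-trans 1≤k k≤e
        1≤* : ∀ {s t} → 1 ≤ s → 1 ≤ t → 1 ≤ s * t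
        1≤* = ℕ.*-mono-≤
        1≤2 : 1 ≤ 2
        1≤2 = s≤s z≤n
        1≤x : ∀ v → 1 ≤ x v
        1≤x v with ⌊ v Fin.≟ u ⌋ | ⌊ v Fin.≟ y ⌋ | ⌊ v Fin.≟ m ⌋ | ⌊ v Fin.≟ w ⌋ | ⌊ v Fin.≟ p ⌋ | ⌊ v Fin.≟ r ⌋
        ... | true  | _     | _     | _     | _     | _     = 1≤* (1≤* 1≤e 1≤F) 1≤Q
        ... | false | true  | _     | _     | _     | _     = 1≤* (1≤* 1≤e 1≤F) 1≤Q
        ... | false | false | true  | _     | _     | _     = 1≤* (1≤* (1≤* 1≤2 1≤k) 1≤F) 1≤Q
        ... | false | false | false | true  | _     | _     = 1≤* (1≤* (1≤* (1≤* 1≤2 1≤k) 1≤k) 1≤e) 1≤Q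
        ... | false | false | false | false | true  | _     = 1≤* (1≤* (1≤* 1≤k 1≤e) 1≤e) 1≤Q
        ... | false | false | false | false | false | true  = 1≤* (1≤* (1≤* 1≤k 1≤e) 1≤e) 1≤Q
        ... | false | false | false | false | false | false = 1≤* (1≤* 1≤k 1≤e) 1≤F
        bound : ∀ v → k * (d v * x v + ∑A x v) ≤ L * x v
        bound v = at (place v) (v Fin.≟ m) (v Fin.≟ p) (v Fin.≟ r)
          where
          at : ∀ {v} → Place u y w v → Dec (v ≡ m) → Dec (v ≡ p) → Dec (v ≡ r) →
            k * (d v * x v + ∑A x v) ≤ L * x v
          at at-u         _          _          _          = BU.bound-u
          at at-y         _          _          _          = BY.bound-u
          at at-w         _          _          _          = BU.bound-w
          at (near-u _)   (yes refl) _          _          = BU.bound-m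
          at (near-u _)   (no _)     (yes refl) _          = BU.bound-p
          at (near-u u~v) (no v≢m)   (no v≢p)   _          = BU.bound-near-u u~v v≢m v≢p
          at (near-y _)   (yes refl) _          _          = BU.bound-m
          at (near-y _)   (no _)     _          (yes refl) = BY.bound-p
          at (near-y y~v) (no v≢m)   _          (no v≢r)   = BY.bound-near-u y~v v≢m v≢r

  -- Both partners exist: identification with T

  module Isomorphism {u y m w p r} (S : Skeleton u y m w p r) {j} (k≡ : k ≡ 3 + j)
                     (p-partner : Half.HasPartner S p) (r-partner : Half.HasPartner (mirror S) r) where
    open Skeleton S
    open Completion S
    open Half S

    p′ r′ : Fin n
    p′ = proj₁ p-partner
    r′ = proj₁ r-partner

    r~r′ : Adj G r r′
    r~r′ = proj₁ (proj₂ r-partner)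

    u~r′ : Adj G u r′
    u~r′ = proj₂ (proj₂ r-partner)

    m≢r′ : m ≢ r′
    m≢r′ m≡r′ = Y.partner≢m y~r r~r′ (sym m≡r′)

    -- Otherwise w, p and r would form a triangle. Hence w meets two different paths of length
    -- three.
    p≢r′ : p ≢ r′
    p≢r′ p≡r′ = noTriangle w~p (subst (λ v → Adj G v r) (sym p≡r′) (Adj-sym G r~r′)) (Adj-sym G w~r)

    ordinary : Fin n → Bool
    ordinary v = adj G u v ∧ (not ⌊ m Fin.≟ v ⌋ ∧ (not ⌊ p Fin.≟ v ⌋ ∧ not ⌊ r′ Fin.≟ v ⌋))

    ordinary-split : ∀ v → bit (ordinary v) + (δ m v + (δ p v + δ r′ v)) ≡ A u v
    ordinary-split v with m Fin.≟ v | p Fin.≟ v | r′ Fin.≟ v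
    ... | yes refl | yes refl | _        = contradiction refl m≢p
    ... | yes refl | no _     | yes refl = contradiction refl m≢r′
    ... | yes refl | no _     | no _     rewrite u~m = refl
    ... | no _     | yes refl | yes refl = contradiction refl p≢r′
    ... | no _     | yes refl | no _     rewrite u~p = refl
    ... | no _     | no _     | yes refl rewrite u~r′ = refl
    ... | no _     | no _     | no _     with adj G u v
    ...   | true  = refl
    ...   | false = refl

    ordinary⇒ : ∀ {v} → ordinary v ≡ true → Adj G u v × m ≢ v × p ≢ v × r′ ≢ v
    ordinary⇒ {v} o with adj G u v | m Fin.≟ v | p Fin.≟ v | r′ Fin.≟ v
    ... | true | no m≢v | no p≢v | no r′≢v = refl , m≢v , p≢v , r′≢v

    ⇒ordinary : ∀ {v} → Adj G u v → m ≢ v → p ≢ v → r′ ≢ v → ordinary v ≡ true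
    ⇒ordinary {v} u~v m≢v p≢v r′≢v with m Fin.≟ v | p Fin.≟ v | r′ Fin.≟ v
    ... | yes m≡v | _       | _        = contradiction m≡v m≢v
    ... | no _    | yes p≡v | _        = contradiction p≡v p≢v
    ... | no _    | no _    | yes r′≡v = contradiction r′≡v r′≢v
    ... | no _    | no _    | no _     rewrite u~v = refl

    ∑ordinary : ∑ (bit ∘ ordinary) ≡ j
    ∑ordinary = ℕ.+-cancelʳ-≡ 3 _ j (begin
      ∑ (bit ∘ ordinary) + 3
        ≡⟨ cong (∑ (bit ∘ ordinary) ℕ.+_) (sym (cong₂ _+_ (∑-δ m) (cong₂ _+_ (∑-δ p) (∑-δ r′)))) ⟩
      ∑ (bit ∘ ordinary) + (∑ (δ m) + (∑ (δ p) + ∑ (δ r′)))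
        ≡⟨ sym (trans (∑-+ (bit ∘ ordinary) (λ v → δ m v + (δ p v + δ r′ v))) (cong (∑ (bit ∘ ordinary) ℕ.+_) (trans (∑-+ (δ m) (λ v → δ p v + δ r′ v)) (cong (∑ (δ m) ℕ.+_) (∑-+ (δ p) (δ r′)))))) ⟩
      ∑ (λ v → bit (ordinary v) + (δ m v + (δ p v + δ r′ v)))
        ≡⟨ ∑-cong ordinary-split ⟩
      ∑ (A u)
        ≡⟨ trans (sym (degree-∑ G u)) (trans du≡k (trans k≡ (ℕ.+-comm 3 j))) ⟩
      j + 3 ∎)
      where open ≡-Reasoning

    enumeration : Enumeration ordinary j
    enumeration = enumerate ordinary ∑ordinary

    g : Fin j → Fin n
    g = proj₁ enumeration

    g-ordinary : ∀ i → Adj G u (g i) × m ≢ g i × p ≢ g i × r′ ≢ g i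
    g-ordinary i = ordinary⇒ (proj₁ (proj₂ (proj₂ enumeration)) i)

    -- The order is dictated by `wNeighbour`: w must be adjacent to the u-end of path 0, which is p,
    -- and to the y-end of path 1, which is r; so path 1 starts with the partner r′ of r.
    nearX′ : Fin (2 + j) → Fin n
    nearX′ zero          = p
    nearX′ (suc zero)    = r′
    nearX′ (suc (suc i)) = g i

    nearX-adj : ∀ {i} → Adj G u (nearX′ i)
    nearX-adj {zero}        = u~p
    nearX-adj {suc zero}    = u~r′
    nearX-adj {suc (suc i)} = proj₁ (g-ordinary i)

    nearX≢m : ∀ {i} → m ≢ nearX′ i
    nearX≢m {zero}        = m≢p
    nearX≢m {suc zero}    = m≢r′
    nearX≢m {suc (suc i)} = proj₁ (proj₂ (g-ordinary i))

    nearX′-injective : ∀ {i i′} → nearX′ i ≡ nearX′ i′ → i ≡ i′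
    nearX′-injective {zero}        {zero}         _  = refl
    nearX′-injective {zero}        {suc zero}     eq = contradiction eq p≢r′
    nearX′-injective {zero}        {suc (suc i)}  eq = contradiction eq (proj₁ (proj₂ (proj₂ (g-ordinary i))))
    nearX′-injective {suc zero}    {zero}         eq = contradiction (sym eq) p≢r′
    nearX′-injective {suc zero}    {suc zero}     _  = refl
    nearX′-injective {suc zero}    {suc (suc i)}  eq = contradiction eq (proj₂ (proj₂ (proj₂ (g-ordinary i))))
    nearX′-injective {suc (suc i)} {zero}         eq = contradiction (sym eq) (proj₁ (proj₂ (proj₂ (g-ordinary i))))
    nearX′-injective {suc (suc i)} {suc zero}     eq = contradiction (sym eq) (proj₂ (proj₂ (proj₂ (g-ordinary i))))
    nearX′-injective {suc (suc i)} {suc (suc i′)} eq = cong (λ i → suc (suc i)) (proj₁ (proj₂ enumeration) eq)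

    nearX′-surjective : ∀ {v} → Adj G u v → m ≢ v → ∃[ i ] nearX′ i ≡ v
    nearX′-surjective {v} u~v m≢v with p Fin.≟ v | r′ Fin.≟ v
    ... | yes p≡v | _        = zero , p≡v
    ... | no _    | yes r′≡v = suc zero , r′≡v
    ... | no p≢v  | no r′≢v  =
      let i , eq = proj₂ (proj₂ (proj₂ enumeration)) v (⇒ordinary u~v m≢v p≢v r′≢v) in suc (suc i) , eq

    across : ∀ i → HasPartner (nearX′ i)
    across zero          = p-partner
    across (suc zero)    = r , Adj-sym G r~r′ , y~r
    across (suc (suc i)) = partner (proj₁ (g-ordinary i)) (proj₁ (proj₂ (g-ordinary i)) ∘ sym)
      (proj₁ (proj₂ (proj₂ (g-ordinary i))) ∘ sym)

    nearY′ : Fin (2 + j) → Fin n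
    nearY′ i = proj₁ (across i)

    nearX~nearY : ∀ {i} → Adj G (nearX′ i) (nearY′ i)
    nearX~nearY {i} = proj₁ (proj₂ (across i))

    nearY-adj : ∀ {i} → Adj G y (nearY′ i)
    nearY-adj {i} = proj₂ (proj₂ (across i))

    u≁nearY : ∀ {i} → ¬ Adj G u (nearY′ i)
    u≁nearY {i} u~ = noTriangle (nearX-adj {i}) (nearX~nearY {i}) (Adj-sym G u~)

    y≁nearX : ∀ {i} → ¬ Adj G y (nearX′ i)
    y≁nearX {i} y~ = nearX≢m {i} (sym (common≡m (nearX-adj {i}) y~))

    m≁nearX : ∀ {i} → ¬ Adj G m (nearX′ i)
    m≁nearX {i} m~ = noTriangle u~m m~ (Adj-sym G (nearX-adj {i}))

    m≁nearY : ∀ {i} → ¬ Adj G m (nearY′ i)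
    m≁nearY {i} m~ = noTriangle y~m m~ (Adj-sym G (nearY-adj {i}))

    nearX≁nearX : ∀ {i i′} → ¬ Adj G (nearX′ i) (nearX′ i′)
    nearX≁nearX {i} {i′} ~ = noTriangle (nearX-adj {i}) ~ (Adj-sym G (nearX-adj {i′}))

    nearY≁nearY : ∀ {i i′} → ¬ Adj G (nearY′ i) (nearY′ i′)
    nearY≁nearY {i} {i′} ~ = noTriangle (nearY-adj {i}) ~ (Adj-sym G (nearY-adj {i′}))

    -- Two neighbours of u joined to the same neighbour of y would close a 4-cycle through u.
    nearX~nearY⇒≡ : ∀ {i i′} → Adj G (nearX′ i) (nearY′ i′) → i ≡ i′
    nearX~nearY⇒≡ {i} {i′} ~ = nearX′-injective (commonNeighbour-unique u≢nearY
      (nearX-adj {i}) (Adj-sym G ~) (nearX-adj {i′}) (Adj-sym G (nearX~nearY {i′})))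
      where
      u≢nearY : u ≢ nearY′ i′
      u≢nearY eq = y≁u (subst (Adj G y) (sym eq) (nearY-adj {i′}))

    nearY′-injective : ∀ {i i′} → nearY′ i ≡ nearY′ i′ → i ≡ i′
    nearY′-injective {i} {i′} eq = nearX~nearY⇒≡ (subst (Adj G (nearX′ i)) eq (nearX~nearY {i}))

    nearY′-surjective : ∀ {v} → Adj G y v → m ≢ v → ∃[ i ] nearY′ i ≡ v
    nearY′-surjective {v} y~v m≢v with v Fin.≟ r
    ... | yes refl = suc zero , refl
    ... | no v≢r = via (Y.partner y~v (m≢v ∘ sym) v≢r)
      where
      via : Y.HasPartner v → ∃[ i ] nearY′ i ≡ v
      via (v′ , v~v′ , u~v′) with nearX′-surjective u~v′ (λ m≡v′ → Y.partner≢m y~v v~v′ (sym m≡v′))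
      ... | i , refl = i , partner-unique u~v′ (nearX~nearY {i}) (nearY-adj {i}) (Adj-sym G v~v′) y~v

    ≁ : ∀ {s t} → ¬ Adj G s t → adj G s t ≡ false
    ≁ {s} {t} s≁t with adj G s t
    ... | true  = contradiction refl s≁t
    ... | false = refl

    w-nearX : ∀ {i} → adj G w (nearX′ i) ≡ wNeighbour (nearX i)
    w-nearX {zero}  = w~p
    w-nearX {suc i} = ≁ λ w~ → contradiction
      (nearX′-injective {suc i} {zero} (commonNeighbour-unique w≢u w~ (nearX-adj {suc i}) w~p u~p)) λ ()

    w-nearY : ∀ {i} → adj G w (nearY′ i) ≡ wNeighbour (nearY i)
    w-nearY {zero} = ≁ λ w~ → contradiction
      (nearY′-injective {zero} {suc zero} (commonNeighbour-unique w≢y w~ (nearY-adj {zero}) w~r y~r)) λ ()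
    w-nearY {suc zero}    = w~r
    w-nearY {suc (suc i)} = ≁ λ w~ → contradiction
      (nearY′-injective {suc (suc i)} {suc zero} (commonNeighbour-unique w≢y w~ (nearY-adj {suc (suc i)}) w~r y~r)) λ ()

    cross : ∀ {i i′} → adj G (nearX′ i) (nearY′ i′) ≡ ⌊ i Fin.≟ i′ ⌋ ∨ false
    cross {i} {i′} with i Fin.≟ i′
    ... | yes refl = nearX~nearY {i}
    ... | no i≢i′  = ≁ λ ~ → i≢i′ (nearX~nearY⇒≡ ~)

    φ : Maybe (ThetaVertex (2 + j)) → Fin n
    φ (just terminalX) = u
    φ (just terminalY) = y
    φ (just mid)       = m
    φ nothing          = w
    φ (just (nearX i)) = nearX′ i
    φ (just (nearY i)) = nearY′ i

    flip : ∀ s t → adj G (φ t) (φ s) ≡ adj (T (3 + j)) t s → adj G (φ s) (φ t) ≡ adj (T (3 + j)) s t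
    flip s t eq = trans (symm G (φ s) (φ t)) (trans eq (symm (T (3 + j)) t s))

    φ-adj : ∀ s t → adj G (φ s) (φ t) ≡ adj (T (3 + j)) s t
    φ-adj (just terminalX) (just terminalX) = irrefl G u
    φ-adj (just terminalX) (just terminalY) = ≁ u≁y
    φ-adj (just terminalX) (just mid) = u~m
    φ-adj (just terminalX) nothing = ≁ u≁w
    φ-adj (just terminalX) (just (nearX i′)) = nearX-adj {i′}
    φ-adj (just terminalX) (just (nearY i′)) = ≁ (u≁nearY {i′})
    φ-adj (just terminalY) (just terminalX) = flip (just terminalY) (just terminalX) (≁ u≁y)
    φ-adj (just terminalY) (just terminalY) = irrefl G y
    φ-adj (just terminalY) (just mid) = y~m
    φ-adj (just terminalY) nothing = ≁ y≁w
    φ-adj (just terminalY) (just (nearX i′)) = ≁ (y≁nearX {i′})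
    φ-adj (just terminalY) (just (nearY i′)) = nearY-adj {i′}
    φ-adj (just mid) (just terminalX) = flip (just mid) (just terminalX) (u~m)
    φ-adj (just mid) (just terminalY) = flip (just mid) (just terminalY) (y~m)
    φ-adj (just mid) (just mid) = irrefl G m
    φ-adj (just mid) nothing = ≁ m≁w
    φ-adj (just mid) (just (nearX i′)) = ≁ (m≁nearX {i′})
    φ-adj (just mid) (just (nearY i′)) = ≁ (m≁nearY {i′})
    φ-adj nothing (just terminalX) = flip nothing (just terminalX) (≁ u≁w)
    φ-adj nothing (just terminalY) = flip nothing (just terminalY) (≁ y≁w)
    φ-adj nothing (just mid) = flip nothing (just mid) (≁ m≁w)
    φ-adj nothing nothing = irrefl G w
    φ-adj nothing (just (nearX i′)) = w-nearX {i′}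
    φ-adj nothing (just (nearY i′)) = w-nearY {i′}
    φ-adj (just (nearX i)) (just terminalX) = flip (just (nearX i)) (just terminalX) (nearX-adj {i})
    φ-adj (just (nearX i)) (just terminalY) = flip (just (nearX i)) (just terminalY) (≁ (y≁nearX {i}))
    φ-adj (just (nearX i)) (just mid) = flip (just (nearX i)) (just mid) (≁ (m≁nearX {i}))
    φ-adj (just (nearX i)) nothing = flip (just (nearX i)) nothing (w-nearX {i})
    φ-adj (just (nearX i)) (just (nearX i′)) = ≁ (nearX≁nearX {i} {i′})
    φ-adj (just (nearX i)) (just (nearY i′)) = cross {i} {i′}
    φ-adj (just (nearY i)) (just terminalX) = flip (just (nearY i)) (just terminalX) (≁ (u≁nearY {i}))
    φ-adj (just (nearY i)) (just terminalY) = flip (just (nearY i)) (just terminalY) (nearY-adj {i})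
    φ-adj (just (nearY i)) (just mid) = flip (just (nearY i)) (just mid) (≁ (m≁nearY {i}))
    φ-adj (just (nearY i)) nothing = flip (just (nearY i)) nothing (w-nearY {i})
    φ-adj (just (nearY i)) (just (nearX i′)) = flip (just (nearY i)) (just (nearX i′)) (cross {i′} {i})
    φ-adj (just (nearY i)) (just (nearY i′)) = ≁ (nearY≁nearY {i} {i′})

    -- Since φ preserves adjacency and non-adjacency, a vertex c of T that is adjacent to only one
    -- of s and t keeps their images apart.
    separated : ∀ c s t → adj (T (3 + j)) c s ≢ adj (T (3 + j)) c t → φ s ≢ φ t
    separated c s t ≢ eq = ≢ (trans (sym (φ-adj c s)) (trans (cong (adj G (φ c)) eq) (φ-adj c t)))

    φ-injective : ∀ s t → φ s ≡ φ t → s ≡ t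
    φ-injective (just terminalX) (just terminalX) eq = refl
    φ-injective (just terminalX) (just terminalY) eq = contradiction eq u≢y
    φ-injective (just terminalX) (just mid) eq = ⊥-elim (separated (just terminalX) (just terminalX) (just mid) (λ ()) eq)
    φ-injective (just terminalX) nothing eq = contradiction (sym eq) w≢u
    φ-injective (just terminalX) (just (nearX i′)) eq = ⊥-elim (separated (just terminalX) (just terminalX) (just (nearX i′)) (λ ()) eq)
    φ-injective (just terminalX) (just (nearY i′)) eq = ⊥-elim (separated (just terminalY) (just terminalX) (just (nearY i′)) (λ ()) eq)
    φ-injective (just terminalY) (just terminalX) eq = contradiction (sym eq) u≢y
    φ-injective (just terminalY) (just terminalY) eq = refl
    φ-injective (just terminalY) (just mid) eq = ⊥-elim (separated (just terminalX) (just terminalY) (just mid) (λ ()) eq)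
    φ-injective (just terminalY) nothing eq = contradiction (sym eq) w≢y
    φ-injective (just terminalY) (just (nearX i′)) eq = ⊥-elim (separated (just terminalX) (just terminalY) (just (nearX i′)) (λ ()) eq)
    φ-injective (just terminalY) (just (nearY i′)) eq = ⊥-elim (separated (just terminalY) (just terminalY) (just (nearY i′)) (λ ()) eq)
    φ-injective (just mid) (just terminalX) eq = ⊥-elim (separated (just terminalX) (just mid) (just terminalX) (λ ()) eq)
    φ-injective (just mid) (just terminalY) eq = ⊥-elim (separated (just terminalX) (just mid) (just terminalY) (λ ()) eq)
    φ-injective (just mid) (just mid) eq = refl
    φ-injective (just mid) nothing eq = ⊥-elim (separated (just terminalX) (just mid) nothing (λ ()) eq)
    φ-injective (just mid) (just (nearX i′)) eq = ⊥-elim (separated (just terminalY) (just mid) (just (nearX i′)) (λ ()) eq)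
    φ-injective (just mid) (just (nearY i′)) eq = ⊥-elim (separated (just terminalX) (just mid) (just (nearY i′)) (λ ()) eq)
    φ-injective nothing (just terminalX) eq = contradiction eq w≢u
    φ-injective nothing (just terminalY) eq = contradiction eq w≢y
    φ-injective nothing (just mid) eq = ⊥-elim (separated (just terminalX) nothing (just mid) (λ ()) eq)
    φ-injective nothing nothing eq = refl
    φ-injective nothing (just (nearX i′)) eq = ⊥-elim (separated (just terminalX) nothing (just (nearX i′)) (λ ()) eq)
    φ-injective nothing (just (nearY i′)) eq = ⊥-elim (separated (just terminalY) nothing (just (nearY i′)) (λ ()) eq)
    φ-injective (just (nearX i)) (just terminalX) eq = ⊥-elim (separated (just terminalX) (just (nearX i)) (just terminalX) (λ ()) eq)
    φ-injective (just (nearX i)) (just terminalY) eq = ⊥-elim (separated (just terminalX) (just (nearX i)) (just terminalY) (λ ()) eq)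
    φ-injective (just (nearX i)) (just mid) eq = ⊥-elim (separated (just terminalY) (just (nearX i)) (just mid) (λ ()) eq)
    φ-injective (just (nearX i)) nothing eq = ⊥-elim (separated (just terminalX) (just (nearX i)) nothing (λ ()) eq)
    φ-injective (just (nearX i)) (just (nearX i′)) eq = cong (just ∘ nearX) (nearX′-injective eq)
    φ-injective (just (nearX i)) (just (nearY i′)) eq = ⊥-elim (separated (just terminalX) (just (nearX i)) (just (nearY i′)) (λ ()) eq)
    φ-injective (just (nearY i)) (just terminalX) eq = ⊥-elim (separated (just terminalY) (just (nearY i)) (just terminalX) (λ ()) eq)
    φ-injective (just (nearY i)) (just terminalY) eq = ⊥-elim (separated (just terminalY) (just (nearY i)) (just terminalY) (λ ()) eq)
    φ-injective (just (nearY i)) (just mid) eq = ⊥-elim (separated (just terminalX) (just (nearY i)) (just mid) (λ ()) eq)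
    φ-injective (just (nearY i)) nothing eq = ⊥-elim (separated (just terminalY) (just (nearY i)) nothing (λ ()) eq)
    φ-injective (just (nearY i)) (just (nearX i′)) eq = ⊥-elim (separated (just terminalX) (just (nearY i)) (just (nearX i′)) (λ ()) eq)
    φ-injective (just (nearY i)) (just (nearY i′)) eq = cong (just ∘ nearY) (nearY′-injective eq)

    φ-surjective : ∀ v → ∃[ s ] φ s ≡ v
    φ-surjective v = at (place v) (m Fin.≟ v)
      where
      at : ∀ {v} → Place u y w v → Dec (m ≡ v) → ∃[ s ] φ s ≡ v
      at at-u         _         = just terminalX , refl
      at at-y         _         = just terminalY , refl
      at at-w         _         = nothing , refl
      at (near-u _)   (yes m≡v) = just mid , m≡v
      at (near-y _)   (yes m≡v) = just mid , m≡v
      at (near-u u~v) (no m≢v)  = let i , eq = nearX′-surjective u~v m≢v in just (nearX i) , eq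
      at (near-y y~v) (no m≢v)  = let i , eq = nearY′-surjective y~v m≢v in just (nearY i) , eq

    isomorphism : G ≅ T (3 + j)
    isomorphism = mk↔ₛ′ to φ (λ s → φ-injective (to (φ s)) s (to-φ (φ s))) to-φ ,
      λ s t → trans (sym (cong₂ (adj G) (to-φ s) (to-φ t))) (φ-adj (to s) (to t))
      where
      to : Fin n → Maybe (ThetaVertex (2 + j))
      to v = proj₁ (φ-surjective v)
      to-φ : ∀ v → φ (to v) ≡ v
      to-φ v = proj₂ (φ-surjective v)

  certificate-or-isomorphism : Certificate G k ⊎ G ≅ T k
  certificate-or-isomorphism with Fin.any? (λ u → d u ℕ.≟ k)
  ... | no none = inj₁ (degreeCertificate λ v → ℕ.≤∧≢⇒< (degree≤k v) λ dv≡k → none (v , dv≡k))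
  ... | yes (u , du≡k) with Fin.any? (λ y → ¬? (u Fin.≟ y) ×-dec d y ℕ.≟ k)
  ...   | no none = inj₁ (OneCentre.certificate u du≡k λ v v≢u →
            ℕ.≤∧≢⇒< (degree≤k v) λ dv≡k → none (v , v≢u ∘ sym , dv≡k))
  ...   | yes (y , u≢y , dy≡k) with Fin.any? (λ m → Adj? u m ×-dec Adj? y m)
  ...     | no none = inj₁ (TwoCentres.Disjoint.certificate u≢y du≡k dy≡k λ v common → none (v , common))
  ...     | yes (m , u~m , y~m) = fromSkeleton (skeleton u≢y du≡k dy≡k u~m y~m)
    where
    fromSkeleton : (∃[ w ] ∃[ p ] ∃[ r ] Skeleton u y m w p r) → Certificate G k ⊎ G ≅ T k
    fromSkeleton (w , p , r , S) = decide (U.hasPartner? p) (Y.hasPartner? r)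
      where
      open Completion S
      decide : Dec (U.HasPartner p) → Dec (Y.HasPartner r) → Certificate G k ⊎ G ≅ T k
      decide (no p-alone)    (no r-alone)    = inj₁ (FourPath.certificate S p-alone r-alone)
      decide (yes p-partner) (no r-alone)    = contradiction crossing-sym (unmatched (U.crossing≥ p-partner) (Y.crossing≤ r-alone))
      decide (no p-alone)    (yes r-partner) = contradiction (sym crossing-sym) (unmatched (Y.crossing≥ r-partner) (U.crossing≤ p-alone))
      decide (yes p-partner) (yes r-partner) = inj₂ (subst (λ k → G ≅ T k) (sym k≡)
        (Isomorphism.isomorphism S {k ∸ 3} k≡ p-partner r-partner))
        where
        k≡ : k ≡ 3 + (k ∸ 3)
        k≡ = sym (ℕ.m+[n∸m]≡n (ℕ.≤-trans (s≤s (s≤s (s≤s z≤n))) 22≤k))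

-- The signless Laplacian over ℚ

ι-∑ : ∀ {n} (f : Fin n → ℕ) → ι (∑ f) ≡ ∑ℚ (ι ∘ f)
ι-∑ {zero}  f = ι-def 0
ι-∑ {suc n} f = trans (ι-+ (f zero) (∑ (f ∘ suc))) (cong (ι (f zero) ℚ.+_) (ι-∑ (f ∘ suc)))

∑ℚ-zero : ∀ n → ∑ℚ {n} (λ _ → 0ℚ) ≡ 0ℚ
∑ℚ-zero = ℚΣ.sum-replicate-zero

∑ℚ-const : ∀ n c → ∑ℚ {n} (λ _ → c) ≡ ι n ℚ.* c
∑ℚ-const zero    c = trans (sym (ℚ.*-zeroˡ c)) (cong (ℚ._* c) (sym (ι-def 0)))
∑ℚ-const (suc n) c = begin
  c ℚ.+ ∑ℚ {n} (λ _ → c)   ≡⟨ cong₂ ℚ._+_ (sym (ℚ.*-identityˡ c)) (∑ℚ-const n c) ⟩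
  1ℚ ℚ.* c ℚ.+ ι n ℚ.* c   ≡⟨ sym (ℚ.*-distribʳ-+ c 1ℚ (ι n)) ⟩
  (1ℚ ℚ.+ ι n) ℚ.* c       ≡⟨ cong (ℚ._* c) (sym (ι-suc n)) ⟩
  ι (suc n) ℚ.* c          ∎
  where open ≡-Reasoning

∑ℚ-diagonal : ∀ {n} (i : Fin n) (f : Fin n → ℚ) → ∑ℚ (λ j → if ⌊ i Fin.≟ j ⌋ then f j else 0ℚ) ≡ f i
∑ℚ-diagonal {suc n} zero    f = trans (cong (f zero ℚ.+_) (∑ℚ-zero n)) (ℚ.+-identityʳ (f zero))
∑ℚ-diagonal {suc n} (suc i) f = trans (ℚ.+-identityˡ _) (trans (∑ℚ-cong step) (∑ℚ-diagonal i (f ∘ suc)))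
  where
  step : ∀ j → (if ⌊ suc i Fin.≟ suc j ⌋ then f (suc j) else 0ℚ) ≡ (if ⌊ i Fin.≟ j ⌋ then f (suc j) else 0ℚ)
  step j with i Fin.≟ j
  ... | yes _ = refl
  ... | no _  = refl

∑ℚ-diagonal′ : ∀ {n} (i : Fin n) (f : Fin n → ℚ) → ∑ℚ (λ j → if ⌊ j Fin.≟ i ⌋ then f j else 0ℚ) ≡ f i
∑ℚ-diagonal′ i f = trans (∑ℚ-cong step) (∑ℚ-diagonal i f)
  where
  step : ∀ j → (if ⌊ j Fin.≟ i ⌋ then f j else 0ℚ) ≡ (if ⌊ i Fin.≟ j ⌋ then f j else 0ℚ)
  step j with j Fin.≟ i | i Fin.≟ j
  ... | yes _   | yes _   = refl
  ... | no _    | no _    = refl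
  ... | yes j≡i | no i≢j  = contradiction (sym j≡i) i≢j
  ... | no j≢i  | yes i≡j = contradiction (sym i≡j) j≢i

module Laplacian {n} (G : Graph (Fin n)) where

  entry : Fin n → Fin n → ℚ
  entry i j = (if ⌊ i Fin.≟ j ⌋ then ι (degree G i) else 0ℚ) ℚ.+ (if adj G i j then 1ℚ else 0ℚ)

  seq-entry : ∀ i j m → seq (signlessLaplacian G i j) m ≡ entry i j
  seq-entry i j m = cong₂ ℚ._+_
    (trans (seq-if ⌊ i Fin.≟ j ⌋ (fromℚ (+ degree G i ℚ./ 1)) 0ℝ m)
      (cong (if ⌊ i Fin.≟ j ⌋ then_else 0ℚ) (sym (ι-def (degree G i)))))
    (seq-if (adj G i j) 1ℝ 0ℝ m)
    where
    seq-if : ∀ b x y m → seq (if b then x else y) m ≡ (if b then seq x m else seq y m)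
    seq-if true  x y m = refl
    seq-if false x y m = refl

  0≤entry : ∀ i j → 0ℚ ℚ.≤ entry i j
  0≤entry i j = ℚ.+-mono-≤ {0ℚ} {_} {0ℚ} (diagonal ⌊ i Fin.≟ j ⌋) (indicator (adj G i j))
    where
    diagonal : ∀ b → 0ℚ ℚ.≤ (if b then ι (degree G i) else 0ℚ)
    diagonal true  = 0≤ι (degree G i)
    diagonal false = ℚ.≤-refl
    indicator : ∀ b → 0ℚ ℚ.≤ (if b then 1ℚ else 0ℚ)
    indicator true  = ℚ.nonNegative⁻¹ 1ℚ
    indicator false = ℚ.≤-refl

  entry-sym : ∀ i j → entry i j ≡ entry j i
  entry-sym i j = cong₂ ℚ._+_ diagonal (cong (if_then 1ℚ else 0ℚ) (symm G i j))
    where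
    diagonal : (if ⌊ i Fin.≟ j ⌋ then ι (degree G i) else 0ℚ) ≡ (if ⌊ j Fin.≟ i ⌋ then ι (degree G j) else 0ℚ)
    diagonal with i Fin.≟ j | j Fin.≟ i
    ... | yes refl | yes _   = refl
    ... | yes refl | no i≢i  = contradiction refl i≢i
    ... | no i≢j   | yes j≡i = contradiction (sym j≡i) i≢j
    ... | no _     | no _    = refl

  neighbourSum : (Fin n → ℚ) → Fin n → ℚ
  neighbourSum x i = ∑ℚ λ j → if adj G i j then x j else 0ℚ

  row : ∀ x i → ∑ℚ (λ j → entry i j ℚ.* x j) ≡ ι (degree G i) ℚ.* x i ℚ.+ neighbourSum x i
  row x i = begin
    ∑ℚ (λ j → entry i j ℚ.* x j)
      ≡⟨ ∑ℚ-cong (λ j → term j ⌊ i Fin.≟ j ⌋ (adj G i j)) ⟩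
    ∑ℚ (λ j → (if ⌊ i Fin.≟ j ⌋ then ι (degree G i) ℚ.* x j else 0ℚ) ℚ.+ (if adj G i j then x j else 0ℚ))
      ≡⟨ ℚΣ.∑-distrib-+ (λ j → if ⌊ i Fin.≟ j ⌋ then ι (degree G i) ℚ.* x j else 0ℚ) (λ j → if adj G i j then x j else 0ℚ) ⟩
    ∑ℚ (λ j → if ⌊ i Fin.≟ j ⌋ then ι (degree G i) ℚ.* x j else 0ℚ) ℚ.+ neighbourSum x i
      ≡⟨ cong (ℚ._+ neighbourSum x i) (∑ℚ-diagonal i (λ j → ι (degree G i) ℚ.* x j)) ⟩
    ι (degree G i) ℚ.* x i ℚ.+ neighbourSum x i ∎
    where
    open ≡-Reasoning
    scaled : ∀ b p q → (if b then p else 0ℚ) ℚ.* q ≡ (if b then p ℚ.* q else 0ℚ)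
    scaled true  p q = refl
    scaled false p q = ℚ.*-zeroˡ q
    unit : ∀ b q → (if b then 1ℚ else 0ℚ) ℚ.* q ≡ (if b then q else 0ℚ)
    unit true  q = ℚ.*-identityˡ q
    unit false q = ℚ.*-zeroˡ q
    term : ∀ j b c → ((if b then ι (degree G i) else 0ℚ) ℚ.+ (if c then 1ℚ else 0ℚ)) ℚ.* x j ≡
      (if b then ι (degree G i) ℚ.* x j else 0ℚ) ℚ.+ (if c then x j else 0ℚ)
    term j b c = trans (ℚ.*-distribʳ-+ (x j) (if b then ι (degree G i) else 0ℚ) (if c then 1ℚ else 0ℚ))
      (cong₂ ℚ._+_ (scaled b (ι (degree G i)) (x j)) (unit c (x j)))

  ι-neighbourSum : ∀ (x : Fin n → ℕ) i → ι (∑ λ j → a G i j * x j) ≡ neighbourSum (ι ∘ x) i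
  ι-neighbourSum x i = trans (ι-∑ (λ j → a G i j * x j)) (∑ℚ-cong λ j → term (adj G i j) (x j))
    where
    term : ∀ b c → ι (bit b * c) ≡ (if b then ι c else 0ℚ)
    term true  c = cong ι (ℕ.+-identityʳ c)
    term false c = ι-def 0

  ι-degree : ∀ i → ι (degree G i) ≡ neighbourSum (λ _ → 1ℚ) i
  ι-degree i = begin
    ι (degree G i)              ≡⟨ cong ι (trans (degree-∑ G i) (∑-cong λ j → sym (ℕ.*-identityʳ (a G i j)))) ⟩
    ι (∑ λ j → a G i j * 1)     ≡⟨ ι-neighbourSum (λ _ → 1) i ⟩
    neighbourSum (λ _ → ι 1) i  ≡⟨ cong (λ c → neighbourSum (λ _ → c) i) ι-1 ⟩
    neighbourSum (λ _ → 1ℚ) i   ∎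
    where open ≡-Reasoning

  eigenvalue≤ℚ : ∀ x ℓ → (∀ i → 0ℚ ℚ.< x i) → (∀ i → ι (degree G i) ℚ.* x i ℚ.+ neighbourSum x i ℚ.≤ ℓ ℚ.* x i) →
    ∀ {q} → IsEigenvalue (signlessLaplacian G) q → q ≤ℝ fromℚ ℓ
  eigenvalue≤ℚ x ℓ 0<x bound {q} = eigenvalue≤ entry 0≤entry entry-sym x 0<x ℓ
    (λ i → subst (ℚ._≤ ℓ ℚ.* x i) (sym (row x i)) (bound i)) (signlessLaplacian G) seq-entry {q}

  certificate⇒eigenvalue≤ : ∀ {k} → 1 ≤ k → Certificate G k → ∀ ℓ → ι k ℚ.* ℓ ≡ ι (k * k + k + 3) →
    ∀ {q} → IsEigenvalue (signlessLaplacian G) q → q ≤ℝ fromℚ ℓ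
  certificate⇒eigenvalue≤ {k} 1≤k (x , 1≤x , bound) ℓ kℓ≡ {q} = eigenvalue≤ℚ (ι ∘ x) ℓ
    (λ i → 0<ι (x i) {{>-nonZero (1≤x i)}})
    (λ i → *-cancelˡ (0<ι k {{>-nonZero 1≤k}}) (begin
      ι k ℚ.* (ι (degree G i) ℚ.* ι (x i) ℚ.+ neighbourSum (ι ∘ x) i)
        ≡⟨ cong (ι k ℚ.*_) (sym (trans (ι-+ (degree G i * x i) (∑ λ j → a G i j * x j)) (cong₂ ℚ._+_ (ι-* (degree G i) (x i)) (ι-neighbourSum x i)))) ⟩
      ι k ℚ.* ι (degree G i * x i + ∑ λ j → a G i j * x j)
        ≡⟨ sym (ι-* k (degree G i * x i + ∑ λ j → a G i j * x j)) ⟩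
      ι (k * (degree G i * x i + ∑ λ j → a G i j * x j))
        ≤⟨ ι-mono (bound i) ⟩
      ι ((k * k + k + 3) * x i)
        ≡⟨ trans (ι-* (k * k + k + 3) (x i)) (cong (ℚ._* ι (x i)) (sym kℓ≡)) ⟩
      ι k ℚ.* ℓ ℚ.* ι (x i)
        ≡⟨ ℚ.*-assoc (ι k) ℓ (ι (x i)) ⟩
      ι k ℚ.* (ℓ ℚ.* ι (x i)) ∎)) {q}
    where open ℚ.≤-Reasoning

-- The quintic

-- Spelled out with the same association and the same expanded powers as the real quintic, so that
-- the two agree termwise by computation.
quinticℚ : ℚ → ℚ → ℚ
quinticℚ n z =
        z ℚ.* (z ℚ.* (z ℚ.* (z ℚ.* (z ℚ.* 1ℚ))))
  ℚ.- ½ ℚ.* (n ℚ.+ + 18 ℚ./ 1) ℚ.* (z ℚ.* (z ℚ.* (z ℚ.* (z ℚ.* 1ℚ))))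
  ℚ.+ + 3 ℚ./ 2 ℚ.* (+ 3 ℚ./ 1 ℚ.* n ℚ.+ + 16 ℚ./ 1) ℚ.* (z ℚ.* (z ℚ.* (z ℚ.* 1ℚ)))
  ℚ.- ½ ℚ.* (+ 27 ℚ./ 1 ℚ.* n ℚ.+ + 20 ℚ./ 1) ℚ.* (z ℚ.* (z ℚ.* 1ℚ))
  ℚ.+ + 4 ℚ./ 1 ℚ.* (+ 4 ℚ./ 1 ℚ.* n ℚ.- + 9 ℚ./ 1) ℚ.* z
  ℚ.- + 6 ℚ./ 1 ℚ.* n
  ℚ.+ + 24 ℚ./ 1

seq-quintic : ∀ n x m → seq (quintic n x) m ≡ quinticℚ (ι n) (seq x m)
seq-quintic n x m = cong (λ n′ → quinticℚ n′ (seq x m)) (sym (ι-def n))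

-- The graph T

∑ℚ-++ : ∀ a {b} (h : Fin (a + b) → ℚ) → ∑ℚ h ≡ ∑ℚ (λ i → h (i ↑ˡ b)) ℚ.+ ∑ℚ (λ i → h (a ↑ʳ i))
∑ℚ-++ zero    h = sym (ℚ.+-identityˡ (∑ℚ h))
∑ℚ-++ (suc a) h = trans (cong (h zero ℚ.+_) (∑ℚ-++ a (h ∘ suc))) (sym (ℚ.+-assoc (h zero) _ _))

two three : ℚ
two   = + 2 ℚ./ 1
three = + 3 ℚ./ 1

module Spectrum (j : ℕ) where

  V : Set
  V = Maybe (ThetaVertex (2 + j))

  N : ℕ
  N = 4 + ((2 + j) + (2 + j))

  near : Fin (2 + j) ⊎ Fin (2 + j) → V
  near = [ just ∘ nearX , just ∘ nearY ]′

  decode : Fin N → V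
  decode zero                      = just terminalX
  decode (suc zero)                = just terminalY
  decode (suc (suc zero))          = just mid
  decode (suc (suc (suc zero)))    = nothing
  decode (suc (suc (suc (suc i)))) = near (splitAt (2 + j) i)

  encode : V → Fin N
  encode (just terminalX) = zero
  encode (just terminalY) = suc zero
  encode (just mid)       = suc (suc zero)
  encode nothing          = suc (suc (suc zero))
  encode (just (nearX i)) = suc (suc (suc (suc (i ↑ˡ (2 + j)))))
  encode (just (nearY i)) = suc (suc (suc (suc ((2 + j) ↑ʳ i))))

  decode-encode : ∀ s → decode (encode s) ≡ s
  decode-encode (just terminalX) = refl
  decode-encode (just terminalY) = refl
  decode-encode (just mid)       = refl
  decode-encode nothing          = refl
  decode-encode (just (nearX i)) = cong near (Fin.splitAt-↑ˡ (2 + j) i (2 + j))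
  decode-encode (just (nearY i)) = cong near (Fin.splitAt-↑ʳ (2 + j) (2 + j) i)

  encode-near : ∀ s → encode (near s) ≡ suc (suc (suc (suc (join (2 + j) (2 + j) s))))
  encode-near (inj₁ i) = refl
  encode-near (inj₂ i) = refl

  encode-decode : ∀ i → encode (decode i) ≡ i
  encode-decode zero                      = refl
  encode-decode (suc zero)                = refl
  encode-decode (suc (suc zero))          = refl
  encode-decode (suc (suc (suc zero)))    = refl
  encode-decode (suc (suc (suc (suc i)))) = trans (encode-near (splitAt (2 + j) i))
    (cong (λ i → suc (suc (suc (suc i)))) (Fin.join-splitAt (2 + j) (2 + j) i))

  ∑V : (V → ℚ) → ℚ
  ∑V f = f (just terminalX) ℚ.+ (f (just terminalY) ℚ.+ (f (just mid) ℚ.+ (f nothing ℚ.+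
    (∑ℚ (f ∘ just ∘ nearX) ℚ.+ ∑ℚ (f ∘ just ∘ nearY)))))

  -- Composing with the coding of V gives a permutation between `Fin N` and `Fin n`, so the sum is
  -- reordered without transport along an equation n = N.
  ∑-transfer : ∀ {n} (iso : Fin n ↔ V) (f : V → ℚ) → ∑ℚ (f ∘ Inverse.to iso) ≡ ∑V f
  ∑-transfer iso f = begin
    ∑ℚ (f ∘ Inverse.to iso)
      ≡⟨ ℚΣ.∑-permute (f ∘ Inverse.to iso) π ⟩
    ∑ℚ (λ i → f (Inverse.to iso (Inverse.from iso (decode i))))
      ≡⟨ ∑ℚ-cong (λ i → cong f (Inverse.strictlyInverseˡ iso (decode i))) ⟩
    ∑ℚ (f ∘ decode)
      ≡⟨ cong (λ s → f (just terminalX) ℚ.+ (f (just terminalY) ℚ.+ (f (just mid) ℚ.+ (f nothing ℚ.+ s))))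
           (trans (∑ℚ-++ (2 + j) (f ∘ near ∘ splitAt (2 + j)))
             (cong₂ ℚ._+_ (∑ℚ-cong λ i → cong (f ∘ near) (Fin.splitAt-↑ˡ (2 + j) i (2 + j)))
                          (∑ℚ-cong λ i → cong (f ∘ near) (Fin.splitAt-↑ʳ (2 + j) (2 + j) i)))) ⟩
    ∑V f ∎
    where
    open ≡-Reasoning
    π : Permutation N _
    π = mk↔ₛ′ (Inverse.from iso ∘ decode) (encode ∘ Inverse.to iso)
      (λ v → trans (cong (Inverse.from iso) (decode-encode (Inverse.to iso v))) (Inverse.strictlyInverseʳ iso v))
      (λ i → trans (cong encode (Inverse.strictlyInverseˡ iso (decode i))) (encode-decode i))

  sumAround : (V → ℚ) → V → ℚ
  sumAround f s = ∑V λ t → if adj (T (3 + j)) s t then f t else 0ℚ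

  around : (V → ℚ) → V → ℚ
  around f (just terminalX)      = f (just mid) ℚ.+ ∑ℚ (f ∘ just ∘ nearX)
  around f (just terminalY)      = f (just mid) ℚ.+ ∑ℚ (f ∘ just ∘ nearY)
  around f (just mid)            = f (just terminalX) ℚ.+ f (just terminalY)
  around f nothing               = f (just (nearX zero)) ℚ.+ f (just (nearY (suc zero)))
  around f (just (nearX i))      = f (just terminalX) ℚ.+ ((if wNeighbour (nearX i) then f nothing else 0ℚ) ℚ.+ f (just (nearY i)))
  around f (just (nearY i))      = f (just terminalY) ℚ.+ ((if wNeighbour (nearY i) then f nothing else 0ℚ) ℚ.+ f (just (nearX i)))

  sumAround≡ : ∀ f s → sumAround f s ≡ around f s
  sumAround≡ f s = at s
    where
    open +-*-Solver
    0s : ∑ℚ {2 + j} (λ _ → 0ℚ) ≡ 0ℚ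
    0s = ∑ℚ-zero (2 + j)
    at : ∀ s → sumAround f s ≡ around f s
    at (just terminalX) = trans (cong (λ z → 0ℚ ℚ.+ (0ℚ ℚ.+ (f (just mid) ℚ.+ (0ℚ ℚ.+ (∑ℚ (f ∘ just ∘ nearX) ℚ.+ z))))) 0s)
      (solve 2 (λ p q → con 0ℚ :+ (con 0ℚ :+ (p :+ (con 0ℚ :+ (q :+ con 0ℚ)))) := p :+ q) refl (f (just mid)) (∑ℚ (f ∘ just ∘ nearX)))
    at (just terminalY) = trans (cong (λ z → 0ℚ ℚ.+ (0ℚ ℚ.+ (f (just mid) ℚ.+ (0ℚ ℚ.+ (z ℚ.+ ∑ℚ (f ∘ just ∘ nearY)))))) 0s)
      (solve 2 (λ p q → con 0ℚ :+ (con 0ℚ :+ (p :+ (con 0ℚ :+ (con 0ℚ :+ q)))) := p :+ q) refl (f (just mid)) (∑ℚ (f ∘ just ∘ nearY)))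
    at (just mid) = trans (cong (λ z → f (just terminalX) ℚ.+ (f (just terminalY) ℚ.+ (0ℚ ℚ.+ (0ℚ ℚ.+ (z ℚ.+ z))))) 0s)
      (solve 2 (λ p q → p :+ (q :+ (con 0ℚ :+ (con 0ℚ :+ (con 0ℚ :+ con 0ℚ)))) := p :+ q) refl (f (just terminalX)) (f (just terminalY)))
    at nothing = trans (cong₂ (λ z z′ → 0ℚ ℚ.+ (0ℚ ℚ.+ (0ℚ ℚ.+ (0ℚ ℚ.+ ((f (just (nearX zero)) ℚ.+ z) ℚ.+ (0ℚ ℚ.+ (f (just (nearY (suc zero))) ℚ.+ z′))))))) (∑ℚ-zero (1 + j)) (∑ℚ-zero j))
      (solve 2 (λ p q → con 0ℚ :+ (con 0ℚ :+ (con 0ℚ :+ (con 0ℚ :+ ((p :+ con 0ℚ) :+ (con 0ℚ :+ (q :+ con 0ℚ)))))) := p :+ q) refl (f (just (nearX zero))) (f (just (nearY (suc zero)))))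
    at (just (nearX i)) = trans (cong₂ (λ z z′ → f (just terminalX) ℚ.+ (0ℚ ℚ.+ (0ℚ ℚ.+ (W ℚ.+ (z ℚ.+ z′))))) 0s
        (trans (∑ℚ-cong λ t → cong (if_then f (just (nearY t)) else 0ℚ) (Bool.∨-identityʳ ⌊ i Fin.≟ t ⌋)) (∑ℚ-diagonal i (f ∘ just ∘ nearY))))
      (solve 3 (λ p w q → p :+ (con 0ℚ :+ (con 0ℚ :+ (w :+ (con 0ℚ :+ q)))) := p :+ (w :+ q)) refl (f (just terminalX)) W (f (just (nearY i))))
      where W = if wNeighbour (nearX i) then f nothing else 0ℚ
    at (just (nearY i)) = trans (cong₂ (λ z z′ → 0ℚ ℚ.+ (f (just terminalY) ℚ.+ (0ℚ ℚ.+ (W ℚ.+ (z ℚ.+ z′)))))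
        (∑ℚ-diagonal′ i (f ∘ just ∘ nearX)) 0s)
      (solve 3 (λ p w q → con 0ℚ :+ (p :+ (con 0ℚ :+ (w :+ (q :+ con 0ℚ)))) := p :+ (w :+ q)) refl (f (just terminalY)) W (f (just (nearX i))))
      where W = if wNeighbour (nearY i) then f nothing else 0ℚ

  -- For E = z - 2 and F = E (E - 1) - 3, the vector with these entries satisfies
  -- the eigenvalue equation for z everywhere except at the terminals.
  E F terminal middle close partner ordinary outer : ℚ → ℚ
  E z = z ℚ.- two
  F z = E z ℚ.* (E z ℚ.- 1ℚ) ℚ.- three
  terminal z = E z ℚ.* (F z ℚ.* (E z ℚ.- 1ℚ))
  middle   z = two ℚ.* (F z ℚ.* (E z ℚ.- 1ℚ))
  close    z = (E z ℚ.+ 1ℚ) ℚ.* (E z ℚ.* (E z ℚ.- 1ℚ))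
  partner  z = (E z ℚ.- 1ℚ) ℚ.* (F z ℚ.+ (E z ℚ.+ 1ℚ))
  ordinary z = E z ℚ.* F z
  outer    z = two ℚ.* ((E z ℚ.+ 1ℚ) ℚ.* (E z ℚ.- 1ℚ))

  entries : ∀ {ℓ} {A : Set ℓ} → (terminal middle close partner ordinary outer : A) → V → A
  entries t m c p o w (just terminalX)             = t
  entries t m c p o w (just terminalY)             = t
  entries t m c p o w (just mid)                   = m
  entries t m c p o w nothing                      = w
  entries t m c p o w (just (nearX zero))          = c
  entries t m c p o w (just (nearX (suc zero)))    = p
  entries t m c p o w (just (nearX (suc (suc _)))) = o
  entries t m c p o w (just (nearY zero))          = p
  entries t m c p o w (just (nearY (suc zero)))    = c
  entries t m c p o w (just (nearY (suc (suc _)))) = o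

  entries-elim : ∀ {a p} {A : Set a} (P : A → Set p) {t m c r o w} →
    P t → P m → P c → P r → P o → P w → ∀ s → P (entries t m c r o w s)
  entries-elim P t m c r o w (just terminalX)             = t
  entries-elim P t m c r o w (just terminalY)             = t
  entries-elim P t m c r o w (just mid)                   = m
  entries-elim P t m c r o w nothing                      = w
  entries-elim P t m c r o w (just (nearX zero))          = c
  entries-elim P t m c r o w (just (nearX (suc zero)))    = r
  entries-elim P t m c r o w (just (nearX (suc (suc _)))) = o
  entries-elim P t m c r o w (just (nearY zero))          = r
  entries-elim P t m c r o w (just (nearY (suc zero)))    = c
  entries-elim P t m c r o w (just (nearY (suc (suc _)))) = o

  value : ℚ → V → ℚ
  value z = entries (terminal z) (middle z) (close z) (partner z) (ordinary z) (outer z)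

  defect : ℚ → V → ℚ
  defect z = entries (quinticℚ (two ℚ.* (three ℚ.+ ι j) ℚ.+ two) z) 0ℚ 0ℚ 0ℚ 0ℚ 0ℚ

  -- At the vertices `close`, eliminating `outer` and `partner` from the equations leaves F · close
  -- = (E + 1) · terminal; this is where F comes from. With E F (E - 1) as terminal entry no
  -- denominators remain, and the equation at a terminal becomes the quintic.
  eigenEquation : ∀ z s → around (λ _ → 1ℚ) s ℚ.* value z s ℚ.+ around (value z) s ℚ.+ defect z s ≡ z ℚ.* value z s
  eigenEquation z s = at s
    where
    open +-*-Solver
    E′ F′ t′ m′ c′ p′ o′ w′ : ∀ {n} → Polynomial n → Polynomial n
    E′ z = z :- con two
    F′ z = E′ z :* (E′ z :- con 1ℚ) :- con three
    t′ z = E′ z :* (F′ z :* (E′ z :- con 1ℚ))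
    m′ z = con two :* (F′ z :* (E′ z :- con 1ℚ))
    c′ z = (E′ z :+ con 1ℚ) :* (E′ z :* (E′ z :- con 1ℚ))
    p′ z = (E′ z :- con 1ℚ) :* (F′ z :+ (E′ z :+ con 1ℚ))
    o′ z = E′ z :* F′ z
    w′ z = con two :* ((E′ z :+ con 1ℚ) :* (E′ z :- con 1ℚ))
    quintic′ : ∀ {n} → Polynomial n → Polynomial n → Polynomial n
    quintic′ n z =
         z :* (z :* (z :* (z :* (z :* con 1ℚ))))
      :- con ½ :* (n :+ con (+ 18 ℚ./ 1)) :* (z :* (z :* (z :* (z :* con 1ℚ))))
      :+ con (+ 3 ℚ./ 2) :* (con (+ 3 ℚ./ 1) :* n :+ con (+ 16 ℚ./ 1)) :* (z :* (z :* (z :* con 1ℚ)))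
      :- con ½ :* (con (+ 27 ℚ./ 1) :* n :+ con (+ 20 ℚ./ 1)) :* (z :* (z :* con 1ℚ))
      :+ con (+ 4 ℚ./ 1) :* (con (+ 4 ℚ./ 1) :* n :- con (+ 9 ℚ./ 1)) :* z
      :- con (+ 6 ℚ./ 1) :* n
      :+ con (+ 24 ℚ./ 1)
    terminal-equation : ∀ {ones ordinaries} → ones ≡ ι j ℚ.* 1ℚ → ordinaries ≡ ι j ℚ.* ordinary z → ∀ {first second} →
      first ℚ.+ second ≡ close z ℚ.+ partner z →
      (1ℚ ℚ.+ (1ℚ ℚ.+ (1ℚ ℚ.+ ones))) ℚ.* terminal z ℚ.+ (middle z ℚ.+ (first ℚ.+ (second ℚ.+ ordinaries)))
        ℚ.+ quinticℚ (two ℚ.* (three ℚ.+ ι j) ℚ.+ two) z ≡ z ℚ.* terminal z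
    terminal-equation refl refl {first} {second} eq = trans
      (cong (λ s → (1ℚ ℚ.+ (1ℚ ℚ.+ (1ℚ ℚ.+ ι j ℚ.* 1ℚ))) ℚ.* terminal z ℚ.+ (middle z ℚ.+ s) ℚ.+ quinticℚ (two ℚ.* (three ℚ.+ ι j) ℚ.+ two) z)
        (trans (sym (ℚ.+-assoc first second (ι j ℚ.* ordinary z))) (cong (ℚ._+ ι j ℚ.* ordinary z) eq)))
      (solve 2 (λ j z → (con 1ℚ :+ (con 1ℚ :+ (con 1ℚ :+ j :* con 1ℚ))) :* t′ z :+ (m′ z :+ (c′ z :+ p′ z :+ j :* o′ z))
          :+ quintic′ (con two :* (con three :+ j) :+ con two) z := z :* t′ z) refl (ι j) z)
    at : ∀ s → around (λ _ → 1ℚ) s ℚ.* value z s ℚ.+ around (value z) s ℚ.+ defect z s ≡ z ℚ.* value z s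
    at (just terminalX) = terminal-equation (∑ℚ-const j 1ℚ) (∑ℚ-const j (ordinary z)) {close z} {partner z} refl
    at (just terminalY) = terminal-equation (∑ℚ-const j 1ℚ) (∑ℚ-const j (ordinary z)) {partner z} {close z} (ℚ.+-comm (partner z) (close z))
    at (just mid) = solve 1 (λ z → (con 1ℚ :+ con 1ℚ) :* m′ z :+ (t′ z :+ t′ z) :+ con 0ℚ := z :* m′ z) refl z
    at nothing = solve 1 (λ z → (con 1ℚ :+ con 1ℚ) :* w′ z :+ (c′ z :+ c′ z) :+ con 0ℚ := z :* w′ z) refl z
    at (just (nearX zero)) = solve 1 (λ z → (con 1ℚ :+ (con 1ℚ :+ con 1ℚ)) :* c′ z :+ (t′ z :+ (w′ z :+ p′ z)) :+ con 0ℚ := z :* c′ z) refl z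
    at (just (nearX (suc zero))) = solve 1 (λ z → (con 1ℚ :+ (con 0ℚ :+ con 1ℚ)) :* p′ z :+ (t′ z :+ (con 0ℚ :+ c′ z)) :+ con 0ℚ := z :* p′ z) refl z
    at (just (nearX (suc (suc i)))) = solve 1 (λ z → (con 1ℚ :+ (con 0ℚ :+ con 1ℚ)) :* o′ z :+ (t′ z :+ (con 0ℚ :+ o′ z)) :+ con 0ℚ := z :* o′ z) refl z
    at (just (nearY zero)) = solve 1 (λ z → (con 1ℚ :+ (con 0ℚ :+ con 1ℚ)) :* p′ z :+ (t′ z :+ (con 0ℚ :+ c′ z)) :+ con 0ℚ := z :* p′ z) refl z
    at (just (nearY (suc zero))) = solve 1 (λ z → (con 1ℚ :+ (con 1ℚ :+ con 1ℚ)) :* c′ z :+ (t′ z :+ (w′ z :+ p′ z)) :+ con 0ℚ := z :* c′ z) refl z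
    at (just (nearY (suc (suc i)))) = solve 1 (λ z → (con 1ℚ :+ (con 0ℚ :+ con 1ℚ)) :* o′ z :+ (t′ z :+ (con 0ℚ :+ o′ z)) :+ con 0ℚ := z :* o′ z) refl z

  -- F is the critical factor: it is -1 at z = 4 and 3 at z = 5. Expanding around 5 shows that it
  -- stays positive.
  positive-entries : ∀ {z} → + 5 ℚ./ 1 ℚ.≤ z → ∀ s → 0ℚ ℚ.< value z s
  positive-entries {z} 5≤z = entries-elim (0ℚ ℚ.<_)
    (0<* 0<E (0<* 0<F 0<E-1)) (0<* 0<two (0<* 0<F 0<E-1)) (0<* 0<E+1 (0<* 0<E 0<E-1))
    (0<* 0<E-1 (0<+ 0<F (ℚ.<⇒≤ 0<E+1))) (0<* 0<E 0<F) (0<* 0<two (0<* 0<E+1 0<E-1))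
    where
    open +-*-Solver
    t : ℚ
    t = z ℚ.- + 5 ℚ./ 1
    0≤t : 0ℚ ℚ.≤ t
    0≤t = 0≤-diff 5≤z
    0<E-1 : 0ℚ ℚ.< E z ℚ.- 1ℚ
    0<E-1 = subst (0ℚ ℚ.<_) (identity z) (0<+ (ℚ.positive⁻¹ two) 0≤t)
      where
      identity : ∀ z → two ℚ.+ (z ℚ.- + 5 ℚ./ 1) ≡ z ℚ.- two ℚ.- 1ℚ
      identity = solve 1 (λ z → con two :+ (z :- con (+ 5 ℚ./ 1)) := z :- con two :- con 1ℚ) refl
    0<E : 0ℚ ℚ.< E z
    0<E = subst (0ℚ ℚ.<_) (identity z) (0<+ (ℚ.positive⁻¹ three) 0≤t)
      where
      identity : ∀ z → three ℚ.+ (z ℚ.- + 5 ℚ./ 1) ≡ z ℚ.- two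
      identity = solve 1 (λ z → con three :+ (z :- con (+ 5 ℚ./ 1)) := z :- con two) refl
    0<E+1 : 0ℚ ℚ.< E z ℚ.+ 1ℚ
    0<E+1 = 0<+ 0<E (ℚ.nonNegative⁻¹ 1ℚ)
    0<F : 0ℚ ℚ.< F z
    0<F = subst (0ℚ ℚ.<_) (identity z) (0<+ (ℚ.positive⁻¹ three) (0≤* 0≤t (ℚ.<⇒≤ (0<+ (ℚ.positive⁻¹ (+ 5 ℚ./ 1)) 0≤t))))
      where
      identity : ∀ z → let t = z ℚ.- + 5 ℚ./ 1 in three ℚ.+ t ℚ.* (+ 5 ℚ./ 1 ℚ.+ t) ≡ (z ℚ.- two) ℚ.* (z ℚ.- two ℚ.- 1ℚ) ℚ.- three
      identity = solve 1 (λ z → let t = z :- con (+ 5 ℚ./ 1) in con three :+ t :* (con (+ 5 ℚ./ 1) :+ t) := (z :- con two) :* (z :- con two :- con 1ℚ) :- con three) refl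
    0<two : 0ℚ ℚ.< two
    0<two = ℚ.positive⁻¹ two

  -- The expansion around z = 5 is 18 + 45t + 34t² + 10t³ + t⁴. A uniform bound away from zero is
  -- what shows that the limit vector is nonzero.
  1≤terminal : ∀ {z} → + 5 ℚ./ 1 ℚ.≤ z → 1ℚ ℚ.≤ terminal z
  1≤terminal {z} 5≤z = ≤-by _ (horner 17 (horner 45 (horner 34 (horner 10 (ℚ.nonNegative⁻¹ 1ℚ))))) (identity z)
    where
    open +-*-Solver
    0≤t : 0ℚ ℚ.≤ z ℚ.- + 5 ℚ./ 1
    0≤t = 0≤-diff 5≤z
    horner : ∀ c {p} → 0ℚ ℚ.≤ p → 0ℚ ℚ.≤ + c ℚ./ 1 ℚ.+ (z ℚ.- + 5 ℚ./ 1) ℚ.* p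
    horner c 0≤p = subst (λ i → 0ℚ ℚ.≤ i ℚ.+ _) (ι-def c) (ℚ.+-mono-≤ {0ℚ} {ι c} {0ℚ} (0≤ι c) (0≤* 0≤t 0≤p))
    identity : ∀ z → let t = z ℚ.- + 5 ℚ./ 1 in terminal z ≡
      1ℚ ℚ.+ (+ 17 ℚ./ 1 ℚ.+ t ℚ.* (+ 45 ℚ./ 1 ℚ.+ t ℚ.* (+ 34 ℚ./ 1 ℚ.+ t ℚ.* (+ 10 ℚ./ 1 ℚ.+ t ℚ.* 1ℚ))))
    identity = solve 1 (λ z → let t = z :- con (+ 5 ℚ./ 1) ; e = z :- con two in
      e :* ((e :* (e :- con 1ℚ) :- con three) :* (e :- con 1ℚ)) :=
      con 1ℚ :+ (con (+ 17 ℚ./ 1) :+ t :* (con (+ 45 ℚ./ 1) :+ t :* (con (+ 34 ℚ./ 1) :+ t :* (con (+ 10 ℚ./ 1) :+ t :* con 1ℚ))))) refl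

  -- Built from real operations in the shape of `value`, so that its approximations are the values
  -- at the approximations of z by computation.
  valueℝ : ℝ → V → ℝ
  valueℝ z = entries (e *ℝ (f *ℝ (e -ℝ 1ℝ))) (twoℝ *ℝ (f *ℝ (e -ℝ 1ℝ))) ((e +ℝ 1ℝ) *ℝ (e *ℝ (e -ℝ 1ℝ)))
      ((e -ℝ 1ℝ) *ℝ (f +ℝ (e +ℝ 1ℝ))) (e *ℝ f) (twoℝ *ℝ ((e +ℝ 1ℝ) *ℝ (e -ℝ 1ℝ)))
    where
    twoℝ e f : ℝ
    twoℝ = fromℚ two
    e = z -ℝ twoℝ
    f = e *ℝ (e -ℝ 1ℝ) -ℝ fromℚ three

  seq-valueℝ : ∀ z m s → seq (valueℝ z s) m ≡ value (seq z m) s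
  seq-valueℝ z m (just terminalX)             = refl
  seq-valueℝ z m (just terminalY)             = refl
  seq-valueℝ z m (just mid)                   = refl
  seq-valueℝ z m nothing                      = refl
  seq-valueℝ z m (just (nearX zero))          = refl
  seq-valueℝ z m (just (nearX (suc zero)))    = refl
  seq-valueℝ z m (just (nearX (suc (suc _)))) = refl
  seq-valueℝ z m (just (nearY zero))          = refl
  seq-valueℝ z m (just (nearY (suc zero)))    = refl
  seq-valueℝ z m (just (nearY (suc (suc _)))) = refl

  module _ {n} (n≡ : ι n ≡ two ℚ.* (three ℚ.+ ι j) ℚ.+ two) (G : Graph (Fin n)) (G≅T : G ≅ T (3 + j)) where
    open Laplacian G

    private
      to : Fin n → V
      to = Inverse.to (proj₁ G≅T)

    neighbourSum≡around : ∀ f i → neighbourSum (f ∘ to) i ≡ around f (to i)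
    neighbourSum≡around f i = begin
      ∑ℚ (λ j → if adj G i j then f (to j) else 0ℚ)
        ≡⟨ ∑ℚ-cong (λ j → cong (if_then f (to j) else 0ℚ) (proj₂ G≅T i j)) ⟩
      ∑ℚ ((λ t → if adj (T (3 + j)) (to i) t then f t else 0ℚ) ∘ to)
        ≡⟨ ∑-transfer (proj₁ G≅T) (λ t → if adj (T (3 + j)) (to i) t then f t else 0ℚ) ⟩
      sumAround f (to i)
        ≡⟨ sumAround≡ f (to i) ⟩
      around f (to i) ∎
      where open ≡-Reasoning

    equation : ∀ z i → ι (degree G i) ℚ.* value z (to i) ℚ.+ neighbourSum (value z ∘ to) i ℚ.+ defect z (to i) ≡ z ℚ.* value z (to i)
    equation z i = trans
      (cong₂ (λ p q → p ℚ.* value z (to i) ℚ.+ q ℚ.+ defect z (to i))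
        (trans (ι-degree i) (neighbourSum≡around (λ _ → 1ℚ) i)) (neighbourSum≡around (value z) i))
      (eigenEquation z (to i))

    -- The defect is then nonnegative at every vertex, so `value z` is a positive vector with Q x ≤
    -- z x.
    eigenvalue-upper : ∀ z → + 5 ℚ./ 1 ℚ.≤ z → 0ℚ ℚ.≤ quinticℚ (ι n) z →
      ∀ {q} → IsEigenvalue (signlessLaplacian G) q → q ≤ℝ fromℚ z
    eigenvalue-upper z 5≤z 0≤quintic {q} = eigenvalue≤ℚ (value z ∘ to) z (λ i → positive-entries 5≤z (to i))
      (λ i → ≤-by (defect z (to i)) (0≤defect (to i)) (sym (equation z i))) {q}
      where
      0≤quintic′ : 0ℚ ℚ.≤ quinticℚ (two ℚ.* (three ℚ.+ ι j) ℚ.+ two) z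
      0≤quintic′ = subst (λ n → 0ℚ ℚ.≤ quinticℚ n z) n≡ 0≤quintic
      0≤defect : ∀ s → 0ℚ ℚ.≤ defect z s
      0≤defect = entries-elim (0ℚ ℚ.≤_) 0≤quintic′ ℚ.≤-refl ℚ.≤-refl ℚ.≤-refl ℚ.≤-refl ℚ.≤-refl

    ∣defect∣≤ : ∀ z b → ∣ quinticℚ (ι n) z ∣ ℚ.≤ b → ∀ s → ∣ defect z s ∣ ℚ.≤ b
    ∣defect∣≤ z b ∣quintic∣≤b = entries-elim (λ d → ∣ d ∣ ℚ.≤ b) ∣quintic∣≤b′ 0≤b 0≤b 0≤b 0≤b 0≤b
      where
      ∣quintic∣≤b′ : ∣ quinticℚ (two ℚ.* (three ℚ.+ ι j) ℚ.+ two) z ∣ ℚ.≤ b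
      ∣quintic∣≤b′ = subst (λ n → ∣ quinticℚ n z ∣ ℚ.≤ b) n≡ ∣quintic∣≤b
      0≤b : 0ℚ ℚ.≤ b
      0≤b = ℚ.≤-trans (ℚ.0≤∣p∣ (quinticℚ (ι n) z)) ∣quintic∣≤b

    -- The defect at each approximation of z is bounded by the value of the quintic there, which
    -- tends to zero; hence the eigenvalue equation holds in the limit.
    root⇒eigenvalue : ∀ z → fromℚ (+ 6 ℚ./ 1) ≤ℝ z → quintic n z ≃ 0ℝ → IsEigenvalue (signlessLaplacian G) z
    root⇒eigenvalue z 6≤z root = v , nonzero , eigen
      where
      v : Fin n → ℝ
      v i = valueℝ z (to i)

      nonzero : ¬ (∀ i → v i ≃ 0ℝ)
      nonzero v≃0 = ℚ.<-irrefl refl (ℚ.<-≤-trans ½<1 (begin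
        1ℚ                                       ≤⟨ 1≤terminal 5≤zM ⟩
        terminal (seq z M)                       ≡⟨ trans (cong (value (seq z M)) (sym (Inverse.strictlyInverseˡ (proj₁ G≅T) (just terminalX)))) (sym (seq-valueℝ z M (to i₀))) ⟩
        seq (v i₀) M                             ≤⟨ p≤∣p∣ (seq (v i₀) M) ⟩
        ∣ seq (v i₀) M ∣                         ≡⟨ cong ∣_∣ (sym (ℚ.+-identityʳ (seq (v i₀) M))) ⟩
        ∣ seq (v i₀) M ℚ.- 0ℚ ∣                  ≤⟨ proj₂ small M (ℕ.m≤m⊔n (proj₁ small) (proj₁ large)) ⟩
        ½                                        ∎))
        where
        open ℚ.≤-Reasoning
        open +-*-Solver using (solve; con; _:+_; _:-_; _:=_)
        ½<1 : ½ ℚ.< 1ℚ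
        ½<1 = <-by ½ (ℚ.positive⁻¹ ½) refl
        i₀ : Fin n
        i₀ = Inverse.from (proj₁ G≅T) (just terminalX)
        small = v≃0 i₀ ½ (ℚ.positive⁻¹ ½)
        -- The slack 1 turns the real inequality 6 ≤ z into the bound 5 for all late approximations.
        large = 6≤z 1ℚ (ℚ.positive⁻¹ 1ℚ)
        M : ℕ
        M = proj₁ small ⊔ proj₁ large
        5≤zM : + 5 ℚ./ 1 ℚ.≤ seq z M
        5≤zM = ≤-by _ (0≤-diff (proj₂ large M (ℕ.m≤n⊔m (proj₁ small) (proj₁ large)))) (identity (seq z M))
          where
          identity : ∀ z → z ≡ + 5 ℚ./ 1 ℚ.+ (z ℚ.+ 1ℚ ℚ.- + 6 ℚ./ 1)
          identity = solve 1 (λ z → z := con (+ 5 ℚ./ 1) :+ (z :+ con 1ℚ :- con (+ 6 ℚ./ 1))) refl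

      image : ∀ i m → seq (sum (λ j → signlessLaplacian G i j *ℝ v j)) m ≡
        ι (degree G i) ℚ.* value (seq z m) (to i) ℚ.+ neighbourSum (value (seq z m) ∘ to) i
      image i m = begin
        seq (sum (λ j → signlessLaplacian G i j *ℝ v j)) m
          ≡⟨ seq-sum (λ j → signlessLaplacian G i j *ℝ v j) m ⟩
        ∑ℚ (λ j → seq (signlessLaplacian G i j) m ℚ.* seq (v j) m)
          ≡⟨ ∑ℚ-cong (λ j → cong₂ ℚ._*_ (seq-entry i j m) (seq-valueℝ z m (to j))) ⟩
        ∑ℚ (λ j → entry i j ℚ.* value (seq z m) (to j))
          ≡⟨ row (value (seq z m) ∘ to) i ⟩
        ι (degree G i) ℚ.* value (seq z m) (to i) ℚ.+ neighbourSum (value (seq z m) ∘ to) i ∎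
        where open ≡-Reasoning

      eigen : ∀ i → sum (λ j → signlessLaplacian G i j *ℝ v j) ≃ z *ℝ v i
      eigen i ε 0<ε = proj₁ (root ε 0<ε) , λ m N≤m → subst (ℚ._≤ ε) (sym (difference m))
        (∣defect∣≤ (seq z m) ε (subst (ℚ._≤ ε)
          (cong ∣_∣ (trans (ℚ.+-identityʳ (seq (quintic n z) m)) (seq-quintic n z m)))
          (proj₂ (root ε 0<ε) m N≤m)) (to i))
        where
        open +-*-Solver using (solve; _:+_; _:-_; :-_; _:=_)
        cancel : ∀ p d → p ℚ.- (p ℚ.+ d) ≡ ℚ.- d
        cancel = solve 2 (λ p d → p :- (p :+ d) := :- d) refl
        difference : ∀ m → ∣ seq (sum (λ j → signlessLaplacian G i j *ℝ v j)) m ℚ.- seq z m ℚ.* seq (v i) m ∣ ≡ ∣ defect (seq z m) (to i) ∣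
        difference m = trans
          (cong ∣_∣ (trans (cong₂ ℚ._-_ (image i m) (trans (cong (seq z m ℚ.*_) (seq-valueℝ z m (to i))) (sym (equation (seq z m) i)))) (cancel (ι (degree G i) ℚ.* value (seq z m) (to i) ℚ.+ neighbourSum (value (seq z m) ∘ to) i) (defect (seq z m) (to i)))))
          (ℚ.∣-p∣≡∣p∣ (defect (seq z m) (to i)))

-- The largest root of the quintic

-- A second reading of the same syntax, which carries inequalities checked coefficientwise over ℕ to
-- signs of the rational quintic.
⟦_⟧ℚ : ∀ {m} → Expr m → Vec ℚ m → ℚ
⟦ lit c ⟧ℚ ρ = + c ℚ./ 1
⟦ arg i ⟧ℚ ρ = lookup ρ i
⟦ e ⊞ f ⟧ℚ ρ = ⟦ e ⟧ℚ ρ ℚ.+ ⟦ f ⟧ℚ ρ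
⟦ e ⊠ f ⟧ℚ ρ = ⟦ e ⟧ℚ ρ ℚ.* ⟦ f ⟧ℚ ρ

ι-⟦⟧ : ∀ {m} (e : Expr m) ρ → ι (⟦ e ⟧ ρ) ≡ ⟦ e ⟧ℚ (map ι ρ)
ι-⟦⟧ (lit c) ρ = ι-def c
ι-⟦⟧ (arg i) ρ = sym (lookup-map i ι ρ)
ι-⟦⟧ (e ⊞ f) ρ = trans (ι-+ (⟦ e ⟧ ρ) (⟦ f ⟧ ρ)) (cong₂ ℚ._+_ (ι-⟦⟧ e ρ) (ι-⟦⟧ f ρ))
ι-⟦⟧ (e ⊠ f) ρ = trans (ι-* (⟦ e ⟧ ρ) (⟦ f ⟧ ρ)) (cong₂ ℚ._*_ (ι-⟦⟧ e ρ) (ι-⟦⟧ f ρ))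

-- For n = 2k + 2 and z = N / D, these are the terms of D⁵ quintic(z) with
-- positive and with negative coefficients.
positivePart negativePart : Expr 3
positivePart = N ⊠ N ⊠ N ⊠ N ⊠ N ⊞ (lit 9 ⊠ K ⊞ lit 33) ⊠ (N ⊠ N ⊠ N ⊠ D ⊠ D)
    ⊞ lit 32 ⊠ K ⊠ (N ⊠ D ⊠ D ⊠ D ⊠ D) ⊞ lit 12 ⊠ (D ⊠ D ⊠ D ⊠ D ⊠ D)
  where K = arg 0F ; D = arg 1F ; N = arg 2F
negativePart = (K ⊞ lit 10) ⊠ (N ⊠ N ⊠ N ⊠ N ⊠ D) ⊞ (lit 27 ⊠ K ⊞ lit 37) ⊠ (N ⊠ N ⊠ D ⊠ D ⊠ D)
    ⊞ lit 4 ⊠ (N ⊠ D ⊠ D ⊠ D ⊠ D) ⊞ lit 12 ⊠ K ⊠ (D ⊠ D ⊠ D ⊠ D ⊠ D)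
  where K = arg 0F ; D = arg 1F ; N = arg 2F

-- On the right z occurs only inside the product d z, so a natural numerator can be substituted for
-- it.
quintic-parts : ∀ k d z → d ℚ.* d ℚ.* d ℚ.* d ℚ.* d ℚ.* quinticℚ (two ℚ.* k ℚ.+ two) z ≡
  ⟦ positivePart ⟧ℚ (k ∷ d ∷ d ℚ.* z ∷ []) ℚ.- ⟦ negativePart ⟧ℚ (k ∷ d ∷ d ℚ.* z ∷ [])
quintic-parts = solve 3 (λ k d z → let n = con two :* k :+ con two ; N = d :* z in
     d :* d :* d :* d :* d :*
     (  z :* (z :* (z :* (z :* (z :* con 1ℚ))))
     :- con ½ :* (n :+ con (+ 18 ℚ./ 1)) :* (z :* (z :* (z :* (z :* con 1ℚ))))
     :+ con (+ 3 ℚ./ 2) :* (con (+ 3 ℚ./ 1) :* n :+ con (+ 16 ℚ./ 1)) :* (z :* (z :* (z :* con 1ℚ)))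
     :- con ½ :* (con (+ 27 ℚ./ 1) :* n :+ con (+ 20 ℚ./ 1)) :* (z :* (z :* con 1ℚ))
     :+ con (+ 4 ℚ./ 1) :* (con (+ 4 ℚ./ 1) :* n :- con (+ 9 ℚ./ 1)) :* z
     :- con (+ 6 ℚ./ 1) :* n
     :+ con (+ 24 ℚ./ 1))
     := (N :* N :* N :* N :* N :+ (con (+ 9 ℚ./ 1) :* k :+ con (+ 33 ℚ./ 1)) :* (N :* N :* N :* d :* d)
          :+ con (+ 32 ℚ./ 1) :* k :* (N :* d :* d :* d :* d) :+ con (+ 12 ℚ./ 1) :* (d :* d :* d :* d :* d))
       :- ((k :+ con (+ 10 ℚ./ 1)) :* (N :* N :* N :* N :* d) :+ (con (+ 27 ℚ./ 1) :* k :+ con (+ 37 ℚ./ 1)) :* (N :* N :* d :* d :* d)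
          :+ con (+ 4 ℚ./ 1) :* (N :* d :* d :* d :* d) :+ con (+ 12 ℚ./ 1) :* k :* (d :* d :* d :* d :* d))) refl
  where open +-*-Solver

module Sign {k D N : ℕ} (1≤D : 1 ≤ D) {z : ℚ} (Dz≡N : ι D ℚ.* z ≡ ι N) where

  private
    ρ : Vec ℕ 3
    ρ = k ∷ D ∷ N ∷ []

    d : ℚ
    d = ι D

    0<d : 0ℚ ℚ.< d
    0<d = 0<ι D {{>-nonZero 1≤D}}

    0<d⁵ : 0ℚ ℚ.< d ℚ.* d ℚ.* d ℚ.* d ℚ.* d
    0<d⁵ = 0<* (0<* (0<* (0<* 0<d 0<d) 0<d) 0<d) 0<d

    parts : d ℚ.* d ℚ.* d ℚ.* d ℚ.* d ℚ.* quinticℚ (two ℚ.* ι k ℚ.+ two) z ≡ ι (⟦ positivePart ⟧ ρ) ℚ.- ι (⟦ negativePart ⟧ ρ)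
    parts = trans (quintic-parts (ι k) d z)
      (trans (cong (λ t → ⟦ positivePart ⟧ℚ (ι k ∷ d ∷ t ∷ []) ℚ.- ⟦ negativePart ⟧ℚ (ι k ∷ d ∷ t ∷ [])) Dz≡N)
        (sym (cong₂ ℚ._-_ (ι-⟦⟧ positivePart ρ) (ι-⟦⟧ negativePart ρ))))

  quintic≤0 : ⟦ positivePart ⟧ ρ ≤ ⟦ negativePart ⟧ ρ → quinticℚ (two ℚ.* ι k ℚ.+ two) z ℚ.≤ 0ℚ
  quintic≤0 p≤n = *-cancelˡ 0<d⁵ (begin
    d ℚ.* d ℚ.* d ℚ.* d ℚ.* d ℚ.* quinticℚ (two ℚ.* ι k ℚ.+ two) z  ≡⟨ parts ⟩
    ι (⟦ positivePart ⟧ ρ) ℚ.- ι (⟦ negativePart ⟧ ρ)               ≤⟨ ℚ.+-monoˡ-≤ (ℚ.- ι (⟦ negativePart ⟧ ρ)) (ι-mono p≤n) ⟩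
    ι (⟦ negativePart ⟧ ρ) ℚ.- ι (⟦ negativePart ⟧ ρ)               ≡⟨ ℚ.+-inverseʳ (ι (⟦ negativePart ⟧ ρ)) ⟩
    0ℚ                                                              ≡⟨ sym (ℚ.*-zeroʳ (d ℚ.* d ℚ.* d ℚ.* d ℚ.* d)) ⟩
    d ℚ.* d ℚ.* d ℚ.* d ℚ.* d ℚ.* 0ℚ                                ∎)
    where open ℚ.≤-Reasoning

  0≤quintic : ⟦ negativePart ⟧ ρ ≤ ⟦ positivePart ⟧ ρ → 0ℚ ℚ.≤ quinticℚ (two ℚ.* ι k ℚ.+ two) z
  0≤quintic n≤p = *-cancelˡ 0<d⁵ (begin
    d ℚ.* d ℚ.* d ℚ.* d ℚ.* d ℚ.* 0ℚ                                ≡⟨ ℚ.*-zeroʳ (d ℚ.* d ℚ.* d ℚ.* d ℚ.* d) ⟩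
    0ℚ                                                              ≤⟨ 0≤-diff (ι-mono n≤p) ⟩
    ι (⟦ positivePart ⟧ ρ) ℚ.- ι (⟦ negativePart ⟧ ρ)               ≡⟨ sym parts ⟩
    d ℚ.* d ℚ.* d ℚ.* d ℚ.* d ℚ.* quinticℚ (two ℚ.* ι k ℚ.+ two) z  ∎)
    where open ℚ.≤-Reasoning

fraction : ∀ {D N} → 1 ≤ D → 1 ≤ N → Σ[ z ∈ ℚ ] ι D ℚ.* z ≡ ι N
fraction {D} {N} 1≤D 1≤N =
  let z , _ , Dz≡N = scale (ι D) (ι N) (0<ι D {{>-nonZero 1≤D}}) (0<ι N {{>-nonZero 1≤N}}) in z , Dz≡N

ι-mono-< : ∀ {m n} → m < n → ι m ℚ.< ι n
ι-mono-< {m} {n} m<n = ℚ.<-≤-trans (<-by 1ℚ (ℚ.positive⁻¹ 1ℚ) (trans (ι-suc m) (ℚ.+-comm 1ℚ (ι m)))) (ι-mono m<n)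

fraction-< : ∀ {D N D′ N′ z z′} → 1 ≤ D → 1 ≤ D′ → ι D ℚ.* z ≡ ι N → ι D′ ℚ.* z′ ≡ ι N′ → D′ * N < D * N′ → z ℚ.< z′
fraction-< {D} {N} {D′} {N′} {z} {z′} 1≤D 1≤D′ Dz D′z′ cross = ℚ.*-cancelˡ-<-nonNeg (ι D′ ℚ.* ι D)
  {{ℚ.nonNegative (0≤* (0≤ι D′) (0≤ι D))}} (begin-strict
    ι D′ ℚ.* ι D ℚ.* z      ≡⟨ trans (ℚ.*-assoc (ι D′) (ι D) z) (trans (cong (ι D′ ℚ.*_) Dz) (sym (ι-* D′ N))) ⟩
    ι (D′ * N)              <⟨ ι-mono-< cross ⟩
    ι (D * N′)              ≡⟨ trans (ι-* D N′) (trans (cong (ι D ℚ.*_) (sym D′z′)) (sym (ℚ.*-assoc (ι D) (ι D′) z′))) ⟩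
    ι D ℚ.* ι D′ ℚ.* z′     ≡⟨ cong (ℚ._* z′) (ℚ.*-comm (ι D) (ι D′)) ⟩
    ι D′ ℚ.* ι D ℚ.* z′     ∎)
  where open ℚ.≤-Reasoning

-- The denominator and numerator of k + 1 + 6 / (2k - 1), which lies strictly
-- between k + 1 + 3/k and the largest root.
lowerD lowerN : ℕ → ℕ
lowerD k = k + (k ∸ 1)
lowerN k = (k + 1) * lowerD k + 6

module _ {k : ℕ} (22≤k : 22 ≤ k) where

  private
    k≡ : k ≡ 1 + (k ∸ 1)
    k≡ = sym (ℕ.m+[n∸m]≡n (ℕ.≤-trans (s≤s z≤n) 22≤k))

    k-1≥21 : 21 ≤ k ∸ 1
    k-1≥21 = ℕ.∸-monoˡ-≤ 1 22≤k

    Kₛ Dₛ Nₛ : Expr 1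
    Kₛ = lit 1 ⊞ arg 0F
    Dₛ = Kₛ ⊞ arg 0F
    Nₛ = (Kₛ ⊞ lit 1) ⊠ Dₛ ⊞ lit 6

    lowerDefs : Defines (k ∸ 1 ∷ []) (k ∷ lowerD k ∷ lowerN k ∷ []) (Kₛ ∷ Dₛ ∷ Nₛ ∷ [])
    lowerDefs = k≡ ∷ D≡ ∷ cong₂ (λ s t → (s + 1) * t + 6) k≡ D≡ ∷ []
      where
      D≡ : lowerD k ≡ 1 + (k ∸ 1) + (k ∸ 1)
      D≡ = cong (_+ (k ∸ 1)) k≡

  lower-sign : ⟦ positivePart ⟧ (k ∷ lowerD k ∷ lowerN k ∷ []) ≤ ⟦ negativePart ⟧ (k ∷ lowerD k ∷ lowerN k ∷ [])
  lower-sign = byCoefficients lowerDefs (k-1≥21 ∷ []) positivePart negativePart refl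

  upper-sign : ⟦ negativePart ⟧ (k ∷ 1 ∷ k + 4 ∷ []) ≤ ⟦ positivePart ⟧ (k ∷ 1 ∷ k + 4 ∷ [])
  upper-sign = byCoefficients {ρ = k ∷ []} {σ = arg 0F ∷ lit 1 ∷ arg 0F ⊞ lit 4 ∷ []}
    (refl ∷ refl ∷ refl ∷ []) (22≤k ∷ []) negativePart positivePart refl

  certificate<lower : lowerD k * (k * k + k + 3) < k * lowerN k
  certificate<lower = byCoefficients lowerDefs (k-1≥21 ∷ [])
    (lit 1 ⊞ arg 1F ⊠ (arg 0F ⊠ arg 0F ⊞ arg 0F ⊞ lit 3)) (arg 0F ⊠ arg 2F) refl

  lower<upper : 1 * lowerN k < lowerD k * (k + 4)
  lower<upper = byCoefficients lowerDefs (k-1≥21 ∷ [])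
    (lit 1 ⊞ lit 1 ⊠ arg 2F) (arg 1F ⊠ (arg 0F ⊞ lit 4)) refl

  6<lower : lowerD k * 6 < 1 * lowerN k
  6<lower = byCoefficients lowerDefs (k-1≥21 ∷ [])
    (lit 1 ⊞ arg 1F ⊠ lit 6) (lit 1 ⊠ arg 2F) refl

-- Comparison of q with the largest root

module _ {n} (G : Graph (Fin n)) where

  connected⇒1≤degree : Connected G → ∀ {u v} → u ≢ v → 1 ≤ degree G u
  connected⇒1≤degree connected {u} {v} u≢v with connected u v
  ... | Star.ε = contradiction refl u≢v
  ... | _◅_ {j = w} u~w _ = ℕ.≤-trans (ℕ.≤-reflexive (sym (a-adj G u~w)))
    (ℕ.≤-trans (term≤∑ (a G u) w) (ℕ.≤-reflexive (sym (degree-∑ G u))))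

distinct : ∀ {n} → 2 ≤ n → (u : Fin n) → ∃[ v ] u ≢ v
distinct (s≤s (s≤s _)) zero    = suc zero , λ ()
distinct (s≤s (s≤s _)) (suc u) = zero , λ ()

module _ (k n : ℕ) (22≤k : 22 ≤ k) (n≡ : n ≡ 2 * k + 2) (G : Graph (Fin n)) (connected : Connected G)
         (free : Free (C₃ ∷ C₄ ∷ []) G) (noPendant : ∀ v → ¬ IsPendant G v) (q q′ : ℝ)
         (q-radius : IsSignlessLaplacianSpectralRadius G q) (q′-root : IsLargestRoot (quintic n) q′) where

  private
    1≤k : 1 ≤ k
    1≤k = ℕ.≤-trans (s≤s z≤n) 22≤k

    2≤n : 2 ≤ n
    2≤n = subst (2 ≤_) (sym n≡) (ℕ.m≤n+m 2 (2 * k))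

    2≤degree : ∀ v → 2 ≤ degree G v
    2≤degree v = ℕ.≤∧≢⇒< (connected⇒1≤degree G connected (proj₂ (distinct 2≤n v))) (noPendant v ∘ sym)

    1≤D : 1 ≤ lowerD k
    1≤D = ℕ.≤-trans 1≤k (ℕ.m≤m+n k (k ∸ 1))

    lowerFraction : Σ[ z ∈ ℚ ] ι (lowerD k) ℚ.* z ≡ ι (lowerN k)
    lowerFraction = fraction 1≤D (ℕ.≤-trans (s≤s z≤n) (ℕ.m≤n+m 6 ((k + 1) * lowerD k)))

    certificateFraction : Σ[ z ∈ ℚ ] ι k ℚ.* z ≡ ι (k * k + k + 3)
    certificateFraction = fraction 1≤k (ℕ.≤-trans (s≤s z≤n) (ℕ.m≤n+m 3 (k * k + k)))

    lower upper : ℚ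
    lower = proj₁ lowerFraction
    upper = ι (k + 4)

    upper-fraction : ι 1 ℚ.* upper ≡ ι (k + 4)
    upper-fraction = trans (cong (ℚ._* upper) ι-1) (ℚ.*-identityˡ upper)

    ιn≡ : ι n ≡ two ℚ.* ι k ℚ.+ two
    ιn≡ = begin
      ι n                        ≡⟨ cong ι n≡ ⟩
      ι (2 * k + 2)              ≡⟨ trans (ι-+ (2 * k) 2) (cong (ℚ._+ ι 2) (ι-* 2 k)) ⟩
      ι 2 ℚ.* ι k ℚ.+ ι 2        ≡⟨ cong (λ t → t ℚ.* ι k ℚ.+ t) (ι-def 2) ⟩
      two ℚ.* ι k ℚ.+ two        ∎
      where open ≡-Reasoning

    module B = Bisection (quinticℚ (ι n)) lower upper
      (fraction-< 1≤D (s≤s z≤n) (proj₂ lowerFraction) upper-fraction (lower<upper 22≤k))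
      (subst (λ n → quinticℚ n lower ℚ.≤ 0ℚ) (sym ιn≡) (Sign.quintic≤0 1≤D (proj₂ lowerFraction) (lower-sign 22≤k)))
      (subst (λ n → 0ℚ ℚ.≤ quinticℚ n upper) (sym ιn≡) (Sign.0≤quintic {k} {1} {k + 4} (s≤s z≤n) upper-fraction (upper-sign 22≤k)))

    -- Maximality of q′ is applied to the root found by bisection; through it every rational lower
    -- bound reaches q′.
    root≤q′ : B.root ≤ℝ q′
    root≤q′ = proj₂ q′-root B.root (B.isRoot (quintic n) (seq-quintic n))

    lower≤q′ : fromℚ lower ≤ℝ q′
    lower≤q′ = ≤ℝ-trans {fromℚ lower} {B.root} {q′} B.lo₀≤root root≤q′

    fromℚ-mono : ∀ {s t} → s ℚ.≤ t → fromℚ s ≤ℝ fromℚ t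
    fromℚ-mono s≤t ε 0<ε = 0 , λ _ _ → ℚ.≤-trans s≤t (≤-by ε (ℚ.<⇒≤ 0<ε) refl)

    6≤lower : + 6 ℚ./ 1 ℚ.≤ lower
    6≤lower = ℚ.<⇒≤ (fraction-< {1} {6} (s≤s z≤n) 1≤D
      (trans (cong (ℚ._* (+ 6 ℚ./ 1)) ι-1) (trans (ℚ.*-identityˡ (+ 6 ℚ./ 1)) (sym (ι-def 6)))) (proj₂ lowerFraction) (6<lower 22≤k))

    5≤hi : ∀ m → + 5 ℚ./ 1 ℚ.≤ B.Bracket.hi (B.bracket m)
    5≤hi m = ℚ.≤-trans (≤-by 1ℚ (ℚ.nonNegative⁻¹ 1ℚ) refl) (ℚ.≤-trans 6≤lower
      (ℚ.≤-trans (proj₁ (B.nested {0} {m} (ℕ.≤⇒≤′ z≤n))) (B.Bracket.lo≤hi (B.bracket m))))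

  -- The strict gap is kept between rationals: an equality q ≃ q′ would give `lower` ≤ ℓ and
  -- contradict it.
  certificate⇒< : Certificate G k → Σ[ ℓ ∈ ℚ ] (ℓ ℚ.< lower × q ≤ℝ fromℚ ℓ)
  certificate⇒< c = proj₁ certificateFraction ,
    fraction-< 1≤k 1≤D (proj₂ certificateFraction) (proj₂ lowerFraction) (certificate<lower 22≤k) ,
    Laplacian.certificate⇒eigenvalue≤ G 1≤k c (proj₁ certificateFraction) (proj₂ certificateFraction) {q} (proj₁ q-radius)

  -- The quintic is nonnegative at the upper end of every bracket, which therefore bounds q; hence q
  -- is at most the bisection root, and so at most q′. Conversely q′ exceeds 6, so it is itself an
  -- eigenvalue and at most q.
  isomorphic⇒≃ : G ≅ T k → q ≃ q′
  isomorphic⇒≃ G≅T = ≤ℝ-antisym {q} {q′}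
    (≤ℝ-trans {q} {B.root} {q′} (B.≤root {q} λ m → Spectrum.eigenvalue-upper (k ∸ 3) ιn≡′ G G≅T′ (B.Bracket.hi (B.bracket m)) (5≤hi m)
      (B.Bracket.0≤f[hi] (B.bracket m)) {q} (proj₁ q-radius)) root≤q′)
    (proj₂ q-radius q′ (Spectrum.root⇒eigenvalue (k ∸ 3) ιn≡′ G G≅T′ q′
      (≤ℝ-trans {fromℚ (+ 6 ℚ./ 1)} {fromℚ lower} {q′} (fromℚ-mono 6≤lower) lower≤q′) (proj₁ q′-root)))
    where
    k≡ : k ≡ 3 + (k ∸ 3)
    k≡ = sym (ℕ.m+[n∸m]≡n (ℕ.≤-trans (s≤s (s≤s (s≤s z≤n))) 22≤k))
    ιk≡ : ι k ≡ + 3 ℚ./ 1 ℚ.+ ι (k ∸ 3)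
    ιk≡ = trans (cong ι k≡) (trans (ι-+ 3 (k ∸ 3)) (cong (ℚ._+ ι (k ∸ 3)) (ι-def 3)))
    ιn≡′ : ι n ≡ two ℚ.* (+ 3 ℚ./ 1 ℚ.+ ι (k ∸ 3)) ℚ.+ two
    ιn≡′ = trans ιn≡ (cong (λ t → two ℚ.* t ℚ.+ two) ιk≡)
    G≅T′ : G ≅ T (3 + (k ∸ 3))
    G≅T′ = subst (λ k → G ≅ T k) k≡ G≅T

  spectralBound : (q ≤ℝ q′) × ((q ≃ q′) ⇔ (G ≅ T k))
  spectralBound = conclude (Setting.certificate-or-isomorphism k n 22≤k n≡ G free 2≤degree)
    where
    conclude : Certificate G k ⊎ G ≅ T k → (q ≤ℝ q′) × ((q ≃ q′) ⇔ (G ≅ T k))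
    conclude (inj₂ G≅T) = ≃⇒≤ {q} {q′} (isomorphic⇒≃ G≅T) , mk⇔ (λ _ → G≅T) isomorphic⇒≃
    conclude (inj₁ c) =
      ≤ℝ-trans {q} {fromℚ ℓ} {q′} q≤ℓ (≤ℝ-trans {fromℚ ℓ} {fromℚ lower} {q′} (fromℚ-mono (ℚ.<⇒≤ ℓ<lower)) lower≤q′) ,
      mk⇔ (λ q≃q′ → ⊥-elim (ℚ.<-irrefl refl (ℚ.<-≤-trans ℓ<lower (fromℚ-cancel-≤
            (≤ℝ-trans {fromℚ lower} {q′} {fromℚ ℓ} lower≤q′
              (≤ℝ-trans {q′} {q} {fromℚ ℓ} (≃⇒≤ {q′} {q} (≃-sym {q} {q′} q≃q′)) q≤ℓ))))))
          isomorphic⇒≃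
      where
      ℓ = proj₁ (certificate⇒< c)
      ℓ<lower = proj₁ (proj₂ (certificate⇒< c))
      q≤ℓ = proj₂ (proj₂ (certificate⇒< c))

theorem3p2 : (k n : ℕ) → 22 ≤ k → n ≡ 2 * k + 2 →
    (G : Graph (Fin n)) →
    Connected G →
    Free (C₃ ∷ C₄ ∷ []) G →
    (∀ v → ¬ IsPendant G v) →
    (q q′ : ℝ) →
    IsSignlessLaplacianSpectralRadius G q →
    IsLargestRoot (quintic n) q′ →
    (q ≤ℝ q′) × ((q ≃ q′) ⇔ (G ≅ T ((n ∸ 2) / 2)))
theorem3p2 k n 22≤k n≡ G connected free noPendant q q′ q-radius q′-root =
  subst (λ r → (q ≤ℝ q′) × ((q ≃ q′) ⇔ (G ≅ T r))) (sym r≡k)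
    (spectralBound k n 22≤k n≡ G connected free noPendant q q′ q-radius q′-root)
  where
  r≡k : (n ∸ 2) / 2 ≡ k
  r≡k = trans (cong (λ n → (n ∸ 2) / 2) n≡)
    (trans (cong (_/ 2) (trans (ℕ.m+n∸n≡m (2 * k) 2) (ℕ.*-comm 2 k))) (m*n/n≡m k 2))
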